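{- Let $p$ be a prime, $G$ a finite additive abelian $p$-group, and $h,\Delta\in\{0,1,2,\ldots\}$. Let $A=\{a_s(n_s)\}_{s=1}^k$ (with $a_s\in\mathbb Z$, $n_s\in\mathbb Z^+$) be a $(d^*(G)+p^h+\Delta)$-cover of $\mathbb Z$. Let $m_1,\ldots,m_k\in\mathbb Z$, $c,c_1,\ldots,c_k\in G$ and $\alpha\in\mathbb Q$, and set $$\mathcal I=\Big\{I\subseteq\{1,\ldots,k\}:\ \sum_{s\in I}c_s=c\ \text{and}\ \sum_{s\in I}\frac{m_s}{n_s}\in\alpha+p^h\mathbb Z\Big\}.$$ For $I\subseteq\{1,\ldots,k\}$ write $P(I)=P([\![1\in I]\!],\ldots,[\![k\in I]\!])$. Let $d\in\mathbb Z^+$ and let $P(x_1,\ldots,x_k)\in\mathbb Q[x_1,\ldots,x_k]$ have degree at most $d$, such that $P(I)\in\mathbb Z$ for every $I\subseteq\{1,\ldots,k\}$ with $\sum_{s\in I}m_s/n_s-\alpha\in\mathbb Z$. Then either $$\big|\{P(I)\bmod p:\ I\in\mathcal I\}\big|>1+\frac{\Delta}{d},$$ or both $|\{I\in\mathcal I: p\mid P(I)\}|\ne 1$ and $$\sum_{\substack{I\in\mathcal I\\ p\mid P(I)}}(-1)^{|I|}e^{2\pi i\sum_{s\in I}a_sm_s/n_s}\equiv 0\pmod p,$$ where the last congruence is in the ring $\Omega$ of algebraic integers (i.e., the left side lies in $p\Omega$).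
   Context: $[\![P]\!]$ denotes $1$ if the statement $P$ holds and $0$ otherwise. For $a\in\mathbb Z$ and $n\in\mathbb Z^+$, $a(n)=a+n\mathbb Z$. For $A=\{a_s(n_s)\}_{s=1}^k$, $w_A(x)=|\{1\le s\le k: x\in a_s(n_s)\}|$; $A$ is an $m$-cover of $\mathbb Z$ if $w_A(x)\ge m$ for all $x\in\mathbb Z$. For a finite abelian group $G$ with $|G|>1$, write $G\cong\mathbb Z_{d_1}\oplus\cdots\oplus\mathbb Z_{d_r}$ with $1<d_1\mid d_2\mid\cdots\mid d_r$ and set $d^*(G)=\sum_{i=1}^r(d_i-1)$; if $|G|=1$ set $d^*(G)=0$. For algebraic integers $\omega_1,\omega_2,\gamma$, $\omega_1\equiv\omega_2\pmod\gamma$ means $\omega_1-\omega_2\in\gamma\Omega$. -}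

module Defs where

open import Data.Bool using (Bool; true; false; if_then_else_; _∧_)
open import Data.Nat as ℕ using (ℕ; zero; suc; NonZero; _∸_)
import Data.Nat.Divisibility as ℕD
open import Data.Integer as ℤ using (ℤ; +_; -[1+_]; ∣_∣)
import Data.Integer.DivMod as ℤDM
import Data.Bool.ListAction as BLA
open import Data.Rational as ℚ using (ℚ)
open import Data.Fin using (Fin; zero; suc; toℕ)
open import Data.Vec using (Vec; []; _∷_; lookup)
open import Data.List as L using (List; []; _∷_; _++_; length; filterᵇ)
open import Data.List.Relation.Unary.All using (All)
open import Data.Product using (_×_; _,_; ∃; proj₁; proj₂)
open import Relation.Nullary using (does)
open import Relation.Binary.PropositionalEquality using (_≡_)

sumℕ : ∀ {k} → (Fin k → ℕ) → ℕ
sumℕ {zero}  f = 0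
sumℕ {suc k} f = f zero ℕ.+ sumℕ (λ i → f (suc i))

prodℕ : ∀ {k} → (Fin k → ℕ) → ℕ
prodℕ {zero}  f = 1
prodℕ {suc k} f = f zero ℕ.* prodℕ (λ i → f (suc i))

sumℤ : ∀ {k} → (Fin k → ℤ) → ℤ
sumℤ {zero}  f = + 0
sumℤ {suc k} f = f zero ℤ.+ sumℤ (λ i → f (suc i))

sumℚ : ∀ {k} → (Fin k → ℚ) → ℚ
sumℚ {zero}  f = ℚ.0ℚ
sumℚ {suc k} f = f zero ℚ.+ sumℚ (λ i → f (suc i))

prodℚ : ∀ {k} → (Fin k → ℚ) → ℚ
prodℚ {zero}  f = ℚ.1ℚ
prodℚ {suc k} f = f zero ℚ.* prodℚ (λ i → f (suc i))

allB : ∀ {k} → (Fin k → Bool) → Bool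
allB {zero}  f = true
allB {suc k} f = f zero ∧ allB (λ i → f (suc i))

dvdB : ℕ → ℤ → Bool
dvdB n z = does (n ℕD.∣? ∣ z ∣)

Subset : ℕ → Set
Subset k = Vec Bool k

allSubsets : (k : ℕ) → List (Subset k)
allSubsets zero    = [] ∷ []
allSubsets (suc k) = L.map (false ∷_) (allSubsets k) ++ L.map (true ∷_) (allSubsets k)

card : ∀ {k} → Subset k → ℕ
card I = sumℕ (λ s → if lookup I s then 1 else 0)

w : ∀ {k} → (Fin k → ℤ) → (Fin k → ℕ) → ℤ → ℕ
w a n x = sumℕ (λ s → if dvdB (n s) (x ℤ.- a s) then 1 else 0)

IsCover : ∀ {k} → ℕ → (Fin k → ℤ) → (Fin k → ℕ) → Set
IsCover M a n = ∀ (x : ℤ) → M ℕ.≤ w a n x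

-- The finite abelian group G ≅ ℤ_{d_1} ⊕ ⋯ ⊕ ℤ_{d_r} (invariant factors d)
-- Elements are represented by integer vectors; equality is componentwise
-- congruence modulo d_i.

Grp : ℕ → Set
Grp r = Fin r → ℤ

eqGB : ∀ {r} → (Fin r → ℕ) → Grp r → Grp r → Bool
eqGB dG x y = allB (λ i → dvdB (dG i) (x i ℤ.- y i))

sumG : ∀ {r k} → (Fin k → Grp r) → Subset k → Grp r
sumG cs I i = sumℤ (λ s → if lookup I s then cs s i else + 0)

dstar : ∀ {r} → (Fin r → ℕ) → ℕ
dstar dG = sumℕ (λ i → dG i ∸ 1)

isIntB : ℚ → Bool
isIntB q = does (ℚ.denominatorℕ q ℕ.≟ 1)

inMultB : ℕ → ℚ → Bool
inMultB N q = isIntB q ∧ dvdB N (ℚ.numerator q)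

IsInt : ℚ → Set
IsInt q = isIntB q ≡ true

ratSum : ∀ {k} → (Fin k → ℤ) → (n : Fin k → ℕ) → (∀ s → NonZero (n s)) → Subset k → ℚ
ratSum m n nz I = sumℚ (λ s → if lookup I s then ℚ._/_ (m s) (n s) {{nz s}} else ℚ.0ℚ)

Poly : ℕ → Set
Poly k = List (ℚ × (Fin k → ℕ))

DegLe : ∀ {k} → ℕ → Poly k → Set
DegLe d P = All (λ t → sumℕ (proj₂ t) ℕ.≤ d) P

powℚ : ℚ → ℕ → ℚ
powℚ q zero    = ℚ.1ℚ
powℚ q (suc e) = q ℚ.* powℚ q e

evalP : ∀ {k} → Poly k → (Fin k → ℚ) → ℚ
evalP []            x = ℚ.0ℚ
evalP ((c , e) ∷ P) x = c ℚ.* prodℚ (λ s → powℚ (x s) (e s)) ℚ.+ evalP P x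

evalSub : ∀ {k} → Poly k → Subset k → ℚ
evalSub P I = evalP P (λ s → if lookup I s then ℚ.1ℚ else ℚ.0ℚ)

-- Integer polynomials (coefficient lists, lowest degree first)

ZPoly : Set
ZPoly = List ℤ

addP : ZPoly → ZPoly → ZPoly
addP []       q        = q
addP (x ∷ p)  []       = x ∷ p
addP (x ∷ p)  (y ∷ q)  = (x ℤ.+ y) ∷ addP p q

scaleP : ℤ → ZPoly → ZPoly
scaleP c = L.map (c ℤ.*_)

mulP : ZPoly → ZPoly → ZPoly
mulP []      q = []
mulP (x ∷ p) q = addP (scaleP x q) (+ 0 ∷ mulP p q)

powP : ZPoly → ℕ → ZPoly
powP y zero    = + 1 ∷ []
powP y (suc e) = mulP y (powP y e)

monoP : ℤ → ℕ → ZPoly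
monoP c e = L.replicate e (+ 0) ++ (c ∷ [])

-- equality of polynomials (up to trailing zeros)
PolyEq : ZPoly → ZPoly → Set
PolyEq p q = All (_≡ + 0) (addP p (scaleP (ℤ.- (+ 1)) q))

-- Möbius function (via Σ_{d ∣ n} μ(d) = [n = 1]), fuel-bounded recursion

properDivisors : ℕ → List ℕ
properDivisors n = filterᵇ (λ d → does (d ℕD.∣? n)) (L.drop 1 (L.upTo n))

sumListℤ : List ℤ → ℤ
sumListℤ = L.foldr ℤ._+_ (+ 0)

μf : ℕ → ℕ → ℤ
μf fuel    1 = + 1
μf zero    n = + 0
μf (suc f) n = ℤ.- sumListℤ (L.map (μf f) (properDivisors n))

μ : ℕ → ℤ
μ n = μf n n

divisors : ℕ → List ℕ
divisors n = filterᵇ (λ d → does (d ℕD.∣? n)) (L.drop 1 (L.upTo (suc n)))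

xpm1 : ℕ → ZPoly
xpm1 e = addP (monoP (+ 1) e) (monoP (ℤ.- (+ 1)) 0)

prodListP : List ZPoly → ZPoly
prodListP = L.foldr mulP (+ 1 ∷ [])

-- Φ_N = ∏_{d∣N} (X^d − 1)^{μ(N/d)} = B_N / C_N  with
-- B_N = ∏_{d∣N, μ(N/d)=1} (X^d−1),  C_N = ∏_{d∣N, μ(N/d)=−1} (X^d−1)
-- truncated division (divisor 0 ↦ 0; only used with nonzero divisors)
divℕ : ℕ → ℕ → ℕ
divℕ x zero    = 0
divℕ x (suc y) = x ℕ./ suc y

-- positive divisors of N (empty for N = 0; only used with N ≥ 1)
divisorsNZ : ℕ → List ℕ
divisorsNZ zero     = []
divisorsNZ (suc N') = divisors (suc N')

cycNum cycDen : ℕ → ZPoly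
cycNum N = prodListP (L.map xpm1 (filterᵇ (λ d → does (μ (divℕ N d) ℤ.≟ + 1)) (divisorsNZ N)))
cycDen N = prodListP (L.map xpm1 (filterᵇ (λ d → does (μ (divℕ N d) ℤ.≟ ℤ.- (+ 1))) (divisorsNZ N)))

-- y(ζ_N) = 0 for ζ_N = e^{2πi/N}, i.e. Φ_N ∣ y in ℤ[X] (⇔ B_N ∣ y·C_N)
VanishesAtζ : ℕ → ZPoly → Set
VanishesAtζ N y = ∃ λ (q : ZPoly) → PolyEq (mulP y (cycDen N)) (mulP q (cycNum N))

-- y(ζ_N) ∈ p Ω : y(ζ_N)/p is a root of a monic polynomial
-- f(Y) = Y^t + c_{t-1} Y^{t-1} + ⋯ + c_0 ∈ ℤ[Y]; multiplying f(y/p)=0 by p^t: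
-- y^t + Σ_{i<t} c_i p^{t−i} y^i vanishes at ζ_N.
InPΩ : ℕ → ℕ → ZPoly → Set
InPΩ N p y = ∃ λ (t : ℕ) → ∃ λ (c : Vec ℤ t) →
  VanishesAtζ N (addP (powP y t)
    (sumPs (L.map (λ i → scaleP (lookup c i ℤ.* (+ (p ℕ.^ (t ∸ toℕ i)))) (powP y (toℕ i))) (L.allFin t))))
  where
  sumPs : List ZPoly → ZPoly
  sumPs = L.foldr addP []

inℐB : ∀ {r k} → (p h : ℕ) → (dG : Fin r → ℕ) → (c : Grp r) → (cs : Fin k → Grp r)
     → (m : Fin k → ℤ) → (n : Fin k → ℕ) → (∀ s → NonZero (n s)) → (α : ℚ) → Subset k → Bool
inℐB p h dG c cs m n nz α I =
  eqGB dG (sumG cs I) c ∧ inMultB (p ℕ.^ h) (ratSum m n nz I ℚ.- α)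

residueCount : ∀ {k} → (p : ℕ) → (Subset k → Bool) → Poly k → ℕ
residueCount {k} p ℐ P =
  length (filterᵇ (λ ρ → BLA.any (λ I → ℐ I ∧ inMultB p (evalSub P I ℚ.- (ℚ._/_ (+ ρ) 1))) (allSubsets k))
                  (L.upTo p))

ℐp : ∀ {k} → (p : ℕ) → (Subset k → Bool) → Poly k → List (Subset k)
ℐp {k} p ℐ P = filterᵇ (λ I → ℐ I ∧ inMultB p (evalSub P I)) (allSubsets k)

neg1pow : ℕ → ℤ
neg1pow zero    = + 1
neg1pow (suc e) = ℤ.- neg1pow e

-- residue of an integer modulo N (N ≥ 1 in all uses)
resid : ℤ → ℕ → ℕ
resid e zero    = 0
resid e (suc N) = ℤDM._%ℕ_ e (suc N)

-- N = ∏ n_s; e^{2πi Σ_{s∈I} a_s m_s / n_s} = ζ_N^{E(I)}, E(I) = Σ_{s∈I} a_s m_s (N / n_s)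
expo : ∀ {k} → (a m : Fin k → ℤ) → (n : Fin k → ℕ) → Subset k → ℤ
expo a m n I = sumℤ (λ s → if lookup I s then a s ℤ.* m s ℤ.* (+ divℕ (prodℕ n) (n s)) else + 0)

-- Σ_{I ∈ list} (−1)^{|I|} X^{E(I) mod N}, an element of ℤ[X] evaluated at ζ_N
rootSum : ∀ {k} → (a m : Fin k → ℤ) → (n : Fin k → ℕ) → List (Subset k) → ZPoly
rootSum a m n Is = L.foldr addP []
  (L.map (λ I → monoP (neg1pow (card I)) (resid (expo a m n I) (prodℕ n))) Is)

module Submission where

-- Let D = d*(G) + p^h + Δ. If g is a function of degree < D on the subsets of {1,…,k} and z_s = 1 for at
-- least D indices s, then Σ_I (−1)^|I| g(I) ∏_{s∈I} z_s = 0. Apply this to z_s = ζ^((a_s − x) m_s N/n_s) for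
-- every x and average over x mod N with weights ζ^(xA): the part of Σ_I (−1)^|I| g(I) ζ^(E(I)) with
-- Σ_{s∈I} m_s/n_s ∈ α + ℤ vanishes. Take for g the product of C(Σ_{s∈I} c_s − c − 1, d_i − 1) over the
-- coordinates i of G, of C(Σ_{s∈I} m_s/n_s − α − 1, p^h − 1), and of P(I) − ρ over the nonzero residues ρ
-- attained by P on ℐ. When q is a power of p, C(x − 1, q − 1) is ≡ (−1)^(q−1) or ≡ 0 mod p according to
-- whether q divides x or not, so modulo p only the I ∈ ℐ with p ∣ P(I) survive, all with the same unit u.
--
-- Vanishing at ζ_N is divisibility by Φ_N, which is built together with Φ_L(X) ∣ Φ_L(X^q) by adding one
-- prime at a time.

open import Defs
open import Level using (0ℓ)
open import Data.Nat as ℕ using (ℕ; zero; suc; NonZero)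
open import Data.Integer as ℤ using (ℤ; +_)
open import Data.Integer.Tactic.RingSolver using (solve-∀)
open import Data.Bool using (Bool; true; false; if_then_else_; _∧_)
open import Data.Fin as Fin using (Fin; zero; suc; toℕ)
open import Data.List as L using (List; []; _∷_; _++_; filterᵇ)
open import Data.Product using (_,_; ∃; _×_; proj₁; proj₂)
open import Data.Sum using (_⊎_; inj₁; inj₂)
open import Data.Empty using (⊥-elim)
open import Function using (_∘_; id)
open import Relation.Nullary using (¬_; Dec; yes; no; does)
open import Relation.Binary.PropositionalEquality as ≡ using (_≡_; _≢_; cong; cong₂; subst)
import Data.Nat.Properties as ℕP
import Data.Nat.Divisibility as ℕD
import Data.Integer.Properties as ℤP
import Relation.Binary.Reasoning.Setoid as SR

-- The average over x answers the form of the hypothesis on P: P(I) is known to be an integer only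
-- when Σ_{s∈I} m_s/n_s ∈ α + ℤ, so reduction modulo p makes sense only once the other subsets are
-- gone. The function g has degree at most d*(G) + (p^h - 1) + d·r, with r the number of nonzero
-- residues. If some I ∈ ℐ has p ∣ P(I), there are r + 1 residues in all; when the first alternative
-- fails this gives d·r ≤ Δ, and the degree is below D, the multiplicity of the cover.
--
-- In place of complex numbers, ζ is the class of X in ℤ[X]/Φ_N. Vanishing at ζ_N is stated through
-- the quotient B_N / C_N, so a polynomial Φ with Φ·C_N = B_N has to be produced. Since B_N and C_N
-- are monic with deg C_N < deg B_N, the ring ℤ[ζ] has no torsion and p is not a unit in it.
-- Divisibility by p in ℤ[ζ] becomes the statement about Ω because every element of ℤ[ζ] is a root
-- of a monic integer polynomial.

module ℤAlgebras where

  open import Algebra.Bundles using (CommutativeRing)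
  open import Data.Maybe using (Maybe; just; nothing)
  import Algebra.Solver.Ring
  import Algebra.Solver.Ring.AlmostCommutativeRing as ACR

  -- The map from ℤ is carried as data, so that each ring supplies its natural one (constant
  -- polynomials for ℤ[X], `fromℤ` for ℚ) and the ring solver can use integer coefficients in all of
  -- them.
  record ℤAlgebra : Set₁ where
    field
      commRing : CommutativeRing 0ℓ 0ℓ
    open CommutativeRing commRing public
    field
      ι   : ℤ → Carrier
      ι-+ : ∀ a b → ι (a ℤ.+ b) ≈ ι a + ι b
      ι-* : ∀ a b → ι (a ℤ.* b) ≈ ι a * ι b
      ι-neg : ∀ a → ι (ℤ.- a) ≈ - ι a
      ι-0 : ι (+ 0) ≈ 0#
      ι-1 : ι (+ 1) ≈ 1#

    ι-cong : ∀ {a b} → a ≡ b → ι a ≈ ι b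
    ι-cong ≡.refl = refl

  module IntSolver (A : ℤAlgebra) where
    open ℤAlgebra A

    weakDec : ∀ a b → Maybe (ι a ≈ ι b)
    weakDec a b with a ℤ.≟ b
    ... | yes ≡.refl = just refl
    ... | no _       = nothing

    almostCommutative : ACR.AlmostCommutativeRing 0ℓ 0ℓ
    almostCommutative = ACR.fromCommutativeRing commRing

    ι-homomorphism : CommutativeRing.rawRing ℤP.+-*-commutativeRing ACR.-Raw-AlmostCommutative⟶ almostCommutative
    ι-homomorphism = record
      { ⟦_⟧ = ι ; +-homo = ι-+ ; *-homo = ι-* ; -‿homo = ι-neg ; 0-homo = ι-0 ; 1-homo = ι-1 }

    open Algebra.Solver.Ring (CommutativeRing.rawRing ℤP.+-*-commutativeRing) almostCommutative ι-homomorphism weakDec public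
      using (solve; _:+_; _:*_; _:-_; :-_; _:=_; con)

-- The ring ℤ[X] on coefficient lists.

module PolynomialRing where

  open ℤAlgebras
  open import Algebra.Bundles using (CommutativeRing)
  open import Data.List.Relation.Unary.All using (All; []; _∷_)
  open import Relation.Binary.PropositionalEquality using (refl; sym; trans)
  open ≡.≡-Reasoning

  coef : ZPoly → ℕ → ℤ
  coef []      i       = + 0
  coef (x ∷ p) zero    = x
  coef (x ∷ p) (suc i) = coef p i

  -- Lists that differ by trailing zeros are the same polynomial, hence equality by coefficients. As
  -- a record it determines `p` and `q`, which can then be inferred.
  record _≋_ (p q : ZPoly) : Set where
    constructor mk≋
    field at : ∀ i → coef p i ≡ coef q i
  open _≋_ public

  infix 4 _≋_

  negP : ZPoly → ZPoly
  negP = scaleP (ℤ.- (+ 1))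

  coef-add : ∀ p q i → coef (addP p q) i ≡ coef p i ℤ.+ coef q i
  coef-add []      q       i       = sym (ℤP.+-identityˡ _)
  coef-add (x ∷ p) []      i       = sym (ℤP.+-identityʳ _)
  coef-add (x ∷ p) (y ∷ q) zero    = refl
  coef-add (x ∷ p) (y ∷ q) (suc i) = coef-add p q i

  coef-scale : ∀ c p i → coef (scaleP c p) i ≡ c ℤ.* coef p i
  coef-scale c []      i       = sym (ℤP.*-zeroʳ c)
  coef-scale c (x ∷ p) zero    = refl
  coef-scale c (x ∷ p) (suc i) = coef-scale c p i

  coef-mul-∷ : ∀ x p q i → coef (mulP (x ∷ p) q) i ≡ x ℤ.* coef q i ℤ.+ coef (+ 0 ∷ mulP p q) i
  coef-mul-∷ x p q i = trans (coef-add (scaleP x q) _ i) (cong (ℤ._+ _) (coef-scale x q i))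

  coef-shift-cong : ∀ {p q} → (∀ i → coef p i ≡ coef q i) → ∀ i → coef (+ 0 ∷ p) i ≡ coef (+ 0 ∷ q) i
  coef-shift-cong e zero    = refl
  coef-shift-cong e (suc i) = e i

  coef-mul-congʳ : ∀ p {q r} → (∀ i → coef q i ≡ coef r i) → ∀ i → coef (mulP p q) i ≡ coef (mulP p r) i
  coef-mul-congʳ []      e i = refl
  coef-mul-congʳ (x ∷ p) {q} {r} e i = begin
    coef (mulP (x ∷ p) q) i                         ≡⟨ coef-mul-∷ x p q i ⟩
    x ℤ.* coef q i ℤ.+ coef (+ 0 ∷ mulP p q) i      ≡⟨ cong₂ ℤ._+_ (cong (x ℤ.*_) (e i))
        (coef-shift-cong {mulP p q} {mulP p r} (coef-mul-congʳ p e) i) ⟩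
    x ℤ.* coef r i ℤ.+ coef (+ 0 ∷ mulP p r) i      ≡⟨ coef-mul-∷ x p r i ⟨
    coef (mulP (x ∷ p) r) i                         ∎

  coef-mul-[] : ∀ p i → coef (mulP p []) i ≡ + 0
  coef-mul-[] []      i       = refl
  coef-mul-[] (x ∷ p) zero    = refl
  coef-mul-[] (x ∷ p) (suc i) = coef-mul-[] p i

  private
    swap-heads : ∀ x y → x ℤ.* y ℤ.+ + 0 ≡ y ℤ.* x ℤ.+ + 0
    swap-heads = solve-∀
    swap-mid : ∀ a b c → a ℤ.+ (b ℤ.+ c) ≡ b ℤ.+ (a ℤ.+ c)
    swap-mid = solve-∀

  -- `mulP` recurses on its first factor; this is the mirror image of its defining equation, and the
  -- inductive step of commutativity.
  coef-mul-∷ʳ : ∀ p y q i → coef (mulP p (y ∷ q)) i ≡ y ℤ.* coef p i ℤ.+ coef (+ 0 ∷ mulP p q) i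
  coef-mul-∷ʳ [] y q zero    = sym (trans (ℤP.+-identityʳ _) (ℤP.*-zeroʳ y))
  coef-mul-∷ʳ [] y q (suc i) = sym (trans (ℤP.+-identityʳ _) (ℤP.*-zeroʳ y))
  coef-mul-∷ʳ (x ∷ p) y q zero = trans (coef-mul-∷ x p (y ∷ q) 0) (swap-heads x y)
  coef-mul-∷ʳ (x ∷ p) y q (suc i) = begin
    coef (mulP (x ∷ p) (y ∷ q)) (suc i)
      ≡⟨ coef-mul-∷ x p (y ∷ q) (suc i) ⟩
    x ℤ.* coef q i ℤ.+ coef (mulP p (y ∷ q)) i
      ≡⟨ cong (ℤ._+_ (x ℤ.* coef q i)) (coef-mul-∷ʳ p y q i) ⟩
    x ℤ.* coef q i ℤ.+ (y ℤ.* coef p i ℤ.+ coef (+ 0 ∷ mulP p q) i)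
      ≡⟨ swap-mid (x ℤ.* coef q i) (y ℤ.* coef p i) _ ⟩
    y ℤ.* coef p i ℤ.+ (x ℤ.* coef q i ℤ.+ coef (+ 0 ∷ mulP p q) i)
      ≡⟨ cong (ℤ._+_ (y ℤ.* coef p i)) (coef-mul-∷ x p q i) ⟨
    y ℤ.* coef p i ℤ.+ coef (mulP (x ∷ p) q) i ∎

  coef-mul-comm : ∀ p q i → coef (mulP p q) i ≡ coef (mulP q p) i
  coef-mul-comm []      q i = sym (coef-mul-[] q i)
  coef-mul-comm (x ∷ p) q i = begin
    coef (mulP (x ∷ p) q) i                     ≡⟨ coef-mul-∷ x p q i ⟩
    x ℤ.* coef q i ℤ.+ coef (+ 0 ∷ mulP p q) i  ≡⟨ cong (ℤ._+_ (x ℤ.* coef q i)) (coef-shift-cong {mulP p q} {mulP q p}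
        (coef-mul-comm p q) i) ⟩
    x ℤ.* coef q i ℤ.+ coef (+ 0 ∷ mulP q p) i  ≡⟨ coef-mul-∷ʳ q x p i ⟨
    coef (mulP q (x ∷ p)) i                     ∎

  private
    add4 : ∀ a b c d → (a ℤ.+ b) ℤ.+ (c ℤ.+ d) ≡ (a ℤ.+ c) ℤ.+ (b ℤ.+ d)
    add4 = solve-∀

  coef-shift-add : ∀ p q i → coef (+ 0 ∷ addP p q) i ≡ coef (+ 0 ∷ p) i ℤ.+ coef (+ 0 ∷ q) i
  coef-shift-add p q zero    = refl
  coef-shift-add p q (suc i) = coef-add p q i

  coef-mul-distribˡ : ∀ p q r i → coef (mulP p (addP q r)) i ≡ coef (mulP p q) i ℤ.+ coef (mulP p r) i
  coef-mul-distribˡ [] q r i = refl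
  coef-mul-distribˡ (x ∷ p) q r i = begin
    coef (mulP (x ∷ p) (addP q r)) i
      ≡⟨ coef-mul-∷ x p (addP q r) i ⟩
    x ℤ.* coef (addP q r) i ℤ.+ coef (+ 0 ∷ mulP p (addP q r)) i
      ≡⟨ cong₂ ℤ._+_ (trans (cong (x ℤ.*_) (coef-add q r i)) (ℤP.*-distribˡ-+ x _ _))
           (trans (coef-shift-cong {mulP p (addP q r)} {addP (mulP p q) (mulP p r)}
                    (λ j → trans (coef-mul-distribˡ p q r j) (sym (coef-add (mulP p q) (mulP p r) j))) i)
                  (coef-shift-add (mulP p q) (mulP p r) i)) ⟩
    (x ℤ.* coef q i ℤ.+ x ℤ.* coef r i) ℤ.+ (coef (+ 0 ∷ mulP p q) i ℤ.+ coef (+ 0 ∷ mulP p r) i)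
      ≡⟨ add4 (x ℤ.* coef q i) _ _ _ ⟩
    (x ℤ.* coef q i ℤ.+ coef (+ 0 ∷ mulP p q) i) ℤ.+ (x ℤ.* coef r i ℤ.+ coef (+ 0 ∷ mulP p r) i)
      ≡⟨ cong₂ ℤ._+_ (coef-mul-∷ x p q i) (coef-mul-∷ x p r i) ⟨
    coef (mulP (x ∷ p) q) i ℤ.+ coef (mulP (x ∷ p) r) i ∎

  ≋-refl : ∀ {p} → p ≋ p
  ≋-refl = mk≋ λ i → refl

  ≋-sym : ∀ {p q} → p ≋ q → q ≋ p
  ≋-sym e = mk≋ λ i → sym (at e i)

  ≋-trans : ∀ {p q r} → p ≋ q → q ≋ r → p ≋ r
  ≋-trans e f = mk≋ λ i → trans (at e i) (at f i)

  add-cong : ∀ {p p′ q q′} → p ≋ p′ → q ≋ q′ → addP p q ≋ addP p′ q′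
  add-cong {p} {p′} {q} {q′} e f = mk≋ λ i →
    trans (coef-add p q i) (trans (cong₂ ℤ._+_ (at e i) (at f i)) (sym (coef-add p′ q′ i)))

  mul-comm : ∀ p q → mulP p q ≋ mulP q p
  mul-comm p q = mk≋ (coef-mul-comm p q)

  mul-cong : ∀ {p p′ q q′} → p ≋ p′ → q ≋ q′ → mulP p q ≋ mulP p′ q′
  mul-cong {p} {p′} {q} {q′} e f =
    ≋-trans (mk≋ (coef-mul-congʳ p (at f)))
    (≋-trans (mul-comm p q′) (≋-trans (mk≋ (coef-mul-congʳ q′ (at e))) (mul-comm q′ p′)))

  mul-distribˡ : ∀ p q r → mulP p (addP q r) ≋ addP (mulP p q) (mulP p r)
  mul-distribˡ p q r = mk≋ λ i → trans (coef-mul-distribˡ p q r i) (sym (coef-add (mulP p q) _ i))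

  mul-distribʳ : ∀ p q r → mulP (addP q r) p ≋ addP (mulP q p) (mulP r p)
  mul-distribʳ p q r = ≋-trans (mul-comm (addP q r) p)
    (≋-trans (mul-distribˡ p q r) (add-cong (mul-comm p q) (mul-comm p r)))

  private
    assoc-scale : ∀ x y a b → x ℤ.* (y ℤ.* a ℤ.+ b) ≡ (x ℤ.* y) ℤ.* a ℤ.+ x ℤ.* b
    assoc-scale = solve-∀
    scale-0 : ∀ x → + 0 ≡ x ℤ.* + 0
    scale-0 = solve-∀

  mul-scaleˡ : ∀ x p q → mulP (scaleP x p) q ≋ scaleP x (mulP p q)
  mul-scaleˡ x [] q = ≋-refl
  mul-scaleˡ x (y ∷ p) q = mk≋ λ i → begin
    coef (mulP (x ℤ.* y ∷ scaleP x p) q) i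
      ≡⟨ coef-mul-∷ (x ℤ.* y) (scaleP x p) q i ⟩
    (x ℤ.* y) ℤ.* coef q i ℤ.+ coef (+ 0 ∷ mulP (scaleP x p) q) i
      ≡⟨ cong (ℤ._+_ ((x ℤ.* y) ℤ.* coef q i)) (trans (coef-shift-cong {mulP (scaleP x p) q} {scaleP x (mulP p q)} (at
          (mul-scaleˡ x p q)) i) (shift i)) ⟩
    (x ℤ.* y) ℤ.* coef q i ℤ.+ x ℤ.* coef (+ 0 ∷ mulP p q) i
      ≡⟨ assoc-scale x y (coef q i) _ ⟨
    x ℤ.* (y ℤ.* coef q i ℤ.+ coef (+ 0 ∷ mulP p q) i)
      ≡⟨ cong (x ℤ.*_) (coef-mul-∷ y p q i) ⟨
    x ℤ.* coef (mulP (y ∷ p) q) i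
      ≡⟨ coef-scale x (mulP (y ∷ p) q) i ⟨
    coef (scaleP x (mulP (y ∷ p) q)) i ∎
    where
    shift : ∀ i → coef (+ 0 ∷ scaleP x (mulP p q)) i ≡ x ℤ.* coef (+ 0 ∷ mulP p q) i
    shift zero    = scale-0 x
    shift (suc i) = coef-scale x (mulP p q) i

  mul-shiftˡ : ∀ p q → mulP (+ 0 ∷ p) q ≋ (+ 0 ∷ mulP p q)
  mul-shiftˡ p q = mk≋ λ i → trans (coef-mul-∷ (+ 0) p q i) (ℤP.+-identityˡ (coef (+ 0 ∷ mulP p q) i))

  shift-cong : ∀ {p q} → p ≋ q → (+ 0 ∷ p) ≋ (+ 0 ∷ q)
  shift-cong {p} {q} e = mk≋ (coef-shift-cong {p} {q} (at e))

  mul-assoc : ∀ p q r → mulP (mulP p q) r ≋ mulP p (mulP q r)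
  mul-assoc [] q r = ≋-refl
  mul-assoc (x ∷ p) q r = ≋-trans (mul-distribʳ r (scaleP x q) (+ 0 ∷ mulP p q))
    (add-cong (mul-scaleˡ x q r) (≋-trans (mul-shiftˡ (mulP p q) r) (shift-cong (mul-assoc p q r))))

  mul-identityˡ : ∀ q → mulP (+ 1 ∷ []) q ≋ q
  mul-identityˡ q = mk≋ λ i → trans (coef-mul-∷ (+ 1) [] q i) (trans (cong₂ ℤ._+_ (ℤP.*-identityˡ (coef q i)) (z i))
      (ℤP.+-identityʳ (coef q i)))
    where
    z : ∀ i → coef (+ 0 ∷ []) i ≡ + 0
    z zero    = refl
    z (suc i) = refl

  scale-cong : ∀ c {p q} → p ≋ q → scaleP c p ≋ scaleP c q
  scale-cong c {p} {q} e = mk≋ λ i → trans (coef-scale c p i) (trans (cong (c ℤ.*_) (at e i)) (sym (coef-scale c q i)))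

  private
    inverse : ∀ a → (ℤ.- (+ 1)) ℤ.* a ℤ.+ a ≡ + 0
    inverse = solve-∀

  add-inverseˡ : ∀ p → addP (negP p) p ≋ []
  add-inverseˡ p = mk≋ λ i → trans (coef-add (negP p) p i) (trans (cong (ℤ._+ coef p i) (coef-scale (ℤ.- (+ 1)) p i))
      (inverse (coef p i)))

  add-comm : ∀ p q → addP p q ≋ addP q p
  add-comm p q = mk≋ λ i → trans (coef-add p q i) (trans (ℤP.+-comm (coef p i) (coef q i)) (sym (coef-add q p i)))

  add-assoc : ∀ p q r → addP (addP p q) r ≋ addP p (addP q r)
  add-assoc p q r = mk≋ λ i → trans (coef-add (addP p q) r i) (trans (cong (ℤ._+ coef r i) (coef-add p q i))
    (trans (ℤP.+-assoc (coef p i) (coef q i) (coef r i)) (sym (trans (coef-add p (addP q r) i) (cong (ℤ._+_ (coef p i))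
        (coef-add q r i))))))

  add-identityʳ : ∀ p → addP p [] ≋ p
  add-identityʳ p = ≋-trans (add-comm p []) ≋-refl

  polyRing : CommutativeRing 0ℓ 0ℓ
  polyRing = record
    { Carrier = ZPoly ; _≈_ = _≋_ ; _+_ = addP ; _*_ = mulP ; -_ = negP ; 0# = [] ; 1# = + 1 ∷ []
    ; isCommutativeRing = record
      { isRing = record
        { +-isAbelianGroup = record
          { isGroup = record
            { isMonoid = record
              { isSemigroup = record
                { isMagma = record
                  { isEquivalence = record { refl = ≋-refl ; sym = ≋-sym ; trans = ≋-trans }
                  ; ∙-cong = add-cong }
                ; assoc = add-assoc }
              ; identity = (λ p → ≋-refl) , add-identityʳ }
            ; inverse = add-inverseˡ , (λ p → ≋-trans (add-comm p (negP p)) (add-inverseˡ p))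
            ; ⁻¹-cong = scale-cong (ℤ.- (+ 1)) }
          ; comm = add-comm }
        ; *-cong = mul-cong
        ; *-assoc = mul-assoc
        ; *-identity = mul-identityˡ , (λ p → ≋-trans (mul-comm p _) (mul-identityˡ p))
        ; distrib = mul-distribˡ , mul-distribʳ }
      ; *-comm = mul-comm } }

  const : ℤ → ZPoly
  const z = z ∷ []

  polyAlg : ℤAlgebra
  polyAlg = record
    { commRing = polyRing
    ; ι = const
    ; ι-+ = λ a b → ≋-refl
    ; ι-* = λ a b → mk≋ λ { zero → sym (ℤP.+-identityʳ _) ; (suc i) → refl }
    ; ι-neg = λ a → mk≋ λ { zero → sym (ℤP.-1*i≡-i a) ; (suc i) → refl }
    ; ι-0 = mk≋ λ { zero → refl ; (suc i) → refl }
    ; ι-1 = ≋-refl }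

  scale-const : ∀ c p → scaleP c p ≋ mulP (const c) p
  scale-const c p = mk≋ λ i → sym (trans (coef-mul-∷ c [] p i) (trans (cong (ℤ._+_ (c ℤ.* coef p i)) (z i)) (trans
      (ℤP.+-identityʳ (c ℤ.* coef p i)) (sym (coef-scale c p i)))))
    where
    z : ∀ i → coef (+ 0 ∷ []) i ≡ + 0
    z zero    = refl
    z (suc i) = refl

  X : ZPoly
  X = + 0 ∷ + 1 ∷ []

  cons-Horner : ∀ x p → (x ∷ p) ≋ addP (const x) (mulP X p)
  cons-Horner x p = mk≋ λ i → trans (h i) (sym (trans (coef-add (const x) (mulP X p) i) (cong (ℤ._+_ (coef (const x) i))
     (trans (at (mul-shiftˡ (+ 1 ∷ []) p) i) (at (shift-cong (mul-identityˡ p)) i)))))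
    where
    h : ∀ i → coef (x ∷ p) i ≡ coef (const x) i ℤ.+ coef (+ 0 ∷ p) i
    h zero    = sym (ℤP.+-identityʳ x)
    h (suc i) = sym (ℤP.+-identityˡ (coef p i))

  ≋⇒PolyEq : ∀ {p q} → p ≋ q → PolyEq p q
  ≋⇒PolyEq {p} {q} e = go (addP p (negP q)) (λ i → trans (coef-add p (negP q) i)
      (trans (cong₂ ℤ._+_ (at e i) (coef-scale (ℤ.- (+ 1)) q i)) (trans (ℤP.+-comm (coef q i) ((ℤ.-
          (+ 1)) ℤ.* coef q i)) (inverse (coef q i)))))
    where
    go : ∀ r → (∀ i → coef r i ≡ + 0) → All (_≡ + 0) r
    go []      h = []
    go (x ∷ r) h = h 0 ∷ go r (λ i → h (suc i))

-- Evaluation as a ring homomorphism; monic polynomials.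

module PolynomialEvaluation where

  open ℤAlgebras
  open PolynomialRing
  open import Data.Integer.Divisibility.Signed using (_∣_; divides; ∣m∣n⇒∣m+n; ∣m+n∣m⇒∣n; ∣n⇒∣m*n)
  import Algebra.Properties.Semiring.Exp as Exp

  module Evaluation (A : ℤAlgebra) (y : ℤAlgebra.Carrier A) where
    open ℤAlgebra A
    open IntSolver A
    open SR setoid

    ev : ZPoly → Carrier
    ev []      = 0#
    ev (x ∷ p) = ι x + y * ev p

    private
      null : ∀ {u v} → u ≈ 0# → v ≈ 0# → u + y * v ≈ 0#
      null {u} {v} a b = begin
        u + y * v    ≈⟨ +-cong a (*-congˡ b) ⟩
        0# + y * 0#  ≈⟨ +-identityˡ _ ⟩
        y * 0#       ≈⟨ zeroʳ y ⟩
        0#           ∎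

    ev-zero : ∀ p → (∀ i → coef p i ≡ + 0) → ev p ≈ 0#
    ev-zero []      h = refl
    ev-zero (x ∷ p) h = null (trans (ι-cong (h 0)) ι-0) (ev-zero p (λ i → h (suc i)))

    ev-cong′ : ∀ p q → (∀ i → coef p i ≡ coef q i) → ev p ≈ ev q
    ev-cong′ []      q       h = sym (ev-zero q (λ i → ≡.sym (h i)))
    ev-cong′ (x ∷ p) []      h = ev-zero (x ∷ p) h
    ev-cong′ (x ∷ p) (z ∷ q) h = +-cong (ι-cong (h 0)) (*-congˡ (ev-cong′ p q (λ i → h (suc i))))

    ev-cong : ∀ {p q} → p ≋ q → ev p ≈ ev q
    ev-cong {p} {q} e = ev-cong′ p q (at e)

    ev-add : ∀ p q → ev (addP p q) ≈ ev p + ev q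
    ev-add []      q       = sym (+-identityˡ _)
    ev-add (x ∷ p) []      = sym (+-identityʳ _)
    ev-add (x ∷ p) (z ∷ q) = begin
      ι (x ℤ.+ z) + y * ev (addP p q)       ≈⟨ +-cong (ι-+ x z) (*-congˡ (ev-add p q)) ⟩
      (ι x + ι z) + y * (ev p + ev q)       ≈⟨ solve 5 (λ a b y c d → (a :+ b) :+ y :* (c :+ d) := (a :+ y :* c) :+
          (b :+ y :* d)) refl (ι x) (ι z) y (ev p) (ev q) ⟩
      (ι x + y * ev p) + (ι z + y * ev q)   ∎

    ev-scale : ∀ c p → ev (scaleP c p) ≈ ι c * ev p
    ev-scale c []      = sym (zeroʳ _)
    ev-scale c (x ∷ p) = begin
      ι (c ℤ.* x) + y * ev (scaleP c p)  ≈⟨ +-cong (ι-* c x) (*-congˡ (ev-scale c p)) ⟩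
      ι c * ι x + y * (ι c * ev p)       ≈⟨ solve 4 (λ c a y b → c :* a :+ y :* (c :* b) := c :* (a :+ y :* b)) refl
          (ι c) (ι x) y (ev p) ⟩
      ι c * (ι x + y * ev p)             ∎

    ev-shift : ∀ p → ev (+ 0 ∷ p) ≈ y * ev p
    ev-shift p = trans (+-congʳ ι-0) (+-identityˡ _)

    ev-mul : ∀ p q → ev (mulP p q) ≈ ev p * ev q
    ev-mul []      q = sym (zeroˡ _)
    ev-mul (x ∷ p) q = begin
      ev (addP (scaleP x q) (+ 0 ∷ mulP p q))  ≈⟨ ev-add (scaleP x q) _ ⟩
      ev (scaleP x q) + ev (+ 0 ∷ mulP p q)    ≈⟨ +-cong (ev-scale x q) (trans (ev-shift (mulP p q)) (*-congˡ (ev-mul p q))) ⟩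
      ι x * ev q + y * (ev p * ev q)           ≈⟨ solve 4 (λ a y p q → a :* q :+ y :* (p :* q) :=
          (a :+ y :* p) :* q) refl (ι x) y (ev p) (ev q) ⟩
      (ι x + y * ev p) * ev q                  ∎

    ev-const : ∀ c → ev (const c) ≈ ι c
    ev-const c = trans (+-congˡ (zeroʳ y)) (+-identityʳ _)

    ev-1 : ev (+ 1 ∷ []) ≈ 1#
    ev-1 = trans (ev-const (+ 1)) ι-1

    ev-X : ev X ≈ y
    ev-X = trans (ev-shift (+ 1 ∷ [])) (trans (*-congˡ ev-1) (*-identityʳ y))

    open Exp semiring using (_^_)

    ev-pow : ∀ p n → ev (powP p n) ≈ ev p ^ n
    ev-pow p zero    = ev-1
    ev-pow p (suc n) = trans (ev-mul p (powP p n)) (*-congˡ (ev-pow p n))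

    ev-mono : ∀ c e → ev (monoP c e) ≈ ι c * y ^ e
    ev-mono c zero    = trans (ev-const c) (sym (*-identityʳ _))
    ev-mono c (suc e) = begin
      ev (+ 0 ∷ monoP c e)  ≈⟨ ev-shift (monoP c e) ⟩
      y * ev (monoP c e)    ≈⟨ *-congˡ (ev-mono c e) ⟩
      y * (ι c * y ^ e)     ≈⟨ solve 3 (λ y c z → y :* (c :* z) := c :* (y :* z)) refl y (ι c) (y ^ e) ⟩
      ι c * (y * y ^ e)     ∎

    ev-xpm1 : ∀ e → ev (xpm1 e) ≈ y ^ e - 1#
    ev-xpm1 e = begin
      ev (xpm1 e)                                         ≈⟨ ev-add (monoP (+ 1) e) _ ⟩
      ev (monoP (+ 1) e) + ev (monoP (ℤ.- (+ 1)) 0)       ≈⟨ +-cong (trans (ev-mono (+ 1) e) (trans (*-congʳ ι-1)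
          (*-identityˡ _))) (trans (ev-const (ℤ.- (+ 1))) (trans (ι-neg (+ 1)) (-‿cong ι-1))) ⟩
      y ^ e - 1#                                          ∎

  -- The degree is an index, since trailing zeros prevent reading it off the length of the list.
  record Monic (b : ℕ) (f : ZPoly) : Set where
    field
      leading : coef f b ≡ + 1
      above   : ∀ j → coef f (suc (b ℕ.+ j)) ≡ + 0
  open Monic public

  Monic-≋ : ∀ {b f g} → f ≋ g → Monic b f → Monic b g
  Monic-≋ {b} e m = record { leading = ≡.trans (≡.sym (at e b)) (leading m) ; above = λ j → ≡.trans (≡.sym (at e _)) (above m j) }

  private
    mul-above : ∀ x (f g : ZPoly) i → coef g (suc i) ≡ + 0 → coef (mulP (x ∷ f) g) (suc i) ≡ coef (mulP f g) i
    mul-above x f g i z = ≡.trans (coef-mul-∷ x f g (suc i))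
      (≡.trans (cong (λ c → x ℤ.* c ℤ.+ coef (mulP f g) i) z)
      (≡.trans (cong (ℤ._+ coef (mulP f g) i) (ℤP.*-zeroʳ x)) (ℤP.+-identityˡ (coef (mulP f g) i))))

  Monic-mul : ∀ {b c} f g → Monic b f → Monic c g → Monic (b ℕ.+ c) (mulP f g)
  Monic-mul []      g m n with leading m
  ... | ()
  -- A monic polynomial of degree 0 equals 1.
  Monic-mul {zero} (x ∷ f) g m n = Monic-≋ (≋-trans (≋-sym (mul-identityˡ g)) (mul-cong {q = g} 1≋ ≋-refl)) n
    where
    1≋ : (+ 1 ∷ []) ≋ (x ∷ f)
    1≋ = mk≋ λ { zero → ≡.sym (leading m) ; (suc i) → ≡.sym (above m i) }
  Monic-mul {suc b} {c} (x ∷ f) g m n = record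
    { leading = ≡.trans (mul-above x f g (b ℕ.+ c) (subst (λ i → coef g (suc i) ≡ + 0) (ℕP.+-comm c b) (above n b))) (leading ih)
    ; above   = λ j → ≡.trans (mul-above x f g (suc (b ℕ.+ c ℕ.+ j)) (subst (λ i → coef g (suc i) ≡ + 0) (e j) (above n
        (suc (b ℕ.+ j))))) (above ih j)
    }
    where
    ih = Monic-mul f g (record { leading = leading m ; above = above m }) n
    e : ∀ j → c ℕ.+ suc (b ℕ.+ j) ≡ suc (b ℕ.+ c ℕ.+ j)
    e j = ≡.trans (ℕP.+-suc c _) (cong suc (≡.trans (≡.sym (ℕP.+-assoc c b j)) (cong (ℕ._+ j) (ℕP.+-comm c b))))

  Monic-1 : Monic 0 (+ 1 ∷ [])
  Monic-1 = record { leading = ≡.refl ; above = λ j → ≡.refl }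

  Monic-xpm1 : ∀ e → Monic (suc e) (xpm1 (suc e))
  Monic-xpm1 e = record { leading = lead e ; above = abv e }
    where
    add-[] : ∀ p i → coef (addP p []) i ≡ coef p i
    add-[] p i = at (add-identityʳ p) i
    lead : ∀ e → coef (addP (monoP (+ 1) e) []) e ≡ + 1
    lead e = ≡.trans (add-[] (monoP (+ 1) e) e) (go e)
      where
      go : ∀ e → coef (monoP (+ 1) e) e ≡ + 1
      go zero    = ≡.refl
      go (suc e) = go e
    abv : ∀ e j → coef (addP (monoP (+ 1) e) []) (suc (e ℕ.+ j)) ≡ + 0
    abv e j = ≡.trans (add-[] (monoP (+ 1) e) _) (go e j)
      where
      go : ∀ e j → coef (monoP (+ 1) e) (suc (e ℕ.+ j)) ≡ + 0
      go zero    j = ≡.refl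
      go (suc e) j = go e j

  private
    ∣-≡ : ∀ {n a b} → a ≡ b → n ∣ a → n ∣ b
    ∣-≡ ≡.refl d = d

  ∣coef-mul : ∀ n q g → (∀ i → n ∣ coef q i) → ∀ i → n ∣ coef (mulP q g) i
  ∣coef-mul n []      g h i = divides (+ 0) ≡.refl
  ∣coef-mul n (x ∷ q) g h i = ∣-≡ (≡.sym (coef-mul-∷ x q g i))
    (∣m∣n⇒∣m+n (∣-≡ (ℤP.*-comm (coef g i) x) (∣n⇒∣m*n (coef g i) (h 0))) (sh i))
    where
    sh : ∀ i → n ∣ coef (+ 0 ∷ mulP q g) i
    sh zero    = divides (+ 0) ≡.refl
    sh (suc i) = ∣coef-mul n q g (λ i → h (suc i)) i

  -- For n = 0 this says that a monic polynomial is not a zero divisor.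
  monic-cancel-∣ : ∀ n {b} q g → Monic b g → (∀ j → n ∣ coef (mulP q g) (b ℕ.+ j)) → ∀ i → n ∣ coef q i
  monic-cancel-∣ n []      g m h i = divides (+ 0) ≡.refl
  monic-cancel-∣ n {b} (x ∷ q) g m h = λ { zero → n∣x ; (suc i) → n∣q i }
    where
    n∣q : ∀ i → n ∣ coef q i
    n∣q = monic-cancel-∣ n q g m (λ j → ∣-≡ (mul-above x q g (b ℕ.+ j) (above m j)) (∣-≡ (cong (coef (mulP (x ∷ q) g))
        (ℕP.+-suc b j)) (h (suc j))))
    sh : ∀ i → n ∣ coef (+ 0 ∷ mulP q g) i
    sh zero    = divides (+ 0) ≡.refl
    sh (suc i) = ∣coef-mul n q g n∣q i
    top : coef (mulP (x ∷ q) g) (b ℕ.+ 0) ≡ coef (+ 0 ∷ mulP q g) b ℤ.+ x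
    top = ≡.trans (cong (coef (mulP (x ∷ q) g)) (ℕP.+-identityʳ b)) (≡.trans (coef-mul-∷ x q g b)
          (≡.trans (cong (λ c → x ℤ.* c ℤ.+ coef (+ 0 ∷ mulP q g) b) (leading m))
          (≡.trans (cong (ℤ._+ coef (+ 0 ∷ mulP q g) b) (ℤP.*-identityʳ x)) (ℤP.+-comm x _))))
    n∣x : n ∣ x
    n∣x = ∣m+n∣m⇒∣n (∣-≡ top (h 0)) (sh b)

  ∣coefs⇒scale : ∀ n q → (∀ i → n ∣ coef q i) → ∃ λ q′ → q ≋ scaleP n q′
  ∣coefs⇒scale n []      h = [] , ≋-refl
  ∣coefs⇒scale n (x ∷ q) h with h 0 | ∣coefs⇒scale n q (λ i → h (suc i))
  ... | divides k e | q′ , r = k ∷ q′ , mk≋ λ { zero → ≡.trans e (ℤP.*-comm k n) ; (suc i) → at r i }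

-- Geometric sums and the vanishing of sums of roots of unity.

module GeometricSums where

  open ℤAlgebras
  open import Data.Nat.GCD as GCD using (gcd; gcd[m,n]∣m; gcd[m,n]∣n; module Bézout)
  open import Data.Nat.Coprimality using (Coprime; coprime-Bézout)
  open import Data.Nat.Primality using (Prime; prime⇒irreducible)
  open import Data.Nat.Primality.Factorisation using (factorise)
  open import Data.Nat.ListAction using (product)
  open import Data.List.Relation.Unary.All using ([]; _∷_)
  import Algebra.Properties.Semiring.Exp as Exp
  import Algebra.Properties.Semiring.Divisibility as Div
  import Algebra.Properties.CommutativeSemiring.Exp as CExp

  primeDivisor : ∀ n .{{_ : NonZero n}} → ¬ n ≡ 1 → ∃ λ ℓ → Prime ℓ × ℓ ℕD.∣ n
  primeDivisor n n≢1 with factorise n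
  ... | record { factors = [] ; isFactorisation = e } = ⊥-elim (n≢1 e)
  ... | record { factors = ℓ ∷ ls ; isFactorisation = e ; factorsPrime = pℓ ∷ _ } =
    ℓ , pℓ , subst (ℓ ℕD.∣_) (≡.sym e) (ℕD.m∣m*n (product ls))

  prime∤⇒coprime : ∀ {p n} → Prime p → ¬ p ℕD.∣ n → Coprime p n
  prime∤⇒coprime pp p∤n (d∣p , d∣n) with prime⇒irreducible pp d∣p
  ... | inj₁ d≡1 = d≡1
  ... | inj₂ ≡.refl = ⊥-elim (p∤n d∣n)

  module Geometric (A : ℤAlgebra) where
    open ℤAlgebra A
    open IntSolver A
    open SR setoid
    open Exp semiring public using (_^_; ^-congˡ; ^-congʳ; ^-homo-*; ^-assocʳ)
    open CExp commutativeSemiring public using (^-distrib-*)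
    open Div semiring public using (_∣_; _,_; ∣-trans; ∣ʳ-respʳ-≈; ∣ʳ-respˡ-≈; 0∣x⇒x≈0)

    -- The q-integer [n](y) = 1 + y + ... + y^(n-1). For a prime ℓ, [ℓ](X^u) is Φ_ℓ(X^u), a multiple
    -- of Φ_N when N = uℓ; this is how cyclotomic polynomials enter.
    geo : ℕ → Carrier → Carrier
    geo zero    y = 0#
    geo (suc n) y = 1# + y * geo n y

    geo-cong : ∀ n {x y} → x ≈ y → geo n x ≈ geo n y
    geo-cong zero    e = refl
    geo-cong (suc n) e = +-congˡ (*-cong e (geo-cong n e))

    geo-telescope : ∀ n y → geo n y * (y - 1#) ≈ y ^ n - 1#
    geo-telescope zero    y = trans (zeroˡ _) (sym (-‿inverseʳ 1#))
    geo-telescope (suc n) y = begin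
      (1# + y * geo n y) * (y - 1#)       ≈⟨ solve 3 (λ o y g → (o :+ y :* g) :* (y :- o) := o :* (y :- o) :+ y :* (g :*
          (y :- o))) refl 1# y (geo n y) ⟩
      1# * (y - 1#) + y * (geo n y * (y - 1#))  ≈⟨ +-cong (*-identityˡ _) (*-congˡ (geo-telescope n y)) ⟩
      (y - 1#) + y * (y ^ n - 1#)         ≈⟨ solve 3 (λ o y z → (y :- o) :+ y :* (z :- o) := (y :- y :* o) :+
          (y :* z :- o)) refl 1# y (y ^ n) ⟩
      (y - y * 1#) + (y * y ^ n - 1#)     ≈⟨ +-congʳ (trans (+-congˡ (-‿cong (*-identityʳ y))) (-‿inverseʳ y)) ⟩
      0# + (y * y ^ n - 1#)               ≈⟨ +-identityˡ _ ⟩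
      y * y ^ n - 1#                      ∎

    geo-+ : ∀ m n y → geo (m ℕ.+ n) y ≈ geo m y + y ^ m * geo n y
    geo-+ zero    n y = sym (trans (+-identityˡ _) (*-identityˡ _))
    geo-+ (suc m) n y = begin
      1# + y * geo (m ℕ.+ n) y                 ≈⟨ +-congˡ (*-congˡ (geo-+ m n y)) ⟩
      1# + y * (geo m y + y ^ m * geo n y)     ≈⟨ solve 5 (λ o y g z h → o :+ y :* (g :+ z :* h) := (o :+ y :* g) :+
          (y :* z) :* h) refl 1# y (geo m y) (y ^ m) (geo n y) ⟩
      (1# + y * geo m y) + (y * y ^ m) * geo n y ∎

    geo-* : ∀ m n y → geo (m ℕ.* n) y ≈ geo m (y ^ n) * geo n y
    geo-* zero    n y = sym (zeroˡ _)
    geo-* (suc m) n y = begin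
      geo (n ℕ.+ m ℕ.* n) y                        ≈⟨ geo-+ n (m ℕ.* n) y ⟩
      geo n y + y ^ n * geo (m ℕ.* n) y            ≈⟨ +-congˡ (*-congˡ (geo-* m n y)) ⟩
      geo n y + y ^ n * (geo m (y ^ n) * geo n y)  ≈⟨ +-congʳ (*-identityˡ _) ⟨
      1# * geo n y + y ^ n * (geo m (y ^ n) * geo n y)  ≈⟨ solve 4 (λ o g z h → o :* g :+ z :* (h :* g) :=
          (o :+ z :* h) :* g) refl 1# (geo n y) (y ^ n) (geo m (y ^ n)) ⟩
      (1# + y ^ n * geo m (y ^ n)) * geo n y       ∎

    -- A Bézout relation s m = 1 + t n between the indices lifts to [sm](y) = 1 + y·[tn](y), where
    -- [m](y) divides the left side and [n](y) divides [tn](y).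
    geo-comaximal : ∀ {m n} → Coprime m n → ∀ y → ∃ λ a → ∃ λ b → a * geo m y + b * geo n y ≈ 1#
    geo-comaximal {m} {n} c y with coprime-Bézout c
    ... | Bézout.+- s t eq = geo s (y ^ m) , - (y * geo t (y ^ n)) , (begin
      geo s (y ^ m) * geo m y + - (y * geo t (y ^ n)) * geo n y   ≈⟨ +-congʳ (trans (sym (geo-* s m y)) (reflexive (cong
          (λ k → geo k y) (≡.sym eq)))) ⟩
      (1# + y * geo (t ℕ.* n) y) + - (y * geo t (y ^ n)) * geo n y  ≈⟨ +-congʳ (+-congˡ (*-congˡ (geo-* t n y))) ⟩
      (1# + y * (geo t (y ^ n) * geo n y)) + - (y * geo t (y ^ n)) * geo n y ≈⟨ solve 4 (λ o y a b → (o :+ y :*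
          (a :* b)) :+ :- (y :* a) :* b := o) refl 1# y (geo t (y ^ n)) (geo n y) ⟩
      1# ∎)
    ... | Bézout.-+ s t eq = - (y * geo s (y ^ m)) , geo t (y ^ n) , (begin
      - (y * geo s (y ^ m)) * geo m y + geo t (y ^ n) * geo n y   ≈⟨ +-congˡ (trans (sym (geo-* t n y)) (reflexive (cong
          (λ k → geo k y) (≡.sym eq)))) ⟩
      - (y * geo s (y ^ m)) * geo m y + (1# + y * geo (s ℕ.* m) y)  ≈⟨ +-congˡ (+-congˡ (*-congˡ (geo-* s m y))) ⟩
      - (y * geo s (y ^ m)) * geo m y + (1# + y * (geo s (y ^ m) * geo m y)) ≈⟨ solve 4 (λ o y a b → :- (y :* a) :* b :+
          (o :+ y :* (a :* b)) := o) refl 1# y (geo s (y ^ m)) (geo m y) ⟩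
      1# ∎)

    -- Both [m](y^j)·[j](y) and [j](y^m)·[m](y) equal [mj](y), so [m](y) divides [m](y^j)·[j](y);
    -- the factor [j](y) is removed by comaximality with [m](y).
    geo-∣-geo-pow : ∀ {m j} → Coprime m j → ∀ y → geo m y ∣ geo m (y ^ j)
    geo-∣-geo-pow {m} {j} c y with geo-comaximal c y
    ... | a , b , e = (geo m (y ^ j) * a + b * geo j (y ^ m)) , (begin
      (geo m (y ^ j) * a + b * geo j (y ^ m)) * geo m y     ≈⟨ solve 5 (λ u a b v g → (u :* a :+ b :* v) :* g := u :*
          (a :* g) :+ b :* (v :* g)) refl (geo m (y ^ j)) a b (geo j (y ^ m)) (geo m y) ⟩
      geo m (y ^ j) * (a * geo m y) + b * (geo j (y ^ m) * geo m y) ≈⟨ +-congˡ (*-congˡ (trans (sym (geo-* j m y))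
          (trans (reflexive (cong (λ k → geo k y) (ℕP.*-comm j m))) (geo-* m j y)))) ⟩
      geo m (y ^ j) * (a * geo m y) + b * (geo m (y ^ j) * geo j y) ≈⟨ solve 5 (λ u a g b h → u :* (a :* g) :+ b :*
          (u :* h) := u :* (a :* g :+ b :* h)) refl (geo m (y ^ j)) a (geo m y) b (geo j y) ⟩
      geo m (y ^ j) * (a * geo m y + b * geo j y)           ≈⟨ trans (*-congˡ e) (*-identityʳ _) ⟩
      geo m (y ^ j)                                         ∎)

    -- Only the sums [ℓ](z^(N/ℓ)) over primes ℓ have to vanish. With g = gcd(j, N) and a prime ℓ
    -- dividing N/g, the sum [N](z^j) has the factor [ℓ](z^(j′·N/ℓ)), where j′ = j/g is prime to ℓ;
    -- that factor is a multiple of [ℓ](z^(N/ℓ)).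
    geo-root-sum : ∀ N .{{_ : NonZero N}} z → (∀ ℓ u → Prime ℓ → N ≡ u ℕ.* ℓ → geo ℓ (z ^ u) ≈ 0#) →
      ∀ j → ¬ N ℕD.∣ j → geo N (z ^ j) ≈ 0#
    geo-root-sum N z root j N∤j with gcd[m,n]∣m j N | gcd[m,n]∣n j N | GCD.gcd[m,n]≢0 j N (inj₂ (ℕ.≢-nonZero⁻¹ N))
    ... | ℕD.divides j′ ej | ℕD.divides t et | g≢0 = main (primeDivisor t {{t≢0}} t≢1)
      where
      g = gcd j N
      t≢1 : ¬ t ≡ 1
      t≢1 ≡.refl = N∤j (ℕD.divides j′ (≡.trans ej (cong (j′ ℕ.*_) (≡.sym (≡.trans et (ℕP.*-identityˡ g))))))
      t≢0 : NonZero t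
      t≢0 = ℕ.≢-nonZero λ { ≡.refl → ℕ.≢-nonZero⁻¹ N et }
      cop : Coprime j′ t
      cop {d} (ℕD.divides a ea , ℕD.divides b eb) = ℕD.∣1⇒≡1 (ℕD.*-cancelʳ-∣ g {{ℕ.≢-nonZero g≢0}} (subst
          (d ℕ.* g ℕD.∣_) (≡.sym (ℕP.*-identityˡ g))
        (GCD.gcd-greatest (ℕD.divides a (≡.trans ej (≡.trans (cong (ℕ._* g) ea) (ℕP.*-assoc a d g))))
                          (ℕD.divides b (≡.trans et (≡.trans (cong (ℕ._* g) eb) (ℕP.*-assoc b d g)))))))
      main : (∃ λ ℓ → Prime ℓ × ℓ ℕD.∣ t) → geo N (z ^ j) ≈ 0#
      main (ℓ , pℓ , ℕD.divides t′ et′) = begin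
        geo N (z ^ j)                                      ≈⟨ reflexive (cong (λ k → geo k (z ^ j)) N≡) ⟩
        geo (g ℕ.* (ℓ ℕ.* t′)) (z ^ j)                     ≈⟨ geo-* g (ℓ ℕ.* t′) (z ^ j) ⟩
        geo g ((z ^ j) ^ (ℓ ℕ.* t′)) * geo (ℓ ℕ.* t′) (z ^ j)   ≈⟨ *-congˡ (geo-* ℓ t′ (z ^ j)) ⟩
        geo g ((z ^ j) ^ (ℓ ℕ.* t′)) * (geo ℓ ((z ^ j) ^ t′) * geo t′ (z ^ j))   ≈⟨ *-congˡ (*-congʳ vanish) ⟩
        geo g ((z ^ j) ^ (ℓ ℕ.* t′)) * (0# * geo t′ (z ^ j))    ≈⟨ trans (*-congˡ (zeroˡ _)) (zeroʳ _) ⟩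
        0#                                                 ∎
        where
        N≡ : N ≡ g ℕ.* (ℓ ℕ.* t′)
        N≡ = ≡.trans et (≡.trans (ℕP.*-comm t g) (cong (g ℕ.*_) (≡.trans et′ (ℕP.*-comm t′ ℓ))))
        exps : j ℕ.* t′ ≡ t′ ℕ.* g ℕ.* j′
        exps = ≡.trans (cong (ℕ._* t′) ej) (≡.trans (ℕP.*-assoc j′ g t′) (≡.trans (ℕP.*-comm j′ _) (cong (ℕ._* j′)
            (ℕP.*-comm g t′))))
        u≡ : N ≡ t′ ℕ.* g ℕ.* ℓ
        u≡ = ≡.trans N≡ (≡.trans (cong (g ℕ.*_) (ℕP.*-comm ℓ t′)) (≡.trans (≡.sym (ℕP.*-assoc g t′ ℓ)) (cong (ℕ._* ℓ)
            (ℕP.*-comm g t′))))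
        cop′ : Coprime ℓ j′
        cop′ (a , b) = cop (b , ℕD.∣-trans a (ℕD.divides t′ et′))
        vanish : geo ℓ ((z ^ j) ^ t′) ≈ 0#
        vanish = trans (geo-cong ℓ (trans (^-assocʳ z j t′) (trans (^-congʳ z exps) (sym (^-assocʳ z (t′ ℕ.* g) j′)))))
          (0∣x⇒x≈0 (∣ʳ-respˡ-≈ (root ℓ (t′ ℕ.* g) pℓ u≡) (geo-∣-geo-pow cop′ (z ^ (t′ ℕ.* g)))))

-- Cyclotomic polynomials of squarefree index.

module RadicalCyclotomic where

  open ℤAlgebras
  open PolynomialRing
  open PolynomialEvaluation
  open GeometricSums
  open import Data.Nat using (_<_; s≤s; z≤n)
  open import Data.Nat.Primality using (Prime; prime⇒nonZero; prime⇒nonTrivial; prime⇒irreducible)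
  open import Data.Nat.ListAction using (sum; product)
  open import Data.Nat.ListAction.Properties using (sum-++)
  open import Data.Integer.Divisibility.Signed using (0∣⇒≡0; divides)
  open import Data.List.Membership.Propositional using (_∈_; _∉_)
  open import Data.List.Relation.Unary.Any using (here; there)
  open import Data.List.Relation.Unary.All as All using (All; []; _∷_)
  import Data.List.Relation.Unary.All.Properties as AllP
  open import Data.List.Relation.Binary.Permutation.Propositional as Perm using (_↭_)

  open ℤAlgebra polyAlg using (_+_; _*_; -_; _-_; 1#; 0#; setoid; *-cong; *-congˡ; *-congʳ; *-comm; *-assoc; *-identityʳ; *-identityˡ; +-cong; +-congˡ; +-congʳ; -‿inverseʳ; reflexive)
  open IntSolver polyAlg
  open Geometric polyAlg
  open SR setoid

  module Sub (v : ℕ) = Evaluation polyAlg (X ^ v)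

  -- The substitution X ↦ X^v, taken as evaluation inside ℤ[X] so that it inherits the homomorphism
  -- laws.
  sub : ℕ → ZPoly → ZPoly
  sub v = Sub.ev v

  sub-pow : ∀ v p n → sub v (p ^ n) ≋ sub v p ^ n
  sub-pow v p zero    = Sub.ev-1 v
  sub-pow v p (suc n) = ≋-trans (Sub.ev-mul v p (p ^ n)) (*-congˡ {sub v p} (sub-pow v p n))

  sub-X^ : ∀ v n → sub v (X ^ n) ≋ X ^ (v ℕ.* n)
  sub-X^ v n = ≋-trans (sub-pow v X n) (≋-trans (^-congˡ n (Sub.ev-X v)) (^-assocʳ X v n))

  sub-sub : ∀ v w p → sub v (sub w p) ≋ sub (v ℕ.* w) p
  sub-sub v w []      = ≋-refl
  sub-sub v w (x ∷ p) = begin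
    sub v (const x + X ^ w * sub w p)                ≈⟨ Sub.ev-add v (const x) (X ^ w * sub w p) ⟩
    sub v (const x) + sub v (X ^ w * sub w p)        ≈⟨ +-cong (Sub.ev-const v x) (≋-trans (Sub.ev-mul v (X ^ w)
        (sub w p)) (*-cong (sub-X^ v w) (sub-sub v w p))) ⟩
    const x + X ^ (v ℕ.* w) * sub (v ℕ.* w) p        ∎

  sub-comm : ∀ v w p → sub v (sub w p) ≋ sub w (sub v p)
  sub-comm v w p = ≋-trans (sub-sub v w p) (≋-trans (reflexive (cong (λ k → sub k p) (ℕP.*-comm v w))) (≋-sym (sub-sub w v p)))

  sub-geo : ∀ v n y → sub v (geo n y) ≋ geo n (sub v y)
  sub-geo v zero    y = ≋-refl
  sub-geo v (suc n) y = ≋-trans (Sub.ev-add v 1# (y * geo n y)) (+-cong (Sub.ev-1 v) (≋-trans (Sub.ev-mul v y (geo n y))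
      (*-congˡ {sub v y} (sub-geo v n y))))

  sub-geo-X^ : ∀ v n u → sub v (geo n (X ^ u)) ≋ geo n (X ^ (v ℕ.* u))
  sub-geo-X^ v n u = ≋-trans (sub-geo v n (X ^ u)) (geo-cong n (sub-X^ v u))

  sub-∣ : ∀ v {f g} → f ∣ g → sub v f ∣ sub v g
  sub-∣ v {f} (q , e) = sub v q , ≋-trans (≋-sym (Sub.ev-mul v q f)) (Sub.ev-cong v e)

  module EvX = Evaluation polyAlg X

  ev-X-id : ∀ p → EvX.ev p ≋ p
  ev-X-id []      = ≋-refl
  ev-X-id (x ∷ p) = ≋-sym (≋-trans (cons-Horner x p) (+-congˡ {const x} (*-congˡ {X} (≋-sym (ev-X-id p)))))

  xpm1-≋ : ∀ e → xpm1 e ≋ X ^ e - 1#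
  xpm1-≋ e = ≋-trans (≋-sym (ev-X-id (xpm1 e))) (EvX.ev-xpm1 e)

  sub-xpm1 : ∀ v e → sub v (xpm1 e) ≋ xpm1 (v ℕ.* e)
  sub-xpm1 v e = begin
    sub v (xpm1 e)         ≈⟨ Sub.ev-xpm1 v e ⟩
    (X ^ v) ^ e - 1#       ≈⟨ +-congʳ (^-assocʳ X v e) ⟩
    X ^ (v ℕ.* e) - 1#     ≈⟨ xpm1-≋ (v ℕ.* e) ⟨
    xpm1 (v ℕ.* e)         ∎

  pr : List ℕ → ZPoly
  pr es = prodListP (L.map xpm1 es)

  pr-++ : ∀ es fs → pr (es ++ fs) ≋ pr es * pr fs
  pr-++ []       fs = ≋-sym (*-identityˡ (pr fs))
  pr-++ (e ∷ es) fs = ≋-trans (*-congˡ {xpm1 e} (pr-++ es fs)) (≋-sym (*-assoc (xpm1 e) (pr es) (pr fs)))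

  pr-↭ : ∀ {es fs} → es ↭ fs → pr es ≋ pr fs
  pr-↭ Perm.refl = ≋-refl
  pr-↭ (Perm.prep e p) = *-congˡ {xpm1 e} (pr-↭ p)
  pr-↭ {_ ∷ _ ∷ es} {_ ∷ _ ∷ fs} (Perm.swap e f p) = ≋-trans (*-congˡ {xpm1 e} (*-congˡ {xpm1 f} (pr-↭ p)))
    (solve 3 (λ a b c → a :* (b :* c) := b :* (a :* c)) ≋-refl (xpm1 e) (xpm1 f) (pr fs))
  pr-↭ (Perm.trans p q) = ≋-trans (pr-↭ p) (pr-↭ q)

  sub-pr : ∀ v es → sub v (pr es) ≋ pr (L.map (v ℕ.*_) es)
  sub-pr v []       = Sub.ev-1 v
  sub-pr v (e ∷ es) = ≋-trans (Sub.ev-mul v (xpm1 e) (pr es)) (*-cong (sub-xpm1 v e) (sub-pr v es))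

  Monic-pr : ∀ {es} → All (0 <_) es → Monic (sum es) (pr es)
  Monic-pr []                       = Monic-1
  Monic-pr {suc e ∷ es} (s≤s _ ∷ h) = Monic-mul (xpm1 (suc e)) (pr es) (Monic-xpm1 e) (Monic-pr h)

  monic-cancelʳ : ∀ {b} p q g → Monic b g → p * g ≋ q * g → p ≋ q
  monic-cancelʳ {b} p q g m e = begin
    p            ≈⟨ solve 2 (λ p q → p := (p :- q) :+ q) ≋-refl p q ⟩
    (p - q) + q  ≈⟨ +-congʳ {q} d≋0 ⟩
    0# + q       ≈⟨ ≋-refl ⟩
    q            ∎
    where
    z : (p - q) * g ≋ 0#
    z = ≋-trans (solve 3 (λ p q g → (p :- q) :* g := p :* g :- q :* g) ≋-refl p q g)
        (≋-trans (+-congʳ { - (q * g)} e) (-‿inverseʳ (q * g)))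
    d≋0 : (p - q) ≋ 0#
    d≋0 = mk≋ λ i → 0∣⇒≡0 (monic-cancel-∣ (+ 0) (p - q) g m (λ j → divides (+ 0) (at z (b ℕ.+ j))) i)

  -- For L the primes of N, Φ_N = ∏_{b ∈ bs L} (X^b − 1) / ∏_{c ∈ cs L} (X^c − 1), up to X ↦ X^(N / ∏ L).
  bs cs : List ℕ → List ℕ
  bs []      = 1 ∷ []
  bs (q ∷ L) = L.map (q ℕ.*_) (bs L) ++ cs L
  cs []      = []
  cs (q ∷ L) = L.map (q ℕ.*_) (cs L) ++ bs L

  bs>0 : ∀ {L} → All Prime L → All (0 <_) (bs L)
  cs>0 : ∀ {L} → All Prime L → All (0 <_) (cs L)

  map>0 : ∀ q .{{_ : NonZero q}} {es} → All (0 <_) es → All (0 <_) (L.map (q ℕ.*_) es)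
  map>0 q {{nz}} h = AllP.map⁺ (All.map (λ {e} 0<e → ℕ.>-nonZero⁻¹ (q ℕ.* e) {{ℕP.m*n≢0 q e {{nz}} {{ℕ.>-nonZero 0<e}}}}) h)

  bs>0 []       = s≤s z≤n ∷ []
  bs>0 (p ∷ ps) = AllP.++⁺ (map>0 _ {{prime⇒nonZero p}} (bs>0 ps)) (cs>0 ps)
  cs>0 []       = []
  cs>0 (p ∷ ps) = AllP.++⁺ (map>0 _ {{prime⇒nonZero p}} (cs>0 ps)) (bs>0 ps)

  sum-map-* : ∀ q es → sum (L.map (q ℕ.*_) es) ≡ q ℕ.* sum es
  sum-map-* q []       = ≡.sym (ℕP.*-zeroʳ q)
  sum-map-* q (e ∷ es) = ≡.trans (cong (q ℕ.* e ℕ.+_) (sum-map-* q es)) (≡.sym (ℕP.*-distribˡ-+ q e (sum es)))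

  -- This is deg Φ > 0, which later keeps p from being a unit modulo Φ. Adjoining q multiplies the
  -- difference b - c of the two sums by q - 1 > 0.
  cs<bs : ∀ {L} → All Prime L → sum (cs L) < sum (bs L)
  cs<bs [] = s≤s z≤n
  cs<bs {q ∷ L} (p ∷ ps) = ≡.subst₂ _<_ (≡.sym (e (cs L) (bs L))) (≡.sym (e (bs L) (cs L))) (go q (sum (bs L)) (sum
      (cs L)) (ℕ.nonTrivial⇒n>1 q {{prime⇒nonTrivial p}}) (cs<bs ps))
    where
    e : ∀ xs ys → sum (L.map (q ℕ.*_) xs ++ ys) ≡ q ℕ.* sum xs ℕ.+ sum ys
    e xs ys = ≡.trans (sum-++ (L.map (q ℕ.*_) xs) ys) (cong (ℕ._+ sum ys) (sum-map-* q xs))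
    go : ∀ q b c → 1 < q → c < b → q ℕ.* c ℕ.+ b < q ℕ.* b ℕ.+ c
    go (suc q) b c (s≤s 0<q) c<b = subst (_< suc q ℕ.* b ℕ.+ c)
      (≡.sym (≡.trans (ℕP.+-comm (c ℕ.+ q ℕ.* c) b) (≡.trans (cong (b ℕ.+_) (ℕP.+-comm c (q ℕ.* c))) (≡.sym
          (ℕP.+-assoc b (q ℕ.* c) c)))))
      (ℕP.+-monoˡ-< c (ℕP.+-monoʳ-< b (ℕP.*-monoʳ-< q {{ℕ.>-nonZero 0<q}} c<b)))

  -- `old` provides the vanishing prime root sums. `new` is the strength of induction: V is the next
  -- cyclotomic polynomial, and its divisibility of [q](X^∏L) is what makes the candidates for two
  -- different primes comaximal. It ranges over every q outside L because adjoining p has to restore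
  -- it for all remaining primes.
  record CycRad (L : List ℕ) : Set where
    field
      Φ   : ZPoly
      Φ*C : Φ * pr (cs L) ≋ pr (bs L)
      old : ∀ {ℓ} → ℓ ∈ L → ∃ λ u → (product L ≡ u ℕ.* ℓ) × Φ ∣ geo ℓ (X ^ u)
      new : ∀ q → Prime q → q ∉ L → ∃ λ V → (Φ * V ≋ sub q Φ) × V ∣ geo q (X ^ product L)

  -- A itself comes without a proof that it is monic; multiplying by C turns it into the monic B,
  -- which can be cancelled.
  cancel-factor : ∀ {b} A C B → A * C ≋ B → Monic b B → ∀ p q → p * A ≋ q * A → p ≋ q
  cancel-factor A C B e m p q h = monic-cancelʳ p q B m (begin
    p * B         ≈⟨ *-congˡ {p} e ⟨
    p * (A * C)   ≈⟨ *-assoc p A C ⟨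
    p * A * C     ≈⟨ *-congʳ {C} h ⟩
    q * A * C     ≈⟨ *-assoc q A C ⟩
    q * (A * C)   ≈⟨ *-congˡ {q} e ⟩
    q * B         ∎)

  cycRad-[] : CycRad []
  cycRad-[] = record
    { Φ = xpm1 1
    ; Φ*C = ≋-refl
    ; old = λ ()
    ; new = λ q _ _ → geo q X , (begin
        xpm1 1 * geo q X        ≈⟨ ≋-trans (*-comm (xpm1 1) (geo q X)) (*-congˡ {geo q X} (≋-trans (xpm1-≋ 1)
            (+-congʳ { - 1#} (*-identityʳ X)))) ⟩
        geo q X * (X - 1#)      ≈⟨ geo-telescope q X ⟩
        X ^ q - 1#              ≈⟨ ≋-trans (sub-xpm1 q 1) (≋-trans (reflexive (cong xpm1 (ℕP.*-identityʳ q))) (xpm1-≋ q)) ⟨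
        sub q (xpm1 1)          ∎)
      , ∣ʳ-respʳ-≈ (geo-cong q (≋-sym (*-identityʳ X))) (1# , *-identityˡ (geo q X))
    }

  -- With A = Φ_L, A U = A(X^p), A V = A(X^q): cancelling A in A(X^(pq)) gives V U(X^q) = U V(X^p), and
  -- U ∣ [p](X^P), V ∣ [q](X^P) are comaximal, so that U ∣ U(X^q) and V ∣ V(X^p) with the same quotient W.
  cycRad-∷ : ∀ {p L} → All Prime L → Prime p → p ∉ L → CycRad L → CycRad (p ∷ L)
  cycRad-∷ {p} {L} pL pp p∉L S with CycRad.new S p pp p∉L
  ... | U , AU , U∣@(g , gU) = record { Φ = U ; Φ*C = ΦC ; old = old′ ; new = new′ }
    where
    open CycRad S renaming (Φ to A)
    P = product L
    B = pr (bs L)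
    C = pr (cs L)
    cancelA = cancel-factor A C B Φ*C (Monic-pr (bs>0 pL))
    -- The new denominator is C(X^p)·B. Writing B as A·C brings out A·U = A(X^p), and A(X^p)·C(X^p)
    -- = B(X^p).
    ΦC : U * pr (cs (p ∷ L)) ≋ pr (bs (p ∷ L))
    ΦC = begin
      U * pr (cs (p ∷ L))              ≈⟨ *-congˡ {U} (≋-trans (pr-++ (L.map (p ℕ.*_) (cs L)) (bs L)) (*-cong (≋-sym
          (sub-pr p (cs L))) (≋-sym Φ*C))) ⟩
      U * (sub p C * (A * C))          ≈⟨ solve 4 (λ u a c s → u :* (s :* (a :* c)) := (a :* u) :* s :* c) ≋-refl U A C
          (sub p C) ⟩
      A * U * sub p C * C              ≈⟨ *-congʳ {C} (*-congʳ {sub p C} AU) ⟩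
      sub p A * sub p C * C            ≈⟨ *-congʳ {C} (≋-trans (≋-sym (Sub.ev-mul p A C)) (Sub.ev-cong p Φ*C)) ⟩
      sub p B * C                      ≈⟨ ≋-trans (*-congʳ {C} (sub-pr p (bs L))) (≋-sym (pr-++ (L.map (p ℕ.*_) (bs L)) (cs L))) ⟩
      pr (bs (p ∷ L))                  ∎
    old′ : ∀ {ℓ} → ℓ ∈ p ∷ L → ∃ λ u → (p ℕ.* P ≡ u ℕ.* ℓ) × U ∣ geo ℓ (X ^ u)
    old′ (here ≡.refl) = P , ℕP.*-comm p P , U∣
    old′ {ℓ} (there ℓ∈L) with old ℓ∈L
    ... | u , e , A∣ = p ℕ.* u , ≡.trans (cong (p ℕ.*_) e) (≡.sym (ℕP.*-assoc p u ℓ)) ,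
      ∣ʳ-respʳ-≈ (sub-geo-X^ p ℓ u) (∣-trans (A , AU) (sub-∣ p A∣))
    new′ : ∀ q → Prime q → q ∉ p ∷ L → ∃ λ W → (U * W ≋ sub q U) × W ∣ geo q (X ^ (p ℕ.* P))
    new′ q pq q∉ with new q pq (q∉ ∘ there)
    ... | V , AV , (h , hV) with geo-comaximal (prime∤⇒coprime pp p∤q) (X ^ P)
      where
      p∤q : _
      p∤q p∣q with prime⇒irreducible pq p∣q
      ... | inj₁ ≡.refl = ℕ.nonTrivial⇒≢1 {{prime⇒nonTrivial pp}} ≡.refl
      ... | inj₂ ≡.refl = q∉ (here ≡.refl)
    ... | a , b , e = W , UW ,
      ∣-trans (V , VW) (∣ʳ-respʳ-≈ (sub-geo-X^ p q P) (sub-∣ p (h , hV)))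
      where
      x = a * g
      y = b * h
      sU = sub q U
      sV = sub p V
      W = x * sU + y * sV
      xU+yV : x * U + y * V ≋ 1#
      xU+yV = ≋-trans (+-cong (≋-trans (*-assoc a g U) (*-congˡ {a} gU)) (≋-trans (*-assoc b h V) (*-congˡ {b} hV))) e
      half : ∀ {F G} v w → A * F ≋ sub v A → A * G ≋ sub w A → F * sub v G * A ≋ sub v (sub w A)
      half {F} {G} v w AF AG = begin
        F * sub v G * A       ≈⟨ solve 3 (λ a f s → f :* s :* a := a :* f :* s) ≋-refl A F (sub v G) ⟩
        A * F * sub v G       ≈⟨ *-congʳ {sub v G} AF ⟩
        sub v A * sub v G     ≈⟨ Sub.ev-mul v A G ⟨
        sub v (A * G)         ≈⟨ Sub.ev-cong v AG ⟩
        sub v (sub w A)       ∎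
      VsU : V * sU ≋ U * sV
      VsU = cancelA _ _ (≋-trans (half q p AV AU) (≋-trans (sub-comm q p A) (≋-sym (half p q AU AV))))
      UW : U * W ≋ sU
      UW = begin
        U * W                          ≈⟨ solve 5 (λ u x s y t → u :* (x :* s :+ y :* t) := x :* u :* s :+ y :*
            (u :* t)) ≋-refl U x sU y sV ⟩
        x * U * sU + y * (U * sV)      ≈⟨ +-congˡ {x * U * sU} (*-congˡ {y} VsU) ⟨
        x * U * sU + y * (V * sU)      ≈⟨ solve 5 (λ u x s y v → x :* u :* s :+ y :* (v :* s) :=
            (x :* u :+ y :* v) :* s) ≋-refl U x sU y V ⟩
        (x * U + y * V) * sU           ≈⟨ ≋-trans (*-congʳ {sU} xU+yV) (*-identityˡ sU) ⟩
        sU                             ∎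
      VW : V * W ≋ sV
      VW = begin
        V * W                          ≈⟨ solve 5 (λ v x s y t → v :* (x :* s :+ y :* t) := x :*
            (v :* s) :+ y :* v :* t) ≋-refl V x sU y sV ⟩
        x * (V * sU) + y * V * sV      ≈⟨ +-congʳ {y * V * sV} (*-congˡ {x} VsU) ⟩
        x * (U * sV) + y * V * sV      ≈⟨ solve 5 (λ u x s y v → x :* (u :* s) :+ y :* v :* s :=
            (x :* u :+ y :* v) :* s) ≋-refl U x sV y V ⟩
        (x * U + y * V) * sV           ≈⟨ ≋-trans (*-congʳ {sV} xU+yV) (*-identityˡ sV) ⟩
        sV                             ∎

-- Divisor lists and the Möbius function.

module MöbiusDivisors where

  open GeometricSums using (prime∤⇒coprime)
  open import Data.Nat using (_+_; _*_; _^_; _≤_; _<_; s≤s; z≤n)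
  open import Data.Nat.Divisibility using (_∣_; divides; _∣?_)
  open import Data.Nat.DivMod using (m*n/n≡m)
  open import Data.Nat.Coprimality using (Coprime; coprime-divisor)
  open import Data.Nat.Primality using (Prime; prime⇒nonZero; prime⇒nonTrivial)
  open import Data.Nat.Induction using (<-rec)
  open import Data.Bool using (T)
  import Data.List.Properties as LP
  open import Data.List.Membership.Propositional using (_∈_)
  open import Data.List.Membership.Propositional.Properties
  open import Data.List.Membership.Propositional.Properties.WithK using (unique∧set⇒bag)
  open import Data.List.Relation.Binary.BagAndSetEquality using (∼bag⇒↭)
  open import Data.List.Relation.Binary.Disjoint.Propositional using (Disjoint)
  open import Data.List.Relation.Binary.Permutation.Propositional as Perm using (_↭_)
  open import Data.List.Relation.Unary.Any using (here; there)
  open import Data.List.Relation.Unary.All as All using (All; []; _∷_)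
  open import Data.List.Relation.Unary.Unique.Propositional using (Unique; []; _∷_)
  import Data.List.Relation.Unary.Unique.Propositional.Properties as Unq
  open import Function.Bundles using (mk⇔)
  open import Relation.Nullary.Decidable using (T?)
  open import Relation.Binary.PropositionalEquality using (refl; sym; trans)

  T-does⁻ : ∀ {P : Set} (P? : Dec P) → T (does P?) → P
  T-does⁻ (yes p) _ = p

  T-does⁺ : ∀ {P : Set} (P? : Dec P) → P → T (does P?)
  T-does⁺ (yes p) _ = _
  T-does⁺ (no ¬p) p = ¬p p

  -- Divisor lists have no repetitions, so sums and products over them can be rearranged by
  -- comparing memberships only.
  unique↭ : ∀ {xs ys : List ℕ} → Unique xs → Unique ys → (∀ {x} → x ∈ xs → x ∈ ys) → (∀ {x} → x ∈ ys → x ∈ xs) → xs ↭ ys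
  unique↭ u v f g = ∼bag⇒↭ (unique∧set⇒bag u v (mk⇔ f g))

  ∈-range⁺ : ∀ {n d} → 0 < d → d < n → d ∈ L.drop 1 (L.upTo n)
  ∈-range⁺ {suc n} {suc d} _ (s≤s d<n) = ∈-applyUpTo⁺ suc d<n

  ∈-range⁻ : ∀ {n d} → d ∈ L.drop 1 (L.upTo n) → 0 < d × d < n
  ∈-range⁻ {suc n} m with ∈-applyUpTo⁻ suc m
  ... | i , i<n , refl = s≤s z≤n , s≤s i<n

  range-unique : ∀ n → Unique (L.drop 1 (L.upTo n))
  range-unique n = Unq.drop⁺ 1 (Unq.upTo⁺ n)

  ∈-properDivisors⁺ : ∀ {n d} → 0 < d → d < n → d ∣ n → d ∈ properDivisors n
  ∈-properDivisors⁺ {n} {d} 0<d d<n d∣n = ∈-filter⁺ (λ e → T? (does (e ∣? n))) (∈-range⁺ 0<d d<n) (T-does⁺ (d ∣? n) d∣n)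

  ∈-properDivisors⁻ : ∀ {n d} → d ∈ properDivisors n → 0 < d × d < n × d ∣ n
  ∈-properDivisors⁻ {n} {d} m with ∈-filter⁻ (λ e → T? (does (e ∣? n))) m
  ... | r , t with ∈-range⁻ {n} r
  ... | a , b = a , b , T-does⁻ (d ∣? n) t

  ∈-divisors⁺ : ∀ {n d} .{{_ : NonZero n}} → d ∣ n → d ∈ divisors n
  ∈-divisors⁺ {n} {d} d∣n = ∈-filter⁺ (λ e → T? (does (e ∣? n))) (∈-range⁺ (ℕP.n≢0⇒n>0 λ { refl → ℕ.≢-nonZero⁻¹ n
      (ℕD.0∣⇒≡0 d∣n) }) (s≤s (ℕD.∣⇒≤ d∣n))) (T-does⁺ (d ∣? n) d∣n)

  ∈-divisors⁻ : ∀ {n d} → d ∈ divisors n → 0 < d × d ∣ n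
  ∈-divisors⁻ {n} {d} m with ∈-filter⁻ (λ e → T? (does (e ∣? n))) m
  ... | r , t = proj₁ (∈-range⁻ {suc n} r) , T-does⁻ (d ∣? n) t

  properDivisors-unique : ∀ n → Unique (properDivisors n)
  properDivisors-unique n = Unq.filter⁺ _ (range-unique n)

  divisors-unique : ∀ n → Unique (divisors n)
  divisors-unique n = Unq.filter⁺ _ (range-unique (suc n))

  divisors↭ : ∀ n .{{_ : NonZero n}} → divisors n ↭ n ∷ properDivisors n
  divisors↭ n = unique↭ (divisors-unique n) (All.tabulate (λ m n≡ → ℕP.<⇒≢ (proj₁ (proj₂ (∈-properDivisors⁻ {n} m)))
      (sym n≡)) ∷ properDivisors-unique n) to from
    where
    to : ∀ {x} → x ∈ divisors n → x ∈ n ∷ properDivisors n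
    to {x} m with ∈-divisors⁻ {n} m
    ... | 0<x , x∣n with x ℕ.≟ n
    ... | yes refl = here refl
    ... | no x≢n   = there (∈-properDivisors⁺ 0<x (ℕP.≤∧≢⇒< (ℕD.∣⇒≤ x∣n) x≢n) x∣n)
    from : ∀ {x} → x ∈ n ∷ properDivisors n → x ∈ divisors n
    from (here refl) = ∈-divisors⁺ ℕD.∣-refl
    from (there m)   = ∈-divisors⁺ (proj₂ (proj₂ (∈-properDivisors⁻ {n} m)))

  Σ[_]_ : List ℕ → (ℕ → ℤ) → ℤ
  Σ[ xs ] f = sumListℤ (L.map f xs)

  Σ-↭ : ∀ {xs ys} f → xs ↭ ys → Σ[ xs ] f ≡ Σ[ ys ] f
  Σ-↭ f Perm.refl = refl
  Σ-↭ f (Perm.prep x p) = cong (ℤ._+_ (f x)) (Σ-↭ f p)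
  Σ-↭ f (Perm.swap {xs} {ys} x y p) = trans (cong (λ s → f x ℤ.+ (f y ℤ.+ s)) (Σ-↭ f p)) (swp (f x) (f y) (Σ[ ys ] f))
    where
    swp : ∀ a b c → a ℤ.+ (b ℤ.+ c) ≡ b ℤ.+ (a ℤ.+ c)
    swp = solve-∀
  Σ-↭ f (Perm.trans p q) = trans (Σ-↭ f p) (Σ-↭ f q)

  Σ-cong : ∀ xs {f g} → (∀ {x} → x ∈ xs → f x ≡ g x) → Σ[ xs ] f ≡ Σ[ xs ] g
  Σ-cong []       h = refl
  Σ-cong (x ∷ xs) h = cong₂ ℤ._+_ (h (here refl)) (Σ-cong xs (h ∘ there))

  Σ-zero : ∀ xs {f} → (∀ {x} → x ∈ xs → f x ≡ + 0) → Σ[ xs ] f ≡ + 0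
  Σ-zero []       h = refl
  Σ-zero (x ∷ xs) h = cong₂ ℤ._+_ (h (here refl)) (Σ-zero xs (h ∘ there))

  Σ-++ : ∀ xs ys f → Σ[ xs ++ ys ] f ≡ Σ[ xs ] f ℤ.+ Σ[ ys ] f
  Σ-++ []       ys f = sym (ℤP.+-identityˡ _)
  Σ-++ (x ∷ xs) ys f = trans (cong (ℤ._+_ (f x)) (Σ-++ xs ys f)) (sym (ℤP.+-assoc (f x) (Σ[ xs ] f) (Σ[ ys ] f)))

  Σ-map : ∀ xs (g : ℕ → ℕ) f → Σ[ L.map g xs ] f ≡ Σ[ xs ] (f ∘ g)
  Σ-map xs g f = cong sumListℤ (sym (LP.map-∘ xs))

  Σ-+ : ∀ xs f g → Σ[ xs ] f ℤ.+ Σ[ xs ] g ≡ Σ[ xs ] (λ x → f x ℤ.+ g x)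
  Σ-+ []       f g = refl
  Σ-+ (x ∷ xs) f g = trans (add4 (f x) (Σ[ xs ] f) (g x) (Σ[ xs ] g)) (cong (ℤ._+_ (f x ℤ.+ g x)) (Σ-+ xs f g))
    where
    add4 : ∀ a b c d → (a ℤ.+ b) ℤ.+ (c ℤ.+ d) ≡ (a ℤ.+ c) ℤ.+ (b ℤ.+ d)
    add4 = solve-∀

  -- The recursion passes to proper divisors, so fuel of at least n never runs out. Hence the
  -- defining recursion of μ(n), whose summands run on fuel n - 1, can be read as a sum of values of
  -- μ.
  μf-fuel : ∀ f f′ n → n ≤ f → n ≤ f′ → μf f n ≡ μf f′ n
  μf-fuel zero    zero     n             a b = refl
  μf-fuel zero    (suc f′) zero          a b = refl
  μf-fuel (suc f) zero     zero          a b = refl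
  μf-fuel (suc f) (suc f′) zero          a b = refl
  μf-fuel (suc f) (suc f′) (suc zero)    a b = refl
  μf-fuel (suc f) (suc f′) n@(suc (suc _)) a b = cong ℤ.-_ (Σ-cong (properDivisors n)
    (λ m → let d<n = proj₁ (proj₂ (∈-properDivisors⁻ {n} m)) in
      μf-fuel f f′ _ (ℕP.≤-pred (ℕP.≤-trans d<n a)) (ℕP.≤-pred (ℕP.≤-trans d<n b))))

  Σμ≡0 : ∀ n .{{_ : NonZero n}} → n ≢ 1 → Σ[ divisors n ] μ ≡ + 0
  Σμ≡0 (suc zero)      n≢1 = ⊥-elim (n≢1 refl)
  Σμ≡0 n@(suc (suc n-2)) n≢1 = trans (Σ-↭ μ (divisors↭ n)) (trans
    (cong (λ s → ℤ.- s ℤ.+ Σ[ properDivisors n ] μ) (Σ-cong (properDivisors n) {μf (suc n-2)} {μ} λ m →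
      μf-fuel (suc n-2) _ _ (ℕP.≤-pred (proj₁ (proj₂ (∈-properDivisors⁻ {n} m)))) ℕP.≤-refl))
    (ℤP.+-inverseˡ (Σ[ properDivisors n ] μ)))

  -- The system of divisor sums is triangular: by strong induction all terms at proper divisors are
  -- already zero, which leaves f(n). The class P must be closed under divisors for this; below it
  -- consists of the numbers prime to ℓ.
  divisorSums-injective : (P : ℕ → Set) → (∀ {m n} → m ∣ n → P n → P m) → (f : ℕ → ℤ) →
    (∀ n .{{_ : NonZero n}} → P n → Σ[ divisors n ] f ≡ + 0) → ∀ n .{{_ : NonZero n}} → P n → f n ≡ + 0
  divisorSums-injective P P-∣ f h n {{nz}} = <-rec Q step n nz
    where
    Q : ℕ → Set
    Q n = .(NonZero n) → P n → f n ≡ + 0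
    step : ∀ n → (∀ {m} → m < n → Q m) → Q n
    step n ih nz pn = trans (sym (ℤP.+-identityʳ (f n))) (trans (cong (ℤ._+_ (f n)) (sym (Σ-zero (properDivisors n) λ m →
        let 0<d , d<n , d∣n = ∈-properDivisors⁻ {n} m in ih d<n (ℕ.>-nonZero 0<d) (P-∣ d∣n pn))))
      (trans (sym (Σ-↭ f (divisors↭ n {{nz}}))) (h n {{nz}} pn)))

  ∤-∣ : ∀ {ℓ m n} → m ∣ n → ¬ ℓ ∣ n → ¬ ℓ ∣ m
  ∤-∣ m∣n ℓ∤n ℓ∣m = ℓ∤n (ℕD.∣-trans ℓ∣m m∣n)

  extract-power : ∀ ℓ → Prime ℓ → ∀ n .{{_ : NonZero n}} → ∃ λ e → ∃ λ m → n ≡ ℓ ^ e * m × ¬ ℓ ∣ m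
  extract-power ℓ pℓ n {{nz}} = <-rec Q step n nz
    where
    Q : ℕ → Set
    Q n = .(NonZero n) → ∃ λ e → ∃ λ m → n ≡ ℓ ^ e * m × ¬ ℓ ∣ m
    step : ∀ n → (∀ {m} → m < n → Q m) → Q n
    step n ih nz with ℓ ∣? n
    ... | no ℓ∤n = 0 , n , sym (ℕP.*-identityˡ n) , ℓ∤n
    ... | yes (divides q n≡qℓ) = cons (ih {q} q<n q≢0)
      where
      q≢0 : NonZero q
      q≢0 = ℕ.≢-nonZero λ { refl → ℕ.≢-nonZero⁻¹ n {{nz}} n≡qℓ }
      q<n : q < n
      q<n = subst (q <_) (sym n≡qℓ) (ℕP.m<m*n q ℓ {{q≢0}} (ℕ.nonTrivial⇒n>1 ℓ {{prime⇒nonTrivial pℓ}}))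
      cons : (∃ λ e → ∃ λ m → q ≡ ℓ ^ e * m × ¬ ℓ ∣ m) → ∃ λ e → ∃ λ m → n ≡ ℓ ^ e * m × ¬ ℓ ∣ m
      cons (e , m , q≡ , ℓ∤m) = suc e , m , trans n≡qℓ (trans (ℕP.*-comm q ℓ) (trans (cong (ℓ *_) q≡) (sym (ℕP.*-assoc ℓ
          (ℓ ^ e) m)))) , ℓ∤m

  module PrimePower (ℓ : ℕ) (pℓ : Prime ℓ) where

    instance
      ℓ≢0 : NonZero ℓ
      ℓ≢0 = prime⇒nonZero pℓ

    pow≢0 : ∀ e → NonZero (ℓ ^ e)
    pow≢0 e = ℕP.m^n≢0 ℓ e

    coprime-pow : ∀ {y} e → ¬ ℓ ∣ y → Coprime y (ℓ ^ e)
    coprime-pow zero    ℓ∤y (_ , d∣1) = ℕD.∣1⇒≡1 d∣1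
    coprime-pow {y} (suc e) ℓ∤y {d} (d∣y , d∣ℓ^) = coprime-pow e ℓ∤y (d∣y , coprime-divisor cop d∣ℓ^)
      where
      cop : Coprime d ℓ
      cop {c} (c∣d , c∣ℓ) = prime∤⇒coprime pℓ ℓ∤y (c∣ℓ , ℕD.∣-trans c∣d d∣y)

    private
      shift : ∀ e m → ℓ * (ℓ ^ e * m) ≡ ℓ ^ suc e * m
      shift e m = sym (ℕP.*-assoc ℓ (ℓ ^ e) m)

    no-extra-ℓ : ∀ e {x m} → ¬ ℓ ∣ m → ¬ (ℓ ^ suc e * x) ∣ (ℓ ^ e * m)
    no-extra-ℓ e {x} {m} ℓ∤m d = ℓ∤m (ℕD.∣-trans (ℕD.m∣m*n x) (ℕD.*-cancelˡ-∣ (ℓ ^ e) {{pow≢0 e}}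
      (subst (_∣ ℓ ^ e * m) (trans (cong (_* x) (ℕP.*-comm ℓ (ℓ ^ e))) (ℕP.*-assoc (ℓ ^ e) ℓ x)) d)))

    -- For x with cofactor y the question is whether ℓ divides y. If it does, one ℓ cancels and x
    -- divides ℓ^e m; if not, y is prime to ℓ^(e+1), hence divides m, and x = ℓ^(e+1)·(m/y).
    divisors-pow↭ : ∀ e m .{{_ : NonZero m}} → ¬ ℓ ∣ m →
      divisors (ℓ ^ suc e * m) ↭ L.map (ℓ ^ suc e *_) (divisors m) ++ divisors (ℓ ^ e * m)
    divisors-pow↭ e m {{nz}} ℓ∤m = unique↭ (divisors-unique (ℓ ^ suc e * m))
      (Unq.++⁺ (Unq.map⁺ (ℕP.*-cancelˡ-≡ _ _ (ℓ ^ suc e) {{pow≢0 (suc e)}}) (divisors-unique m)) (divisors-unique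
          (ℓ ^ e * m)) disj) to from
      where
      N≢0 : ∀ e → NonZero (ℓ ^ e * m)
      N≢0 e = ℕP.m*n≢0 (ℓ ^ e) m {{pow≢0 e}} {{nz}}
      disj : Disjoint (L.map (ℓ ^ suc e *_) (divisors m)) (divisors (ℓ ^ e * m))
      disj (a , b) with ∈-map⁻ (ℓ ^ suc e *_) a
      ... | x , _ , refl = no-extra-ℓ e ℓ∤m (proj₂ (∈-divisors⁻ {ℓ ^ e * m} b))
      to : ∀ {x} → x ∈ divisors (ℓ ^ suc e * m) → x ∈ L.map (ℓ ^ suc e *_) (divisors m) ++ divisors (ℓ ^ e * m)
      to {x} x∈ with proj₂ (∈-divisors⁻ {ℓ ^ suc e * m} x∈)
      ... | divides y eq with ℓ ∣? y
      ... | yes (divides y′ refl) = ∈-++⁺ʳ (L.map (ℓ ^ suc e *_) (divisors m)) (∈-divisors⁺ {{N≢0 e}} (divides y′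
            (ℕP.*-cancelˡ-≡ _ _ ℓ (trans (shift e m) (trans eq (trans (cong (_* x) (ℕP.*-comm y′ ℓ)) (ℕP.*-assoc ℓ y′ x)))))))
      ... | no ℓ∤y with coprime-divisor (coprime-pow (suc e) ℓ∤y) (divides x (trans eq (ℕP.*-comm y x)))
      ... | divides t m≡ = subst (_∈ _) (sym x≡) (∈-++⁺ˡ (∈-map⁺ (ℓ ^ suc e *_) (∈-divisors⁺ (divides y (trans m≡
          (ℕP.*-comm t y))))))
        where
        y≢0 : NonZero y
        y≢0 = ℕ.≢-nonZero λ { refl → ℓ∤y (ℓ ℕD.∣0) }
        x≡ : x ≡ ℓ ^ suc e * t
        x≡ = ℕP.*-cancelʳ-≡ x _ y {{y≢0}} (trans (ℕP.*-comm x y) (trans (sym eq) (trans (cong (ℓ ^ suc e *_) m≡) (sym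
            (ℕP.*-assoc (ℓ ^ suc e) t y)))))
      from : ∀ {x} → x ∈ L.map (ℓ ^ suc e *_) (divisors m) ++ divisors (ℓ ^ e * m) → x ∈ divisors (ℓ ^ suc e * m)
      from m∈ with ∈-++⁻ (L.map (ℓ ^ suc e *_) (divisors m)) m∈
      ... | inj₂ b = ∈-divisors⁺ {{N≢0 (suc e)}} (ℕD.∣-trans (proj₂ (∈-divisors⁻ {ℓ ^ e * m} b)) (divides ℓ (sym (shift e m))))
      ... | inj₁ a with ∈-map⁻ (ℓ ^ suc e *_) a
      ... | x , x∈ , refl = ∈-divisors⁺ {{N≢0 (suc e)}} (ℕD.*-monoʳ-∣ (ℓ ^ suc e) (proj₂ (∈-divisors⁻ {m} x∈)))

    -- The divisors of ℓ^(e+1) m that do not divide ℓ^e m are the ℓ^(e+1) d with d ∣ m.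
    Σ-step : ∀ e m .{{_ : NonZero m}} → ¬ ℓ ∣ m → Σ[ divisors m ] (λ d → μ (ℓ ^ suc e * d)) ℤ.+ Σ[ divisors (ℓ ^ e * m) ] μ ≡ + 0
    Σ-step e m {{nz}} ℓ∤m = trans (cong (ℤ._+ Σ[ divisors (ℓ ^ e * m) ] μ) (sym (Σ-map (divisors m) (ℓ ^ suc e *_) μ)))
      (trans (sym (Σ-++ (L.map (ℓ ^ suc e *_) (divisors m)) (divisors (ℓ ^ e * m)) μ)) (trans (sym (Σ-↭ μ
          (divisors-pow↭ e m ℓ∤m)))
        (Σμ≡0 (ℓ ^ suc e * m) {{ℕP.m*n≢0 (ℓ ^ suc e) m {{pow≢0 (suc e)}} {{nz}}}} (ℓ^*≢1 e m))))
      where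
      ℓ^*≢1 : ∀ e m → ℓ ^ suc e * m ≢ 1
      ℓ^*≢1 e m eq = ℕ.nonTrivial⇒≢1 {{prime⇒nonTrivial pℓ}} (ℕD.∣1⇒≡1 (subst (ℓ ∣_) eq (ℕD.∣-trans (ℕD.m∣m*n (ℓ ^ e))
          (ℕD.m∣m*n m))))

    -- The divisor sum of d ↦ μ(ℓd) + μ(d) over d ∣ m is the sum of μ over all divisors of ℓm, which
    -- is zero; injectivity of divisor sums does the rest.
    μ-prime : ∀ m .{{_ : NonZero m}} → ¬ ℓ ∣ m → μ (ℓ * m) ℤ.+ μ m ≡ + 0
    μ-prime = divisorSums-injective (λ m → ¬ ℓ ∣ m) ∤-∣ (λ m → μ (ℓ * m) ℤ.+ μ m) λ m ℓ∤m →
      trans (sym (Σ-+ (divisors m) _ μ)) (trans (cong₂ ℤ._+_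
        (Σ-cong (divisors m) {λ d → μ (ℓ * d)} {λ d → μ (ℓ ^ 1 * d)} λ {x} _ → cong (λ q → μ (q * x)) (sym (ℕP.*-identityʳ ℓ)))
        (cong (λ k → Σ[ divisors k ] μ) (sym (ℕP.*-identityˡ m)))) (Σ-step 0 m ℓ∤m))

    -- The sum of μ(ℓ^(e+2) d) over d ∣ m is the difference of the sums of μ over the divisors of
    -- ℓ^(e+2) m and of ℓ^(e+1) m, and both vanish.
    μ-square : ∀ e m .{{_ : NonZero m}} → ¬ ℓ ∣ m → μ (ℓ ^ suc (suc e) * m) ≡ + 0
    μ-square e = divisorSums-injective (λ m → ¬ ℓ ∣ m) ∤-∣ (λ m → μ (ℓ ^ suc (suc e) * m)) λ m {{nz}} ℓ∤m →
      trans (sym (ℤP.+-identityʳ _)) (trans (cong (ℤ._+_ (Σ[ divisors m ] (λ d → μ (ℓ ^ suc (suc e) * d))))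
        (sym (Σμ≡0 (ℓ ^ suc e * m) {{ℕP.m*n≢0 (ℓ ^ suc e) m {{pow≢0 (suc e)}} {{nz}}}}
            (λ eq → ℕ.nonTrivial⇒≢1 {{prime⇒nonTrivial pℓ}}
          (ℕD.∣1⇒≡1 (subst (ℓ ∣_) eq (ℕD.∣-trans (ℕD.m∣m*n (ℓ ^ e)) (ℕD.m∣m*n m)))))))) (Σ-step (suc e) m ℓ∤m))

  -- For ε = 1 and ε = -1 these are, by definition, the exponent lists behind `cycNum` and `cycDen`.
  signedDivisors : ℤ → ℕ → List ℕ
  signedDivisors ε n = filterᵇ (λ d → does (μ (divℕ n d) ℤ.≟ ε)) (divisorsNZ n)

  divisorsNZ≡ : ∀ n .{{_ : NonZero n}} → divisorsNZ n ≡ divisors n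
  divisorsNZ≡ (suc n) = refl

  divℕ-cofactor : ∀ y x → NonZero x → divℕ (y * x) x ≡ y
  divℕ-cofactor y (suc x) _ = m*n/n≡m y (suc x)

  ∈-signed⁺ : ∀ ε {n x} .{{_ : NonZero n}} y → n ≡ y * x → μ y ≡ ε → x ∈ signedDivisors ε n
  ∈-signed⁺ ε {n} {x} y n≡ μy = ∈-filter⁺ (λ d → T? (does (μ (divℕ n d) ℤ.≟ ε))) (subst (x ∈_) (sym (divisorsNZ≡ n))
      (∈-divisors⁺ (divides y n≡)))
    (T-does⁺ (μ (divℕ n x) ℤ.≟ ε) (trans (cong μ (trans (cong (λ k → divℕ k x) n≡) (divℕ-cofactor y x x≢0))) μy))
    where
    x≢0 : NonZero x
    x≢0 = ℕ.≢-nonZero λ { refl → ℕ.≢-nonZero⁻¹ n (trans n≡ (ℕP.*-zeroʳ y)) }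

  ∈-signed⁻ : ∀ ε {n x} .{{_ : NonZero n}} → x ∈ signedDivisors ε n → ∃ λ y → n ≡ y * x × μ y ≡ ε
  ∈-signed⁻ ε {n} {x} m with ∈-filter⁻ (λ d → T? (does (μ (divℕ n d) ℤ.≟ ε))) m
  ... | x∈ , t with ∈-divisors⁻ {n} (subst (x ∈_) (divisorsNZ≡ n) x∈)
  ... | 0<x , divides y n≡ = y , n≡ , trans (sym (cong μ (trans (cong (λ k → divℕ k x) n≡) (divℕ-cofactor y x
      (ℕ.>-nonZero 0<x))))) (T-does⁻ (μ (divℕ n x) ℤ.≟ ε) t)

  signed-unique : ∀ ε n .{{_ : NonZero n}} → Unique (signedDivisors ε n)
  signed-unique ε n = Unq.filter⁺ _ (subst Unique (sym (divisorsNZ≡ n)) (divisors-unique n))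

  module SignedStep (ℓ : ℕ) (pℓ : Prime ℓ) where
    open PrimePower ℓ pℓ

    private
      opposite : ∀ {a b} → a ℤ.+ b ≡ + 0 → a ≡ ℤ.- b
      opposite {a} {b} e = trans (sym (trans (ℤP.+-assoc a b (ℤ.- b)) (trans (cong (ℤ._+_ a) (ℤP.+-inverseʳ b))
          (ℤP.+-identityʳ a))))
        (trans (cong (ℤ._+ (ℤ.- b)) e) (ℤP.+-identityˡ (ℤ.- b)))

    -- The two parts come from the power ℓ^j in the cofactor y of x: for j = 0 the sign is unchanged
    -- and x takes all of ℓ^(e+1); for j = 1 the sign flips and x takes ℓ^e; for j ≥ 2 the value
    -- μ(y) is 0 and x does not occur. Up to a scaling by ℓ^e this is the recursion of `bs` and
    -- `cs`.
    signed↭ : ∀ ε → ε ≢ + 0 → ∀ e m .{{_ : NonZero m}} → ¬ ℓ ∣ m →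
      signedDivisors ε (ℓ ^ suc e * m) ↭ L.map (ℓ ^ suc e *_) (signedDivisors ε m) ++ L.map (ℓ ^ e *_) (signedDivisors (ℤ.- ε) m)
    signed↭ ε ε≢0 e m {{nz}} ℓ∤m = unique↭ (signed-unique ε (ℓ ^ suc e * m) {{N≢0}})
      (Unq.++⁺ (Unq.map⁺ (ℕP.*-cancelˡ-≡ _ _ (ℓ ^ suc e) {{pow≢0 (suc e)}}) (signed-unique ε m))
               (Unq.map⁺ (ℕP.*-cancelˡ-≡ _ _ (ℓ ^ e) {{pow≢0 e}}) (signed-unique (ℤ.- ε) m)) disj) to from
      where
      N≢0 : NonZero (ℓ ^ suc e * m)
      N≢0 = ℕP.m*n≢0 (ℓ ^ suc e) m {{pow≢0 (suc e)}} {{nz}}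
      S₁ = L.map (ℓ ^ suc e *_) (signedDivisors ε m)
      S₂ = L.map (ℓ ^ e *_) (signedDivisors (ℤ.- ε) m)
      disj : Disjoint S₁ S₂
      disj (a , b) with ∈-map⁻ (ℓ ^ suc e *_) a | ∈-map⁻ (ℓ ^ e *_) b
      ... | x , _ , refl | y , y∈ , eq with ∈-signed⁻ (ℤ.- ε) {m} y∈
      ... | z , m≡ , _ = no-extra-ℓ e ℓ∤m (subst (_∣ ℓ ^ e * m) (sym eq) (ℕD.*-monoʳ-∣ (ℓ ^ e) (divides z m≡)))
      to : ∀ {x} → x ∈ signedDivisors ε (ℓ ^ suc e * m) → x ∈ S₁ ++ S₂
      to {x} x∈ with ∈-signed⁻ ε {ℓ ^ suc e * m} {{N≢0}} x∈
      ... | y , eq , μy = go (extract-power ℓ pℓ y {{y≢0}})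
        where
        y≢0 : NonZero y
        y≢0 = ℕ.≢-nonZero λ { refl → ℕ.≢-nonZero⁻¹ _ {{N≢0}} eq }
        go : (∃ λ j → ∃ λ y′ → y ≡ ℓ ^ j * y′ × ¬ ℓ ∣ y′) → x ∈ S₁ ++ S₂
        cancel : ∀ f y′ → NonZero y′ → ¬ ℓ ∣ y′ → y′ * x ≡ ℓ ^ f * m → ∃ λ t → m ≡ y′ * t × x ≡ ℓ ^ f * t
        cancel f y′ nz′ ℓ∤y′ e′ with coprime-divisor (coprime-pow f ℓ∤y′) (divides x (trans (sym e′) (ℕP.*-comm y′ x)))
        ... | divides t m≡ = t , trans m≡ (ℕP.*-comm t y′) , ℕP.*-cancelʳ-≡ x _ y′ {{nz′}}
                (trans (ℕP.*-comm x y′) (trans e′ (trans (cong (ℓ ^ f *_) m≡) (sym (ℕP.*-assoc (ℓ ^ f) t y′)))))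
        go (j , y′ , y≡ , ℓ∤y′) with y′≢0
          where
          y′≢0 : NonZero y′
          y′≢0 = ℕ.≢-nonZero λ { refl → ℓ∤y′ (ℓ ℕD.∣0) }
        go (zero , y′ , y≡ , ℓ∤y′) | nz′ with cancel (suc e) y′ nz′ ℓ∤y′ (trans (cong (_* x) (trans (sym
            (ℕP.*-identityˡ y′)) (sym y≡))) (sym eq))
        ... | t , m≡ , x≡ = subst (_∈ _) (sym x≡) (∈-++⁺ˡ (∈-map⁺ (ℓ ^ suc e *_) (∈-signed⁺ ε y′ m≡ (trans (cong μ
            (trans (sym (ℕP.*-identityˡ y′)) (sym y≡))) μy))))
        go (suc zero , y′ , y≡ , ℓ∤y′) | nz′ with cancel e y′ nz′ ℓ∤y′ (ℕP.*-cancelˡ-≡ _ _ ℓ (trans (sym (ℕP.*-assoc ℓ y′ x))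
             (trans (cong (λ q → q * y′ * x) (sym (ℕP.*-identityʳ ℓ))) (trans (cong (_* x) (sym y≡)) (trans (sym eq)
                 (ℕP.*-assoc ℓ (ℓ ^ e) m))))))
        ... | t , m≡ , x≡ = subst (_∈ _) (sym x≡) (∈-++⁺ʳ S₁ (∈-map⁺ (ℓ ^ e *_) (∈-signed⁺ (ℤ.- ε) y′ m≡ μy′)))
          where
          μy′ : μ y′ ≡ ℤ.- ε
          μy′ = opposite (trans (ℤP.+-comm (μ y′) ε) (trans (cong (ℤ._+ μ y′) (trans (sym μy) (cong μ (trans y≡ (cong
              (_* y′) (ℕP.*-identityʳ ℓ)))))) (μ-prime y′ {{nz′}} ℓ∤y′)))
        go (suc (suc j) , y′ , y≡ , ℓ∤y′) | nz′ = ⊥-elim (ε≢0 (trans (sym μy) (trans (cong μ y≡) (μ-square j y′ {{nz′}} ℓ∤y′))))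
      from : ∀ {x} → x ∈ S₁ ++ S₂ → x ∈ signedDivisors ε (ℓ ^ suc e * m)
      from x∈ with ∈-++⁻ S₁ x∈
      ... | inj₁ a with ∈-map⁻ (ℓ ^ suc e *_) a
      ... | t , t∈ , refl with ∈-signed⁻ ε {m} t∈
      ... | y , m≡ , μy = ∈-signed⁺ ε {{N≢0}} y (trans (cong (ℓ ^ suc e *_) m≡) (mulswap (ℓ ^ suc e) y t)) μy
        where
        mulswap : ∀ a b c → a * (b * c) ≡ b * (a * c)
        mulswap a b c = trans (sym (ℕP.*-assoc a b c)) (trans (cong (_* c) (ℕP.*-comm a b)) (ℕP.*-assoc b a c))
      from x∈ | inj₂ b with ∈-map⁻ (ℓ ^ e *_) b
      ... | t , t∈ , refl with ∈-signed⁻ (ℤ.- ε) {m} t∈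
      ... | y , m≡ , μy = ∈-signed⁺ ε {{N≢0}} (ℓ * y)
          (trans (cong (ℓ ^ suc e *_) m≡) (reorg ℓ (ℓ ^ e) y t))
          (trans (opposite (μ-prime y {{y≢0}} (∤-∣ (divides t (trans m≡ (ℕP.*-comm y t))) ℓ∤m))) (trans (cong ℤ.-_ μy)
              (ℤP.neg-involutive ε)))
        where
        y≢0 : NonZero y
        y≢0 = ℕ.≢-nonZero λ { refl → ℕ.≢-nonZero⁻¹ m {{nz}} m≡ }
        reorg : ∀ a b c d → a * b * (c * d) ≡ a * c * (b * d)
        reorg a b c d = trans (ℕP.*-assoc a b (c * d)) (trans (cong (a *_) (trans (sym (ℕP.*-assoc b c d)) (trans (cong
            (_* d) (ℕP.*-comm b c)) (ℕP.*-assoc c b d)))) (sym (ℕP.*-assoc a c (b * d))))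

-- Cyclotomic polynomials of arbitrary index.

module CyclotomicPolynomials where

  open ℤAlgebras
  open PolynomialRing
  open PolynomialEvaluation
  open GeometricSums
  open RadicalCyclotomic
  open MöbiusDivisors
  open import Data.Nat using (_<_; _^_)
  open import Data.Nat.Primality using (Prime; prime⇒nonZero; prime⇒nonTrivial)
  open import Data.Nat.Induction using (<-rec)
  open import Data.Nat.ListAction using (product)
  open import Data.Nat.ListAction.Properties using (∈⇒∣product)
  import Data.List.Properties as LP
  open import Data.List.Membership.Propositional using (_∈_)
  open import Data.List.Relation.Unary.Any using (here; there)
  open import Data.List.Relation.Unary.All using (All; []; _∷_)
  open import Data.List.Relation.Binary.Permutation.Propositional using (_↭_; ↭-trans; ↭-refl; ↭-reflexive)
  import Data.List.Relation.Binary.Permutation.Propositional.Properties as PermP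
  open import Relation.Binary.PropositionalEquality using (refl; sym; trans)

  open ℤAlgebra polyAlg using (_*_; _-_; 1#; *-congˡ; +-congʳ; -_; *-identityʳ; *-comm)
  open Geometric polyAlg using (_∣_; _,_; geo; geo-telescope; ∣-trans; ∣ʳ-respʳ-≈; ^-assocʳ; ^-congʳ) renaming (_^_ to _^ᴾ_)

  -- Encodes Φ_N(X) = Φ_R(X^v), where R is the product of the primes dividing N and v = N/R. The
  -- permutations match the exponents prescribed by μ with those built prime by prime.
  record RadicalForm (N : ℕ) : Set where
    field
      L      : List ℕ
      primes : All Prime L
      rad    : CycRad L
      v      : ℕ
      N≡     : N ≡ v ℕ.* product L
      num↭   : signedDivisors (+ 1) N ↭ L.map (v ℕ.*_) (bs L)
      den↭   : signedDivisors (ℤ.- (+ 1)) N ↭ L.map (v ℕ.*_) (cs L)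
      supp   : ∀ {ℓ} → Prime ℓ → ℓ ℕD.∣ N → ℓ ∈ L

  private
    -- `bs` and `cs` recurse by the same rule with roles exchanged, so this one rearrangement,
    -- resting on ℓ^(e+1)·v = (ℓ^e·v)·ℓ, serves numerator and denominator.
    scaled↭ : ∀ {S₁ S₂} ℓ e v {b c} → S₁ ↭ L.map (v ℕ.*_) b → S₂ ↭ L.map (v ℕ.*_) c →
      L.map ((ℓ ^ suc e) ℕ.*_) S₁ ++ L.map ((ℓ ^ e) ℕ.*_) S₂ ↭ L.map ((ℓ ^ e ℕ.* v) ℕ.*_) (L.map (ℓ ℕ.*_) b ++ c)
    scaled↭ ℓ e v {b} {c} p q = ↭-trans (PermP.++⁺ (PermP.map⁺ _ p) (PermP.map⁺ _ q)) (↭-reflexive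
      (trans (cong₂ _++_ (trans (sym (LP.map-∘ b)) (trans (LP.map-cong assoc₁ b) (LP.map-∘ b))) (trans (sym
          (LP.map-∘ c)) (LP.map-cong (λ x → sym (ℕP.*-assoc (ℓ ^ e) v x)) c)))
        (sym (LP.map-++ _ (L.map (ℓ ℕ.*_) b) c))))
      where
      assoc₁ : ∀ x → ℓ ^ suc e ℕ.* (v ℕ.* x) ≡ ℓ ^ e ℕ.* v ℕ.* (ℓ ℕ.* x)
      assoc₁ x = trans (cong (ℕ._* (v ℕ.* x)) (ℕP.*-comm ℓ (ℓ ^ e))) (trans (ℕP.*-assoc (ℓ ^ e) ℓ (v ℕ.* x))
        (trans (cong (ℓ ^ e ℕ.*_) (trans (sym (ℕP.*-assoc ℓ v x)) (trans (cong (ℕ._* x) (ℕP.*-comm ℓ v))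
            (ℕP.*-assoc v ℓ x)))) (sym (ℕP.*-assoc (ℓ ^ e) v (ℓ ℕ.* x)))))

  radicalForm-1 : RadicalForm 1
  radicalForm-1 = record
    { L = [] ; primes = [] ; rad = cycRad-[] ; v = 1 ; N≡ = refl ; num↭ = ↭-refl ; den↭ = ↭-refl
    ; supp = λ pℓ ℓ∣1 → ⊥-elim (ℕ.nonTrivial⇒≢1 {{prime⇒nonTrivial pℓ}} (ℕD.∣1⇒≡1 ℓ∣1)) }

  radicalForm-step : ∀ ℓ → Prime ℓ → ∀ e m .{{_ : NonZero m}} → ¬ ℓ ℕD.∣ m → RadicalForm m → RadicalForm (ℓ ^ suc e ℕ.* m)
  radicalForm-step ℓ pℓ e m ℓ∤m F = record
    { L      = ℓ ∷ L
    ; primes = pℓ ∷ primes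
    ; rad    = cycRad-∷ primes pℓ (λ ℓ∈L → ℓ∤m (subst (ℓ ℕD.∣_) (sym N≡) (ℕD.∣-trans (∈⇒∣product ℓ∈L) (ℕD.n∣m*n v)))) rad
    ; v      = ℓ ^ e ℕ.* v
    ; N≡     = trans (cong (ℓ ^ suc e ℕ.*_) N≡) (trans (cong (ℕ._* (v ℕ.* product L)) (ℕP.*-comm ℓ (ℓ ^ e))) (trans
        (ℕP.*-assoc (ℓ ^ e) ℓ _)
                 (trans (cong (ℓ ^ e ℕ.*_) (trans (sym (ℕP.*-assoc ℓ v _)) (trans (cong (ℕ._* product L)
                     (ℕP.*-comm ℓ v)) (ℕP.*-assoc v ℓ _)))) (sym (ℕP.*-assoc (ℓ ^ e) v _)))))
    ; num↭   = ↭-trans (SignedStep.signed↭ ℓ pℓ (+ 1) (λ ()) e m ℓ∤m) (scaled↭ ℓ e v num↭ den↭)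
    ; den↭   = ↭-trans (SignedStep.signed↭ ℓ pℓ (ℤ.- (+ 1)) (λ ()) e m ℓ∤m) (scaled↭ ℓ e v den↭ num↭)
    ; supp   = supp′
    }
    where
    open RadicalForm F
    supp′ : ∀ {q} → Prime q → q ℕD.∣ ℓ ^ suc e ℕ.* m → q ∈ ℓ ∷ L
    supp′ {q} pq q∣ with q ℕ.≟ ℓ
    ... | yes refl = here refl
    ... | no q≢ℓ = there (supp pq (coprime-divisor′ q∣))
      where
      open import Data.Nat.Coprimality using (coprime-divisor)
      open import Data.Nat.Primality using (prime⇒irreducible)
      ℓ∤q : ¬ ℓ ℕD.∣ q
      ℓ∤q ℓ∣q with prime⇒irreducible pq ℓ∣q
      ... | inj₁ ℓ≡1 = ℕ.nonTrivial⇒≢1 {{prime⇒nonTrivial pℓ}} ℓ≡1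
      ... | inj₂ ℓ≡q = q≢ℓ (sym ℓ≡q)
      coprime-divisor′ : q ℕD.∣ ℓ ^ suc e ℕ.* m → q ℕD.∣ m
      coprime-divisor′ = coprime-divisor (PrimePower.coprime-pow ℓ pℓ (suc e) ℓ∤q)

  radicalForm : ∀ N .{{_ : NonZero N}} → RadicalForm N
  radicalForm N {{nz}} = <-rec Q step N nz
    where
    Q : ℕ → Set
    Q n = .(NonZero n) → RadicalForm n
    step : ∀ n → (∀ {m} → m < n → Q m) → Q n
    step n ih nz with n ℕ.≟ 1
    ... | yes refl = radicalForm-1
    ... | no n≢1 = go (primeDivisor n {{nz}} n≢1)
      where
      go : (∃ λ ℓ → Prime ℓ × ℓ ℕD.∣ n) → RadicalForm n
      go (ℓ , pℓ , ℓ∣n) = go′ (extract-power ℓ pℓ n {{nz}})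
        where
        go′ : (∃ λ e → ∃ λ m → n ≡ ℓ ^ e ℕ.* m × ¬ ℓ ℕD.∣ m) → RadicalForm n
        go′ (zero , m , n≡ , ℓ∤m) = ⊥-elim (ℓ∤m (subst (ℓ ℕD.∣_) (trans n≡ (ℕP.*-identityˡ m)) ℓ∣n))
        go′ (suc e , m , n≡ , ℓ∤m) = subst RadicalForm (sym n≡) (radicalForm-step ℓ pℓ e m {{m≢0}} ℓ∤m (ih m<n m≢0))
          where
          m≢0 : NonZero m
          m≢0 = ℕ.≢-nonZero λ { refl → ℓ∤m (ℓ ℕD.∣0) }
          m<n : m < n
          m<n = subst (m <_) (trans (ℕP.*-comm m (ℓ ^ suc e)) (sym n≡)) (ℕP.m<m*n m (ℓ ^ suc e) {{m≢0}}
            (ℕP.≤-trans (ℕ.nonTrivial⇒n>1 ℓ {{prime⇒nonTrivial pℓ}}) (ℕP.m≤m*n ℓ (ℓ ^ e) {{ℕP.m^n≢0 ℓ e {{prime⇒nonZero pℓ}}}})))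

  -- Monicity is recorded for the numerator and the denominator, whose shape is explicit; `degDen<`
  -- then says that Φ is not constant.
  record Cyclotomic (N : ℕ) : Set where
    field
      Φ         : ZPoly
      Φ*den     : Φ * cycDen N ≋ cycNum N
      degNum    : ℕ
      degDen    : ℕ
      monicNum  : Monic degNum (cycNum N)
      monicDen  : Monic degDen (cycDen N)
      degDen<   : degDen < degNum
      Φ∣geo     : ∀ ℓ u → Prime ℓ → N ≡ u ℕ.* ℓ → Φ ∣ geo ℓ (X ^ᴾ u)
      Φ∣X^N-1   : Φ ∣ X ^ᴾ N - 1#

  fromRadicalForm : ∀ {N} .{{_ : NonZero N}} → RadicalForm N → Cyclotomic N
  fromRadicalForm {N} {{nz}} F = record
    { Φ = sub v Ψ
    ; Φ*den = Φ*den
    ; monicNum = Monic-≋ (≋-sym num≋) (Monic-pr (map>0 v {{v≢0}} (bs>0 primes)))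
    ; monicDen = Monic-≋ (≋-sym den≋) (Monic-pr (map>0 v {{v≢0}} (cs>0 primes)))
    ; degDen< = ≡.subst₂ _<_ (sym (sum-map-* v (cs L))) (sym (sum-map-* v (bs L))) (ℕP.*-monoʳ-< v {{v≢0}} (cs<bs primes))
    ; Φ∣geo = Φ∣geo
    ; Φ∣X^N-1 = Φ∣X^N-1
    }
    where
    open RadicalForm F
    open CycRad rad renaming (Φ to Ψ)
    v≢0 : NonZero v
    v≢0 = ℕ.≢-nonZero λ v≡0 → ℕ.≢-nonZero⁻¹ N {{nz}} (trans N≡ (cong (ℕ._* product L) v≡0))
    num≋ : cycNum N ≋ pr (L.map (v ℕ.*_) (bs L))
    num≋ = pr-↭ num↭
    den≋ : cycDen N ≋ pr (L.map (v ℕ.*_) (cs L))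
    den≋ = pr-↭ den↭
    Φ*den : sub v Ψ * cycDen N ≋ cycNum N
    Φ*den = ≋-trans (*-congˡ {sub v Ψ} (≋-trans den≋ (≋-sym (sub-pr v (cs L))))) (≋-trans (≋-sym (Sub.ev-mul v Ψ (pr (cs L))))
      (≋-trans (Sub.ev-cong v Φ*C) (≋-trans (sub-pr v (bs L)) (≋-sym num≋))))
    Φ∣geo : ∀ ℓ u → Prime ℓ → N ≡ u ℕ.* ℓ → sub v Ψ ∣ geo ℓ (X ^ᴾ u)
    Φ∣geo ℓ u pℓ N≡uℓ with old (supp pℓ (ℕD.divides u N≡uℓ))
    ... | u′ , e , d = subst (λ k → sub v Ψ ∣ geo ℓ (X ^ᴾ k)) u≡ (∣ʳ-respʳ-≈ (sub-geo-X^ v ℓ u′) (sub-∣ v d))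
      where
      u≡ : v ℕ.* u′ ≡ u
      u≡ = ℕP.*-cancelʳ-≡ _ u ℓ {{prime⇒nonZero pℓ}} (trans (ℕP.*-assoc v u′ ℓ) (trans (cong (v ℕ.*_) (sym e)) (trans
          (sym N≡) N≡uℓ)))
    Φ∣X^N-1 : sub v Ψ ∣ X ^ᴾ N - 1#
    Φ∣X^N-1 with N ℕ.≟ 1
    -- 1 has no prime divisor, but here X^N - 1 is the numerator itself, a multiple of Φ.
    ... | yes N≡1 = subst (λ k → sub v Ψ ∣ X ^ᴾ k - 1#) (sym N≡1) (∣ʳ-respʳ-≈ (≋-trans (*-identityʳ (xpm1 1)) (xpm1-≋ 1))
          (subst (λ k → sub v Ψ ∣ cycNum k) N≡1 (cycDen N , ≋-trans (*-comm (cycDen N) (sub v Ψ)) Φ*den)))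
    ... | no N≢1 with primeDivisor N N≢1
    ... | ℓ , pℓ , ℕD.divides u N≡uℓ = ∣ʳ-respʳ-≈ tele (∣-trans (Φ∣geo ℓ u pℓ N≡uℓ) (X ^ᴾ u - 1# , ≋-refl))
      where
      tele : ((X ^ᴾ u - 1#) * geo ℓ (X ^ᴾ u)) ≋ (X ^ᴾ N - 1#)
      tele = ≋-trans (*-comm (X ^ᴾ u - 1#) (geo ℓ (X ^ᴾ u))) (≋-trans (geo-telescope ℓ (X ^ᴾ u)) (+-congʳ { - 1#}
          (≋-trans (^-assocʳ X u ℓ) (^-congʳ X (sym N≡uℓ)))))

  abstract
    cyclotomic : ∀ N .{{_ : NonZero N}} → Cyclotomic N
    cyclotomic N = fromRadicalForm (radicalForm N)

-- The ring ℤ[ζ] as ℤ[X]/Φ_N.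

module RootsOfUnity where

  open ℤAlgebras
  open PolynomialRing
  open PolynomialEvaluation
  open GeometricSums
  open RadicalCyclotomic using (ev-X-id)
  open CyclotomicPolynomials
  open import Data.Nat.Primality using (Prime; prime⇒nonTrivial)
  open import Data.Integer.Divisibility.Signed as ℤD using (divides; ∣m∣n⇒∣m+n)

  module Quotient (A : ℤAlgebra) (φ : ℤAlgebra.Carrier A) where
    open ℤAlgebra A
    open IntSolver A
    open Geometric A using (_∣_; _,_; geo; _^_)
    open SR setoid

    infix 4 _≈φ_
    -- The quotient keeps carrier and operations and only weakens equality, so powers, geometric
    -- sums and evaluations computed in it are propositionally those of the original ring.
    record _≈φ_ (x y : Carrier) : Set where
      constructor ⟨_⟩
      field divides-difference : φ ∣ x - y
    open _≈φ_ public

    lift : ∀ {x y} → x ≈ y → x ≈φ y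
    lift {x} {y} e = ⟨ 0# , trans (zeroˡ φ) (sym (trans (+-congʳ e) (-‿inverseʳ y))) ⟩

    φ-sym : ∀ {x y} → x ≈φ y → y ≈φ x
    φ-sym {x} {y} ⟨ q , e ⟩ = ⟨ - q , trans (solve 2 (λ q f → :- q :* f := :- (q :* f)) refl q φ) (trans (-‿cong e)
        (solve 2 (λ x y → :- (x :- y) := y :- x) refl x y)) ⟩

    φ-trans : ∀ {x y z} → x ≈φ y → y ≈φ z → x ≈φ z
    φ-trans {x} {y} {z} ⟨ q , e ⟩ ⟨ r , f ⟩ = ⟨ q + r , trans (distribʳ φ q r) (trans (+-cong e f) (solve 3
        (λ x y z → x :- y :+ (y :- z) := x :- z) refl x y z)) ⟩

    φ-+ : ∀ {x y u v} → x ≈φ y → u ≈φ v → x + u ≈φ y + v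
    φ-+ {x} {y} {u} {v} ⟨ q , e ⟩ ⟨ r , f ⟩ = ⟨ q + r , trans (distribʳ φ q r) (trans (+-cong e f) (solve 4
        (λ x y u v → x :- y :+ (u :- v) := x :+ u :- (y :+ v)) refl x y u v)) ⟩

    φ-neg : ∀ {x y} → x ≈φ y → - x ≈φ - y
    φ-neg {x} {y} ⟨ q , e ⟩ = ⟨ - q , trans (solve 2 (λ q f → :- q :* f := :- (q :* f)) refl q φ) (trans (-‿cong e)
        (solve 2 (λ x y → :- (x :- y) := :- x :- :- y) refl x y)) ⟩

    φ-* : ∀ {x y u v} → x ≈φ y → u ≈φ v → x * u ≈φ y * v
    φ-* {x} {y} {u} {v} ⟨ q , e ⟩ ⟨ r , f ⟩ = ⟨ q * u + y * r , (begin
      (q * u + y * r) * φ          ≈⟨ solve 5 (λ q u y r f → (q :* u :+ y :* r) :* f := (q :* f) :* u :+ y :*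
          (r :* f)) refl q u y r φ ⟩
      (q * φ) * u + y * (r * φ)    ≈⟨ +-cong (*-congʳ e) (*-congˡ f) ⟩
      (x - y) * u + y * (u - v)    ≈⟨ solve 4 (λ x y u v → (x :- y) :* u :+ y :* (u :- v) := x :* u :- y :* v) refl x y u v ⟩
      x * u - y * v                ∎) ⟩

    quotient : ℤAlgebra
    quotient = record
      { commRing = record
        { Carrier = Carrier ; _≈_ = _≈φ_ ; _+_ = _+_ ; _*_ = _*_ ; -_ = -_ ; 0# = 0# ; 1# = 1#
        ; isCommutativeRing = record
          { isRing = record
            { +-isAbelianGroup = record
              { isGroup = record
                { isMonoid = record
                  { isSemigroup = record
                    { isMagma = record
                      { isEquivalence = record { refl = lift refl ; sym = φ-sym ; trans = φ-trans }
                      ; ∙-cong = φ-+ }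
                    ; assoc = λ x y z → lift (+-assoc x y z) }
                  ; identity = (λ x → lift (+-identityˡ x)) , (λ x → lift (+-identityʳ x)) }
                ; inverse = (λ x → lift (-‿inverseˡ x)) , (λ x → lift (-‿inverseʳ x))
                ; ⁻¹-cong = φ-neg }
              ; comm = λ x y → lift (+-comm x y) }
            ; *-cong = φ-*
            ; *-assoc = λ x y z → lift (*-assoc x y z)
            ; *-identity = (λ x → lift (*-identityˡ x)) , (λ x → lift (*-identityʳ x))
            ; distrib = (λ x y z → lift (distribˡ x y z)) , (λ x y z → lift (distribʳ x y z)) }
          ; *-comm = λ x y → lift (*-comm x y) } }
      ; ι = ι
      ; ι-+ = λ a b → lift (ι-+ a b)
      ; ι-* = λ a b → lift (ι-* a b)
      ; ι-neg = λ a → lift (ι-neg a)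
      ; ι-0 = lift ι-0
      ; ι-1 = lift ι-1 }

    private
      x-0 : ∀ x → x ≈ x - 0#
      x-0 x = trans (sym (+-identityʳ x)) (+-congˡ (trans (sym (-‿inverseʳ 0#)) (+-identityˡ (- 0#))))

    ∣⇒≈0 : ∀ {x} → φ ∣ x → x ≈φ 0#
    ∣⇒≈0 {x} (q , e) = ⟨ q , trans e (x-0 x) ⟩

    ≈0⇒∣ : ∀ {x} → x ≈φ 0# → φ ∣ x
    ≈0⇒∣ {x} ⟨ q , e ⟩ = q , trans e (sym (x-0 x))

    module Q = Geometric quotient

    geo-quotient : ∀ n y → Q.geo n y ≡ geo n y
    geo-quotient zero    y = ≡.refl
    geo-quotient (suc n) y = cong (λ g → 1# + y * g) (geo-quotient n y)

    ^-quotient : ∀ y n → y Q.^ n ≡ y ^ n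
    ^-quotient y zero    = ≡.refl
    ^-quotient y (suc n) = cong (y *_) (^-quotient y n)

    ev-quotient : ∀ y p → Evaluation.ev quotient y p ≡ Evaluation.ev A y p
    ev-quotient y []      = ≡.refl
    ev-quotient y (x ∷ p) = cong (λ g → ι x + y * g) (ev-quotient y p)

  -- ℤ[ζ] for a primitive N-th root of unity ζ, reduced to what the argument needs.
  record RootRing (N : ℕ) : Set₁ where
    field
      A : ℤAlgebra
    open ℤAlgebra A
    open Geometric A using (geo; _^_)
    field
      ζ            : Carrier
      ζ^N          : ζ ^ N ≈ 1#
      root-sum     : ∀ j → ¬ N ℕD.∣ j → geo N (ζ ^ j) ≈ 0#
      torsion-free : ∀ n .{{_ : NonZero n}} z → ι (+ n) * z ≈ 0# → z ≈ 0#
      p∤1          : ∀ p → Prime p → ∀ z → ¬ 1# ≈ ι (+ p) * z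
      generated    : ∀ z → ∃ λ y → Evaluation.ev A ζ y ≈ z
      vanishes     : ∀ y → Evaluation.ev A ζ y ≈ 0# → VanishesAtζ N y

  module _ (N : ℕ) .{{_ : NonZero N}} (C : Cyclotomic N) where
    open Cyclotomic C
    open ℤAlgebra polyAlg hiding (zero; _≈_; refl; sym; trans)
    open Geometric polyAlg using (_∣_; _,_) renaming (geo to geoᴾ; _^_ to _^ᴾ_)
    open Quotient polyAlg Φ
    open IntSolver polyAlg
    private
      den = cycDen N
      num = cycNum N

      -- Multiplication by C turns a multiple of Φ into a multiple of the monic B. All arithmetic
      -- modulo Φ goes through this, and it is also the form in which `VanishesAtζ` is stated.
      times-den : ∀ q z → q * Φ ≋ z → q * num ≋ z * den
      times-den q z e = ≋-trans (*-congˡ {q} (≋-sym Φ*den)) (≋-trans (≋-sym (*-assoc q Φ den)) (*-congʳ {den} e))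

      ev≡ : ∀ y → Evaluation.ev quotient X y ≋ y
      ev≡ y = ≋-trans (ℤAlgebra.reflexive polyAlg (ev-quotient X y)) (ev-X-id y)

      const-* : ∀ n z i → coef (const n * z) i ≡ n ℤ.* coef z i
      const-* n z i = ≡.trans (≡.sym (at (scale-const n z) i)) (coef-scale n z i)

      -- From n z = qΦ follows qB = n z C. As B is monic, n divides every coefficient of q; then q =
      -- n q′ and z = q′Φ.
      tf : ∀ n .{{_ : NonZero n}} z → (const (+ n) * z) ≈φ 0# → z ≈φ 0#
      tf n {{nz}} z h with ≈0⇒∣ h
      ... | q , e with ∣coefs⇒scale (+ n) q (monic-cancel-∣ (+ n) q num monicNum λ j →
            divides (coef (z * den) (degNum ℕ.+ j)) (≡.trans (at (times-den q (const (+ n) * z) e) _)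
              (≡.trans (at (*-assoc (const (+ n)) z den) _) (≡.trans (const-* (+ n) (z * den) _) (ℤP.*-comm (+ n) (coef
                  (z * den) (degNum ℕ.+ j)))))))
      ... | q′ , q≋ = ∣⇒≈0 (q′ , mk≋ λ i → ℤP.*-cancelˡ-≡ (+ n) _ _ {{nz}} (≡.trans (≡.sym (≡.trans (at qΦ i) (const-*
          (+ n) (q′ * Φ) i)))
              (≡.trans (at e i) (const-* (+ n) z i))))
        where
        qΦ : q * Φ ≋ const (+ n) * (q′ * Φ)
        qΦ = ≋-trans (*-congʳ {Φ} (≋-trans q≋ (scale-const (+ n) q′))) (*-assoc (const (+ n)) q′ Φ)

      -- From 1 - p z = sΦ follows C = sB + p z C. In degrees from deg B on, C has no coefficients,
      -- so p divides those of sB and hence, B being monic, all of s. Then p divides every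
      -- coefficient of C, against its leading coefficient 1.
      nonunit : ∀ p → Prime p → ∀ z → ¬ (+ 1 ∷ []) ≈φ (const (+ p) * z)
      nonunit p pp z ⟨ s , e ⟩ = p∤1ℤ (subst (+ p ℤD.∣_) (leading monicDen) (p∣den degDen))
        where
        p∤1ℤ : ¬ + p ℤD.∣ + 1
        p∤1ℤ d = ℕ.nonTrivial⇒≢1 {{prime⇒nonTrivial pp}} (ℕD.∣1⇒≡1 (ℤD.∣⇒∣ᵤ d))
        den≋ : den ≋ s * num + const (+ p) * (z * den)
        den≋ = ≋-sym (≋-trans (+-congʳ {const (+ p) * (z * den)} (times-den s ((+ 1 ∷ []) - const (+ p) * z) e))
          (≋-trans (solve 4 (λ o p z d → (o :- p :* z) :* d :+ p :* (z :* d) := o :* d) ≋-refl (+ 1 ∷ []) (const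
              (+ p)) z den) (*-identityˡ den)))
        p∣pz : ∀ i → + p ℤD.∣ coef (const (+ p) * (z * den)) i
        p∣pz i = divides (coef (z * den) i) (≡.trans (const-* (+ p) (z * den) i) (ℤP.*-comm (+ p) _))
        coefs : ∀ i → coef den i ≡ coef (s * num) i ℤ.+ coef (const (+ p) * (z * den)) i
        coefs i = ≡.trans (at den≋ i) (coef-add (s * num) (const (+ p) * (z * den)) i)
        den-above : ∀ j → coef den (degNum ℕ.+ j) ≡ + 0
        den-above j = subst (λ k → coef den k ≡ + 0) (≡.trans (≡.sym (ℕP.+-assoc (suc degDen) _ j)) (cong (ℕ._+ j)
            (ℕP.m+[n∸m]≡n degDen<))) (above monicDen (degNum ℕ.∸ suc degDen ℕ.+ j))
        p∣s : ∀ i → + p ℤD.∣ coef s i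
        p∣s = monic-cancel-∣ (+ p) s num monicNum λ j → ℤD.∣m+n∣m⇒∣n (subst (+ p ℤD.∣_) (≡.trans (≡.sym (den-above j))
            (≡.trans (coefs (degNum ℕ.+ j))
                (ℤP.+-comm (coef (s * num) (degNum ℕ.+ j)) _))) (divides (+ 0) ≡.refl)) (p∣pz (degNum ℕ.+ j))
        p∣den : ∀ i → + p ℤD.∣ coef den i
        p∣den i = subst (+ p ℤD.∣_) (≡.sym (coefs i)) (∣m∣n⇒∣m+n (∣coef-mul (+ p) s num p∣s i) (p∣pz i))

      vanish : ∀ y → y ≈φ 0# → VanishesAtζ N y
      vanish y h with ≈0⇒∣ h
      ... | q , e = q , ≋⇒PolyEq (≋-sym (times-den q y e))

    rootRing : RootRing N
    rootRing = record
      { A = quotient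
      ; ζ = X
      ; ζ^N = φ-trans (lift (ℤAlgebra.reflexive polyAlg (^-quotient X N))) ⟨ Φ∣X^N-1 ⟩
      ; root-sum = Q.geo-root-sum N X λ ℓ u pℓ N≡ → φ-trans (lift (ℤAlgebra.reflexive polyAlg
          (≡.trans (geo-quotient ℓ (X Q.^ u)) (cong (geoᴾ ℓ) (^-quotient X u))))) (∣⇒≈0 (Φ∣geo ℓ u pℓ N≡))
      ; torsion-free = tf
      ; p∤1 = nonunit
      ; generated = λ z → z , lift (ev≡ z)
      ; vanishes = λ y h → vanish y (φ-trans (lift (≋-sym (ev≡ y))) h)
      }

-- Elements of ℤ[ζ] are integral over ℤ.

module IntegralElements where

  open ℤAlgebras
  open PolynomialRing
  open PolynomialEvaluation
  open GeometricSums
  open RootsOfUnity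
  open import Data.Fin using (fromℕ; fromℕ<)
  import Data.Fin.Properties as FinP
  open import Data.Vec as Vec using (Vec)
  import Data.Vec.Properties as VecP
  import Algebra.Properties.Semiring.Sum as Sum

  DegreeBelow : ℕ → ZPoly → Set
  DegreeBelow D f = ∀ j → coef f (D ℕ.+ j) ≡ + 0

  DegreeBelow-suc : ∀ {D f} → DegreeBelow D f → DegreeBelow (suc D) f
  DegreeBelow-suc {D} {f} h j = subst (λ i → coef f i ≡ + 0) (ℕP.+-suc D j) (h (suc j))

  -- One strict bound is enough for a strict bound on the product; this lets a diagonal entry of
  -- degree D multiply an off-diagonal one during elimination.
  DegreeBelow-mul : ∀ {D E} f g → DegreeBelow (suc D) f → DegreeBelow E g → DegreeBelow (D ℕ.+ E) (mulP f g)
  DegreeBelow-mul []      g hf hg j = ≡.refl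
  DegreeBelow-mul {zero} {E} (x ∷ f) g hf hg j = ≡.trans (coef-mul-∷ x f g (E ℕ.+ j))
    (≡.trans (≡.cong₂ (λ a b → x ℤ.* a ℤ.+ b) (hg j) (sh (E ℕ.+ j))) (≡.trans (ℤP.+-identityʳ (x ℤ.* + 0)) (ℤP.*-zeroʳ x)))
    where
    f≋0 : f ≋ []
    f≋0 = mk≋ hf
    sh : ∀ i → coef (+ 0 ∷ mulP f g) i ≡ + 0
    sh zero    = ≡.refl
    sh (suc i) = at (mul-cong {f} {[]} {g} {g} f≋0 ≋-refl) i
  DegreeBelow-mul {suc D} {E} (x ∷ f) g hf hg j = ≡.trans (coef-mul-∷ x f g (suc (D ℕ.+ E ℕ.+ j)))
    (≡.trans (≡.cong₂ (λ a b → x ℤ.* a ℤ.+ b) (subst (λ i → coef g i ≡ + 0) e (hg (suc (D ℕ.+ j)))) (DegreeBelow-mul f g hf hg j))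
      (≡.trans (ℤP.+-identityʳ (x ℤ.* + 0)) (ℤP.*-zeroʳ x)))
    where
    e : E ℕ.+ suc (D ℕ.+ j) ≡ suc (D ℕ.+ E ℕ.+ j)
    e = ≡.trans (ℕP.+-suc E (D ℕ.+ j)) (cong suc (≡.trans (≡.sym (ℕP.+-assoc E D j)) (cong (ℕ._+ j) (ℕP.+-comm E D))))

  open ℤAlgebra polyAlg using () renaming (_-_ to _-ᴾ_; _*_ to _*ᴾ_)

  coef-sub : ∀ f g i → coef (f -ᴾ g) i ≡ coef f i ℤ.+ (ℤ.- (+ 1)) ℤ.* coef g i
  coef-sub f g i = ≡.trans (coef-add f (negP g) i) (cong (ℤ._+_ (coef f i)) (coef-scale (ℤ.- (+ 1)) g i))

  private
    minus-0 : ∀ {a b} c → a ≡ c → b ≡ + 0 → a ℤ.+ (ℤ.- (+ 1)) ℤ.* b ≡ c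
    minus-0 c ≡.refl ≡.refl = ℤP.+-identityʳ c

  DegreeBelow-sub : ∀ {D} f g → DegreeBelow D f → DegreeBelow D g → DegreeBelow D (f -ᴾ g)
  DegreeBelow-sub f g hf hg j = ≡.trans (coef-sub f g _) (minus-0 (+ 0) (hf j) (hg j))

  Monic-sub : ∀ {D} f g → Monic D f → DegreeBelow D g → Monic D (f -ᴾ g)
  Monic-sub {D} f g m h = record
    { leading = ≡.trans (coef-sub f g D) (minus-0 (+ 1) (leading m) (subst (λ i → coef g i ≡ + 0) (ℕP.+-identityʳ D) (h 0)))
    ; above = λ j → ≡.trans (coef-sub f g _) (minus-0 (+ 0) (above m j) (DegreeBelow-suc {D} {g} h j)) }

  module ListSum (A : ℤAlgebra) where
    open ℤAlgebra A hiding (zero)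
    open IntSolver A

    sumL : ∀ {I : Set} → List I → (I → Carrier) → Carrier
    sumL []       f = 0#
    sumL (x ∷ xs) f = f x + sumL xs f

    sumL-++ : ∀ {B : Set} (xs ys : List B) f → sumL (xs ++ ys) f ≈ sumL xs f + sumL ys f
    sumL-++ []       ys f = sym (+-identityˡ _)
    sumL-++ (x ∷ xs) ys f = trans (+-congˡ (sumL-++ xs ys f)) (sym (+-assoc _ _ _))

    sumL-map : ∀ {B C : Set} (g : B → C) xs f → sumL (L.map g xs) f ≈ sumL xs (f ∘ g)
    sumL-map g []       f = refl
    sumL-map g (x ∷ xs) f = +-congˡ (sumL-map g xs f)

    sumL-cong : ∀ {B : Set} (xs : List B) {f g} → (∀ x → f x ≈ g x) → sumL xs f ≈ sumL xs g
    sumL-cong []       h = refl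
    sumL-cong (x ∷ xs) h = +-cong (h x) (sumL-cong xs h)

    sumL-+ : ∀ {B : Set} (xs : List B) f g → sumL xs f + sumL xs g ≈ sumL xs (λ x → f x + g x)
    sumL-+ []       f g = +-identityˡ 0#
    sumL-+ (x ∷ xs) f g = trans (solve 4 (λ a b c d → (a :+ b) :+ (c :+ d) := (a :+ c) :+ (b :+ d)) refl (f x)
        (sumL xs f) (g x) (sumL xs g)) (+-congˡ (sumL-+ xs f g))

    sumL-* : ∀ {B : Set} c (xs : List B) f → c * sumL xs f ≈ sumL xs (λ x → c * f x)
    sumL-* c []       f = zeroʳ c
    sumL-* c (x ∷ xs) f = trans (distribˡ c _ _) (+-congˡ (sumL-* c xs f))

    sumL-zero : ∀ {B : Set} (xs : List B) {f} → (∀ x → f x ≈ 0#) → sumL xs f ≈ 0#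
    sumL-zero []       h = refl
    sumL-zero (x ∷ xs) h = trans (+-cong (h x) (sumL-zero xs h)) (+-identityˡ 0#)

    sumL-swap : ∀ {B C : Set} (xs : List B) (ys : List C) (f : B → C → Carrier) → sumL xs (λ x → sumL ys
        (f x)) ≈ sumL ys (λ y → sumL xs (λ x → f x y))
    sumL-swap []       ys f = sym (sumL-zero ys (λ _ → refl))
    sumL-swap (x ∷ xs) ys f = trans (+-congˡ (sumL-swap xs ys f)) (sumL-+ ys (f x) _)

    sumL-filter : ∀ {B : Set} (b : B → Bool) (xs : List B) f → sumL (filterᵇ b xs) f ≈ sumL xs (λ x → if b x then f x else 0#)
    sumL-filter b []       f = refl
    sumL-filter b (x ∷ xs) f with b x
    ... | true  = +-congˡ (sumL-filter b xs f)
    ... | false = trans (sumL-filter b xs f) (sym (+-identityˡ _))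

  module Integrality {N : ℕ} .{{_ : NonZero N}} (R : RootRing N) where
    open RootRing R
    open ℤAlgebra A hiding (zero)
    open IntSolver A
    open Geometric A using (_^_; ^-homo-*; ^-congʳ)
    open Sum semiring using (sum; sum-cong-≋; ∑-distrib-+; *-distribˡ-sum; sum-remove)
    open ListSum A
    open SR setoid

    -- A determinant-free Cayley–Hamilton: one fraction-free elimination step preserves the shape of the
    -- matrix (monic diagonal of degree D, smaller degrees elsewhere) and doubles D.
    eliminate : ∀ (q : Carrier) n D (a : Fin (suc n) → Fin (suc n) → ZPoly) (e : Fin (suc n) → Carrier) →
      (∀ i → Monic D (a i i)) → (∀ i j → i ≢ j → DegreeBelow D (a i j)) →
      (∀ i → sum (λ j → Evaluation.ev A q (a i j) * e j) ≈ 0#) →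
      ∃ λ d → ∃ λ f → Monic d f × Evaluation.ev A q f * e (fromℕ n) ≈ 0#
    eliminate q zero    D a e diag off rel = D , a zero zero , diag zero , trans (sym (+-identityʳ _)) (rel zero)
    eliminate q (suc n) D a e diag off rel = eliminate q n (D ℕ.+ D) a′ (e ∘ suc) diag′ off′ rel′
      where
      open Evaluation A q
      a′ : Fin (suc n) → Fin (suc n) → ZPoly
      a′ i j = a zero zero *ᴾ a (suc i) (suc j) -ᴾ a (suc i) zero *ᴾ a zero (suc j)
      degD : ∀ i j → DegreeBelow (suc D) (a i j)
      degD i j with i Fin.≟ j
      ... | yes ≡.refl = above (diag i)
      ... | no i≢j     = DegreeBelow-suc {D} {a i j} (off i j i≢j)
      below : ∀ i j → DegreeBelow (D ℕ.+ D) (a (suc i) zero *ᴾ a zero (suc j))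
      below i j = DegreeBelow-mul (a (suc i) zero) (a zero (suc j)) (degD (suc i) zero) (off zero (suc j) (λ ()))
      diag′ : ∀ i → Monic (D ℕ.+ D) (a′ i i)
      diag′ i = Monic-sub _ _ (Monic-mul (a zero zero) _ (diag zero) (diag (suc i))) (below i i)
      off′ : ∀ i j → i ≢ j → DegreeBelow (D ℕ.+ D) (a′ i j)
      off′ i j i≢j = DegreeBelow-sub (a zero zero *ᴾ a (suc i) (suc j)) _
        (DegreeBelow-mul (a zero zero) (a (suc i) (suc j)) (degD zero zero) (off (suc i) (suc j)
            (i≢j ∘ FinP.suc-injective))) (below i j)
      ev-a′ : ∀ i j → ev (a′ i j) ≈ ev (a zero zero) * ev (a (suc i) (suc j)) + - ev (a (suc i) zero) * ev (a zero (suc j))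
      ev-a′ i j = begin
        ev (a′ i j)            ≈⟨ ev-add (a zero zero *ᴾ a (suc i) (suc j)) (negP (a (suc i) zero *ᴾ a zero (suc j))) ⟩
        ev (a zero zero *ᴾ a (suc i) (suc j)) + ev (negP (a (suc i) zero *ᴾ a zero (suc j)))
                               ≈⟨ +-cong (ev-mul (a zero zero) _) (trans (ev-scale (ℤ.- (+ 1)) (a (suc i) zero *ᴾ a zero
                                   (suc j))) (*-cong (trans (ι-neg (+ 1)) (-‿cong ι-1)) (ev-mul (a (suc i) zero) (a zero
                                   (suc j))))) ⟩
        ev (a zero zero) * ev (a (suc i) (suc j)) + - 1# * (ev (a (suc i) zero) * ev (a zero (suc j)))
                               ≈⟨ +-congˡ (trans (solve 3 (λ o x y → :- o :* (x :* y) := :- (o :* x) :* y) refl 1# (ev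
                                   (a (suc i) zero)) (ev (a zero (suc j)))) (*-congʳ (-‿cong (*-identityˡ _)))) ⟩
        ev (a zero zero) * ev (a (suc i) (suc j)) + - ev (a (suc i) zero) * ev (a zero (suc j)) ∎
      rel′ : ∀ i → sum (λ j → ev (a′ i j) * e (suc j)) ≈ 0#
      rel′ i = begin
        sum (λ j → ev (a′ i j) * e (suc j))
          ≈⟨ sum-cong-≋ (λ j → trans (*-congʳ (ev-a′ i j)) (solve 5 (λ p x r y s → (p :* x :+ r :* y) :* s := p :*
              (x :* s) :+ r :* (y :* s)) refl (ev (a zero zero)) (ev (a (suc i) (suc j))) (- ev (a (suc i) zero)) (ev
              (a zero (suc j))) (e (suc j)))) ⟩
        sum (λ j → P * U j + - T * V j)
          ≈⟨ ∑-distrib-+ (λ j → P * U j) (λ j → - T * V j) ⟩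
        sum (λ j → P * U j) + sum (λ j → - T * V j)
          ≈⟨ +-cong (*-distribˡ-sum P U) (*-distribˡ-sum (- T) V) ⟨
        P * sum U + - T * sum V
          ≈⟨ solve 5 (λ p t u v z → p :* u :+ :- t :* v := p :* (t :* z :+ u) :+ :- t :* (p :* z :+ v)) refl P T (sum U)
              (sum V) (e zero) ⟩
        P * (T * e zero + sum U) + - T * (P * e zero + sum V)
          ≈⟨ +-cong (*-congˡ (rel (suc i))) (*-congˡ (rel zero)) ⟩
        P * 0# + - T * 0#
          ≈⟨ trans (+-cong (zeroʳ P) (zeroʳ (- T))) (+-identityˡ 0#) ⟩
        0# ∎
        where
        P = ev (a zero zero)
        T = ev (a (suc i) zero)
        U V : Fin (suc n) → Carrier
        U j = ev (a (suc i) (suc j)) * e (suc j)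
        V j = ev (a zero (suc j)) * e (suc j)

    Span : ∀ {n} → (Fin n → Carrier) → Carrier → Set
    Span e z = ∃ λ (α : _ → ℤ) → z ≈ sum (λ j → ι (α j) * e j)

    sum-zero : ∀ {n} (e : Fin n → Carrier) → 0# ≈ sum (λ j → ι (+ 0) * e j)
    sum-zero {zero}  e = refl
    sum-zero {suc n} e = trans (sym (+-identityˡ 0#)) (+-cong (sym (trans (*-congʳ ι-0) (zeroˡ _))) (sum-zero (e ∘ suc)))

    Span-0 : ∀ {n} {e : Fin n → Carrier} → Span e 0#
    Span-0 {e = e} = (λ _ → + 0) , sum-zero e

    Span-≈ : ∀ {n} {e : Fin n → Carrier} {x y} → x ≈ y → Span e x → Span e y
    Span-≈ h (α , r) = α , trans (sym h) r

    Span-+ : ∀ {n} {e : Fin n → Carrier} {x y} → Span e x → Span e y → Span e (x + y)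
    Span-+ {e = e} (α , r) (β , s) = (λ j → α j ℤ.+ β j) , trans (+-cong r s) (sym (trans
      (sum-cong-≋ (λ j → trans (*-congʳ (ι-+ (α j) (β j))) (distribʳ (e j) _ _))) (∑-distrib-+ (λ j → ι (α j) * e j)
          (λ j → ι (β j) * e j))))

    Span-ι : ∀ {n} {e : Fin n → Carrier} {x} c → Span e x → Span e (ι c * x)
    Span-ι {e = e} c (α , r) = (λ j → c ℤ.* α j) , trans (*-congˡ r) (trans (*-distribˡ-sum (ι c) (λ j → ι (α j) * e j))
      (sum-cong-≋ (λ j → trans (sym (*-assoc (ι c) (ι (α j)) (e j))) (*-congʳ (sym (ι-* c (α j)))))))

    Span-e : ∀ {n} (e : Fin n → Carrier) j → Span e (e j)
    Span-e e zero = (λ { zero → + 1 ; (suc _) → + 0 }) , trans (sym (+-identityʳ _))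
      (+-cong (sym (trans (*-congʳ ι-1) (*-identityˡ _))) (sum-zero (e ∘ suc)))
    Span-e e (suc j) with Span-e (e ∘ suc) j
    ... | α , r = (λ { zero → + 0 ; (suc i) → α i }) , trans (sym (+-identityˡ _)) (+-cong (sym (trans (*-congʳ ι-0)
        (zeroˡ _))) r)

    -- The exponents run over 1, …, N, so that the last power is 1.
    powers : Fin N → Carrier
    powers j = ζ ^ suc (toℕ j)

    ζ^-period : ∀ q r → ζ ^ (r ℕ.+ q ℕ.* N) ≈ ζ ^ r
    ζ^-period zero    r = ^-congʳ ζ (ℕP.+-identityʳ r)
    ζ^-period (suc q) r = begin
      ζ ^ (r ℕ.+ (N ℕ.+ q ℕ.* N))      ≈⟨ ^-congʳ ζ (≡.trans (≡.sym (ℕP.+-assoc r N _)) (≡.trans (cong (ℕ._+ q ℕ.* N)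
          (ℕP.+-comm r N)) (ℕP.+-assoc N r _))) ⟩
      ζ ^ (N ℕ.+ (r ℕ.+ q ℕ.* N))      ≈⟨ ^-homo-* ζ N _ ⟩
      ζ ^ N * ζ ^ (r ℕ.+ q ℕ.* N)      ≈⟨ *-cong ζ^N (ζ^-period q r) ⟩
      1# * ζ ^ r                       ≈⟨ *-identityˡ _ ⟩
      ζ ^ r                            ∎

    open import Data.Nat.DivMod using (_%_; _/_; m≡m%n+[m/n]*n; m%n<n)

    ζ^suc∈Span : ∀ k → Span powers (ζ ^ suc k)
    ζ^suc∈Span k = Span-≈ (begin
        ζ ^ suc (toℕ j)                     ≈⟨ ^-congʳ ζ (cong suc (FinP.toℕ-fromℕ< (m%n<n k N))) ⟩
        ζ ^ suc (k % N)                     ≈⟨ ζ^-period (k / N) (suc (k % N)) ⟨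
        ζ ^ suc (k % N ℕ.+ k / N ℕ.* N)     ≈⟨ ^-congʳ ζ (cong suc (m≡m%n+[m/n]*n k N)) ⟨
        ζ ^ suc k                           ∎) (Span-e powers j)
      where
      j = fromℕ< (m%n<n k N)

    -- Supplies the integer matrix of multiplication by an element of ℤ[ζ]. The exponent `k` is
    -- general because each Horner step moves one factor ζ over to the power.
    ev*ζ^∈Span : ∀ y k → Span powers (Evaluation.ev A ζ y * ζ ^ suc k)
    ev*ζ^∈Span []      k = Span-≈ (sym (zeroˡ _)) Span-0
    ev*ζ^∈Span (x ∷ y) k = Span-≈ (solve 4 (λ x z e p → x :* p :+ e :* (z :* p) := (x :+ z :* e) :* p) refl (ι x) ζ
        (Evaluation.ev A ζ y) (ζ ^ suc k))
      (Span-+ (Span-ι x (ζ^suc∈Span k)) (ev*ζ^∈Span y (suc k)))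

    sum-tabulate : ∀ {I : Set} n (g : Fin n → I) (f : I → Carrier) → sumL (L.tabulate g) f ≈ sum (f ∘ g)
    sum-tabulate zero    g f = refl
    sum-tabulate (suc n) g f = +-congˡ (sum-tabulate n (g ∘ suc) f)

    ev-monic : ∀ q {d} f → Monic d f → Evaluation.ev A q f ≈ q ^ d + sum {d} (λ i → ι (coef f (toℕ i)) * q ^ toℕ i)
    ev-monic q []      m with leading m
    ... | ()
    ev-monic q {zero} (x ∷ f) m = begin
      ι x + q * ev f       ≈⟨ +-cong (trans (ι-cong (leading m)) ι-1) (trans (*-congˡ (ev-zero f (above m))) (zeroʳ q)) ⟩
      1# + 0#              ∎
      where open Evaluation A q
    ev-monic q {suc d} (x ∷ f) m = begin
      ι x + q * ev f
        ≈⟨ +-congˡ (*-congˡ (ev-monic q f (record { leading = leading m ; above = above m }))) ⟩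
      ι x + q * (q ^ d + S)
        ≈⟨ +-congʳ (sym (*-identityʳ (ι x))) ⟩
      ι x * 1# + q * (q ^ d + S)
        ≈⟨ solve 4 (λ x q d s → x :+ q :* (d :+ s) := q :* d :+ (x :+ q :* s)) refl (ι x * 1#) q (q ^ d) S ⟩
      q * q ^ d + (ι x * 1# + q * S)
        ≈⟨ +-congˡ (+-congˡ (trans (*-distribˡ-sum q F) (sum-cong-≋ {d} (λ i → solve 3 (λ q c p → q :* (c :* p) := c :*
            (q :* p)) refl q (ι (coef f (toℕ i))) (q ^ toℕ i))))) ⟩
      q * q ^ d + (ι x * 1# + sum {d} (λ i → ι (coef f (toℕ i)) * (q * q ^ toℕ i))) ∎
      where
      open Evaluation A q
      F : Fin d → Carrier
      F i = ι (coef f (toℕ i)) * q ^ toℕ i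
      S = sum F

    -- Multiplication by q on the powers of ζ has an integer matrix α. Elimination applied to X·1 -
    -- α, whose entries evaluated at X = q annihilate the vector of powers, gives f(q)·ζ^N = 0 with
    -- f monic, and ζ^N = 1. The equation for N provides the last index.
    integral-last : ∀ n → N ≡ suc n → ∀ q → ∃ λ d → ∃ λ f → Monic d f × Evaluation.ev A q f ≈ 0#
    integral-last n ≡.refl q with proj₂ (generated q)
    ... | gen = finish (eliminate q n 1 a powers diag off rel)
      where
      open Evaluation A q
      α : Fin (suc n) → Fin (suc n) → ℤ
      α i = proj₁ (Span-≈ {e = powers} (*-congʳ gen) (ev*ζ^∈Span (proj₁ (generated q)) (toℕ i)))
      α-rel : ∀ i → q * powers i ≈ sum (λ j → ι (α i j) * powers j)
      α-rel i = proj₂ (Span-≈ {e = powers} (*-congʳ gen) (ev*ζ^∈Span (proj₁ (generated q)) (toℕ i)))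
      entry : ∀ {i j : Fin (suc n)} → Dec (i ≡ j) → ℤ → ZPoly
      entry (yes _) c = ℤ.- c ∷ + 1 ∷ []
      entry (no _)  c = ℤ.- c ∷ []
      a : Fin (suc n) → Fin (suc n) → ZPoly
      a i j = entry (i Fin.≟ j) (α i j)
      diag : ∀ i → Monic 1 (a i i)
      diag i with i Fin.≟ i
      ... | yes _ = record { leading = ≡.refl ; above = λ _ → ≡.refl }
      ... | no ¬p with ¬p ≡.refl
      ... | ()
      off : ∀ i j → i ≢ j → DegreeBelow 1 (a i j)
      off i j i≢j k with i Fin.≟ j
      ... | yes p with i≢j p
      ... | ()
      off i j i≢j k | no _ = ≡.refl
      δ : ∀ {i j : Fin (suc n)} → Dec (i ≡ j) → Carrier
      δ (yes _) = q
      δ (no _)  = 0#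
      zeros : ∀ {m} (f : Fin m → Carrier) → (∀ j → f j ≈ 0#) → sum f ≈ 0#
      zeros {zero}  f h = refl
      zeros {suc m} f h = trans (+-cong (h zero) (zeros (f ∘ suc) (h ∘ suc))) (+-identityˡ 0#)
      δ-refl : ∀ i → δ (i Fin.≟ i) ≈ q
      δ-refl i with i Fin.≟ i
      ... | yes _ = refl
      ... | no ¬p with ¬p ≡.refl
      ... | ()
      δ-≢ : ∀ i j → i ≢ j → δ (i Fin.≟ j) ≈ 0#
      δ-≢ i j i≢j with i Fin.≟ j
      ... | no _ = refl
      ... | yes p with i≢j p
      ... | ()
      select : ∀ i → sum (λ j → δ (i Fin.≟ j) * powers j) ≈ q * powers i
      select i = trans (sum-remove {i = i} (λ j → δ (i Fin.≟ j) * powers j)) (trans (+-cong (*-congʳ (δ-refl i))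
        (zeros _ (λ j → trans (*-congʳ (δ-≢ i (Fin.punchIn i j) (FinP.punchInᵢ≢i i j ∘ ≡.sym))) (zeroˡ _)))) (+-identityʳ _))
      ev-entry : ∀ {i j : Fin (suc n)} (p : Dec (i ≡ j)) c → ev (entry p c) ≈ δ p + - 1# * ι c
      ev-entry (yes _) c = begin
        ι (ℤ.- c) + q * (ι (+ 1) + q * 0#)   ≈⟨ +-cong (ι-neg c) (*-congˡ (trans (+-cong ι-1 (zeroʳ q)) (+-identityʳ 1#))) ⟩
        - ι c + q * 1#                       ≈⟨ +-cong (-‿cong (sym (*-identityˡ _))) (*-identityʳ q) ⟩
        - (1# * ι c) + q                     ≈⟨ solve 3 (λ o c q → :- (o :* c) :+ q := q :+ :- o :* c) refl 1# (ι c) q ⟩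
        q + - 1# * ι c                       ∎
      ev-entry (no _) c = begin
        ι (ℤ.- c) + q * 0#                   ≈⟨ +-cong (trans (ι-neg c) (-‿cong (sym (*-identityˡ _)))) (zeroʳ q) ⟩
        - (1# * ι c) + 0#                    ≈⟨ solve 3 (λ o c z → :- (o :* c) :+ z := z :+ :- o :* c) refl 1# (ι c) 0# ⟩
        0# + - 1# * ι c                      ∎
      rel : ∀ i → sum (λ j → ev (a i j) * powers j) ≈ 0#
      rel i = begin
        sum (λ j → ev (a i j) * powers j)
          ≈⟨ sum-cong-≋ (λ j → trans (*-congʳ (ev-entry (i Fin.≟ j) (α i j))) (solve 4 (λ d o c p →
              (d :+ o :* c) :* p := d :* p :+ o :* (c :* p)) refl (δ (i Fin.≟ j)) (- 1#) (ι (α i j)) (powers j))) ⟩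
        sum (λ j → δ (i Fin.≟ j) * powers j + - 1# * (ι (α i j) * powers j))
          ≈⟨ ∑-distrib-+ (λ j → δ (i Fin.≟ j) * powers j) (λ j → - 1# * (ι (α i j) * powers j)) ⟩
        sum (λ j → δ (i Fin.≟ j) * powers j) + sum (λ j → - 1# * (ι (α i j) * powers j))
          ≈⟨ +-cong (select i) (sym (*-distribˡ-sum (- 1#) (λ j → ι (α i j) * powers j))) ⟩
        q * powers i + - 1# * sum (λ j → ι (α i j) * powers j)
          ≈⟨ +-cong (sym (*-identityˡ _)) (*-congˡ (sym (α-rel i))) ⟩
        1# * (q * powers i) + - 1# * (q * powers i)
          ≈⟨ solve 2 (λ o x → o :* x :+ :- o :* x := x :- x) refl 1# (q * powers i) ⟩
        q * powers i - q * powers i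
          ≈⟨ -‿inverseʳ _ ⟩
        0# ∎
      finish : (∃ λ d → ∃ λ f → Monic d f × ev f * powers (fromℕ n) ≈ 0#) → ∃ λ d → ∃ λ f → Monic d f × ev f ≈ 0#
      finish (d , f , m , h) = d , f , m , trans (sym (trans (*-congˡ (trans (^-congʳ ζ (cong suc
          (FinP.toℕ-fromℕ n))) ζ^N)) (*-identityʳ _))) h

    integral : ∀ q → ∃ λ t → ∃ λ (c : Vec ℤ t) → q ^ t + sumL (L.allFin t) (λ i → ι (Vec.lookup c i) * q ^ toℕ i) ≈ 0#
    integral q with integral-last (ℕ.pred N) (≡.sym (ℕP.suc-pred N)) q
    ... | d , f , m , h = d , Vec.tabulate (coef f ∘ toℕ) , (begin
      q ^ d + sumL (L.allFin d) (λ i → ι (Vec.lookup (Vec.tabulate (coef f ∘ toℕ)) i) * q ^ toℕ i)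
        ≈⟨ +-congˡ (trans (sum-tabulate d id _) (sum-cong-≋ {d} (λ i → *-congʳ {q ^ toℕ i} (reflexive (cong ι
            (VecP.lookup∘tabulate (coef f ∘ toℕ) i)))))) ⟩
      q ^ d + sum {d} (λ i → ι (coef f (toℕ i)) * q ^ toℕ i)
        ≈⟨ ev-monic q f m ⟨
      Evaluation.ev A q f
        ≈⟨ h ⟩
      0# ∎)

-- Integers inside ℚ.

module RationalAlgebra where

  open ℤAlgebras
  open import Data.Rational as ℚ using (ℚ; mkℚ; ↥_; ↧ₙ_)
  open import Data.Rational.Literals using (fromℤ)
  import Data.Rational.Properties as ℚP
  open import Data.Rational.Unnormalised using (mkℚᵘ; *≡*)
  import Data.Rational.Unnormalised.Properties as ℚᵘP
  open import Data.Bool using (T)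
  open import Relation.Binary.PropositionalEquality using (sym; trans; refl)

  private
    +-cross : ∀ a b → (a ℤ.+ b) ℤ.* + 1 ≡ (a ℤ.* + 1 ℤ.+ b ℤ.* + 1) ℤ.* + 1
    +-cross = solve-∀

  fromℤ-+ : ∀ a b → fromℤ (a ℤ.+ b) ≡ fromℤ a ℚ.+ fromℤ b
  fromℤ-+ a b = ℚP.toℚᵘ-injective (ℚᵘP.≃-trans (*≡* (+-cross a b)) (ℚᵘP.≃-sym (ℚP.toℚᵘ-homo-+ (fromℤ a) (fromℤ b))))

  fromℤ-* : ∀ a b → fromℤ (a ℤ.* b) ≡ fromℤ a ℚ.* fromℤ b
  fromℤ-* a b = ℚP.toℚᵘ-injective (ℚᵘP.≃-trans (*≡* refl) (ℚᵘP.≃-sym (ℚP.toℚᵘ-homo-* (fromℤ a) (fromℤ b))))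

  fromℤ-neg : ∀ a → fromℤ (ℤ.- a) ≡ ℚ.- fromℤ a
  fromℤ-neg a = ℚP.toℚᵘ-injective (ℚᵘP.≃-trans (*≡* refl) (ℚᵘP.≃-sym (ℚP.toℚᵘ-homo‿- (fromℤ a))))

  fromℤ-sub : ∀ a b → fromℤ (a ℤ.- b) ≡ fromℤ a ℚ.- fromℤ b
  fromℤ-sub a b = trans (fromℤ-+ a (ℤ.- b)) (cong (fromℤ a ℚ.+_) (fromℤ-neg b))

  fromℤ-injective : ∀ {a b} → fromℤ a ≡ fromℤ b → a ≡ b
  fromℤ-injective e = cong ↥_ e

  ratAlg : ℤAlgebra
  ratAlg = record
    { commRing = ℚP.+-*-commutativeRing
    ; ι = fromℤ ; ι-+ = fromℤ-+ ; ι-* = fromℤ-* ; ι-neg = fromℤ-neg ; ι-0 = refl ; ι-1 = refl }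

  /1≡fromℤ : ∀ z → z ℚ./ 1 ≡ fromℤ z
  /1≡fromℤ z = ℚP.fromℚᵘ-toℚᵘ (fromℤ z)

  /-* : ∀ m n .{{_ : NonZero n}} → fromℤ (+ n) ℚ.* (m ℚ./ n) ≡ fromℤ m
  /-* m n@(suc n-1) = ℚP.toℚᵘ-injective (ℚᵘP.≃-trans (ℚP.toℚᵘ-homo-* (fromℤ (+ n)) (m ℚ./ n))
    (ℚᵘP.≃-trans (ℚᵘP.*-congˡ {mkℚᵘ (+ n) 0} (ℚP.toℚᵘ-fromℚᵘ (mkℚᵘ m n-1))) (*≡* (cross m (+ n)))))
    where
    cross : ∀ m n → n ℤ.* m ℤ.* + 1 ≡ m ℤ.* (+ 1 ℤ.* n)
    cross = solve-∀

  ↧*q≡↥ : ∀ q → fromℤ (+ ↧ₙ q) ℚ.* q ≡ fromℤ (↥ q)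
  ↧*q≡↥ q@(mkℚ n d-1 c) = trans (cong (fromℤ (+ suc d-1) ℚ.*_) (sym (ℚP.fromℚᵘ-toℚᵘ q))) (/-* n (suc d-1))

  isInt⇒fromℤ : ∀ q → IsInt q → q ≡ fromℤ (↥ q)
  isInt⇒fromℤ q h = trans (sym (ℚP.*-identityˡ q)) (trans (cong (λ d → fromℤ (+ d) ℚ.* q) (sym ↧≡1)) (↧*q≡↥ q))
    where
    ↧≡1 : ↧ₙ q ≡ 1
    ↧≡1 = cong suc (ℕP.≡ᵇ⇒≡ (ℚ.denominator-1 q) 0 (subst T (sym h) _))

  fromℤ⇒isInt : ∀ {q z} → q ≡ fromℤ z → IsInt q
  fromℤ⇒isInt refl = refl

  fromℤ-cancelˡ : ∀ n .{{_ : NonZero n}} x y → fromℤ (+ n) ℚ.* x ≡ fromℤ (+ n) ℚ.* y → x ≡ y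
  fromℤ-cancelˡ n x y e = trans (sym (undo x)) (trans (cong (((+ 1) ℚ./ n) ℚ.*_) e) (undo y))
    where
    undo : ∀ x → ((+ 1) ℚ./ n) ℚ.* (fromℤ (+ n) ℚ.* x) ≡ x
    undo x = trans (sym (ℚP.*-assoc ((+ 1) ℚ./ n) (fromℤ (+ n)) x)) (trans (cong (ℚ._* x) (trans (ℚP.*-comm
        ((+ 1) ℚ./ n) (fromℤ (+ n))) (/-* (+ 1) n))) (ℚP.*-identityˡ x))

-- Degree of functions on subsets and the vanishing signed sums.

module FiniteDifferences where

  open ℤAlgebras
  open IntegralElements using (module ListSum)
  open import Data.Nat using (_∸_; _≤_)
  open import Data.Vec using ([]; _∷_)

  module Degree (S : ℤAlgebra) where
    open ℤAlgebra S hiding (zero)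
    open IntSolver S
    open SR setoid

    Δ : ∀ {k} → (Subset (suc k) → Carrier) → Subset k → Carrier
    Δ f I = f (true ∷ I) - f (false ∷ I)

    -- f agrees on {0,1}^k with a polynomial of degree < D.
    DegLt : ∀ {k} → ℕ → (Subset k → Carrier) → Set
    DegLt {zero}  D f = D ≡ 0 → f [] ≈ 0#
    DegLt {suc k} D f = DegLt D (f ∘ (false ∷_)) × DegLt (D ∸ 1) (Δ f)

    DegLt-cong : ∀ {k D} {f g : Subset k → Carrier} → (∀ I → f I ≈ g I) → DegLt D f → DegLt D g
    DegLt-cong {zero}  e h D≡0 = trans (sym (e [])) (h D≡0)
    DegLt-cong {suc k} e (h , d) = DegLt-cong (λ I → e (false ∷ I)) h , DegLt-cong (λ I → +-cong (e (true ∷ I)) (-‿cong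
        (e (false ∷ I)))) d

    DegLt-mono : ∀ {k D E} {f : Subset k → Carrier} → D ≤ E → DegLt D f → DegLt E f
    DegLt-mono {zero}  D≤E h ≡.refl = h (ℕP.n≤0⇒n≡0 D≤E)
    DegLt-mono {suc k} D≤E (h , d) = DegLt-mono D≤E h , DegLt-mono (ℕP.∸-monoˡ-≤ 1 D≤E) d

    DegLt-0⇒≈0 : ∀ {k} {f : Subset k → Carrier} → DegLt 0 f → ∀ I → f I ≈ 0#
    DegLt-0⇒≈0 h [] = h ≡.refl
    DegLt-0⇒≈0 (h , d) (false ∷ I) = DegLt-0⇒≈0 h I
    DegLt-0⇒≈0 {f = f} (h , d) (true ∷ I) = begin
      f (true ∷ I)                   ≈⟨ solve 2 (λ a b → a := (a :- b) :+ b) refl (f (true ∷ I)) (f (false ∷ I)) ⟩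
      Δ f I + f (false ∷ I)          ≈⟨ +-cong (DegLt-0⇒≈0 d I) (DegLt-0⇒≈0 h I) ⟩
      0# + 0#                        ≈⟨ +-identityˡ 0# ⟩
      0#                             ∎

    DegLt-zero : ∀ {k D} → DegLt {k} D (λ _ → 0#)
    DegLt-zero {zero}  _ = refl
    DegLt-zero {suc k} = DegLt-zero {k} , DegLt-cong (λ _ → sym (-‿inverseʳ 0#)) (DegLt-zero {k})

    DegLt-≈0 : ∀ {k D} {f : Subset k → Carrier} → (∀ I → f I ≈ 0#) → DegLt D f
    DegLt-≈0 {k} h = DegLt-cong (λ I → sym (h I)) (DegLt-zero {k})

    DegLt-+ : ∀ {k D} {f g : Subset k → Carrier} → DegLt D f → DegLt D g → DegLt D (λ I → f I + g I)
    DegLt-+ {zero}  h h′ e = trans (+-cong (h e) (h′ e)) (+-identityˡ 0#)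
    DegLt-+ {suc k} {f = f} {g} (h , d) (h′ , d′) = DegLt-+ h h′ ,
      DegLt-cong (λ I → solve 4 (λ a b c d → (a :- b) :+ (c :- d) := (a :+ c) :- (b :+ d)) refl (f (true ∷ I)) (f
          (false ∷ I)) (g (true ∷ I)) (g (false ∷ I))) (DegLt-+ d d′)

    DegLt-const : ∀ {k} c → DegLt {k} 1 (λ _ → c)
    DegLt-const {zero}  c ()
    DegLt-const {suc k} c = DegLt-const {k} c , DegLt-≈0 (λ _ → -‿inverseʳ c)

    -- Leibniz rule: Δ(fg) = f(0)·Δg + Δf·g(1), with g(1) = g(0) + Δg. Strict bounds D and E combine
    -- to D + E - 1; the truncated subtraction is harmless, since a bound of 0 makes the product
    -- vanish.
    DegLt-* : ∀ {k} D E {f g : Subset k → Carrier} → DegLt D f → DegLt E g → DegLt (D ℕ.+ E ∸ 1) (λ I → f I * g I)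
    DegLt-* zero    E       h h′ = DegLt-≈0 λ I → trans (*-congʳ (DegLt-0⇒≈0 h I)) (zeroˡ _)
    DegLt-* (suc D) zero    h h′ = DegLt-≈0 λ I → trans (*-congˡ (DegLt-0⇒≈0 h′ I)) (zeroʳ _)
    DegLt-* {zero}  (suc D) (suc E) h h′ e with ≡.trans (≡.sym (ℕP.+-suc D E)) e
    ... | ()
    DegLt-* {suc k} (suc D) (suc E) {f} {g} (h , d) (h′ , d′) = DegLt-* (suc D) (suc E) h h′ ,
      DegLt-cong (λ I → solve 4 (λ a b c d → (b :* (c :- d)) :+ (a :- b) :* (d :+ (c :- d)) := a :* c :- b :* d) refl (f
          (true ∷ I)) (f (false ∷ I)) (g (true ∷ I)) (g (false ∷ I)))
        (DegLt-+ (subst (λ n → DegLt n (λ I → f (false ∷ I) * Δ g I)) (≡.sym (cong (_∸ 1) (ℕP.+-suc D E))) (DegLt-*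
            (suc D) E h d′))
          (DegLt-* D (suc E) d (DegLt-+ h′ (DegLt-mono (ℕP.n≤1+n E) d′))))

    -- "degree ≤ D" is DegLt (suc D).
    DegLe-* : ∀ {k} D E {f g : Subset k → Carrier} → DegLt (suc D) f → DegLt (suc E) g → DegLt (suc (D ℕ.+ E)) (λ I → f I * g I)
    DegLe-* D E {f} {g} h h′ = subst (λ n → DegLt n (λ I → f I * g I)) (ℕP.+-suc D E) (DegLt-* (suc D) (suc E) h h′)

  -- Degrees are measured in S, which will be ℚ because P has rational coefficients, while the sums
  -- live in A, which will be ℤ[ζ]. Integer-valued functions connect the two, and injectivity of ℤ →
  -- S carries a vanishing value back to ℤ and on to A.
  module Vanishing (S A : ℤAlgebra) (ι-injective : ∀ z → ℤAlgebra._≈_ S (ℤAlgebra.ι S z) (ℤAlgebra.0# S) → z ≡ + 0) where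
    private module S = ℤAlgebra S
    open Degree S
    open ℤAlgebra A hiding (zero)
    open IntSolver A
    open ListSum A
    open SR setoid

    prodS : ∀ {k} → (Fin k → Carrier) → Subset k → Carrier
    prodS z []          = 1#
    prodS z (false ∷ I) = prodS (z ∘ suc) I
    prodS z (true ∷ I)  = z zero * prodS (z ∘ suc) I

    -- For constant g = 1 this is the expansion of ∏(1 - z_s); the function g plays the part of a
    -- polynomial weight.
    signedSum : ∀ {k} → (Subset k → ℤ) → (Fin k → Carrier) → Carrier
    signedSum {k} g z = sumL (allSubsets k) (λ I → ι (neg1pow (card I)) * (ι (g I) * prodS z I))

    signedSum-split : ∀ {k} (g : Subset (suc k) → ℤ) z →
      signedSum g z ≈ signedSum (g ∘ (false ∷_)) (z ∘ suc) + - z zero * signedSum (g ∘ (true ∷_)) (z ∘ suc)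
    signedSum-split {k} g z = trans (sumL-++ (L.map (false ∷_) (allSubsets k)) _ _)
      (+-cong (sumL-map (false ∷_) (allSubsets k) _)
        (trans (sumL-map (true ∷_) (allSubsets k) _) (trans (sumL-cong (allSubsets k) (λ I → trans (*-congʳ (ι-neg
            (neg1pow (card I))))
          (solve 4 (λ s g z p → :- s :* (g :* (z :* p)) := :- z :* (s :* (g :* p))) refl (ι (neg1pow (card I))) (ι (g
              (true ∷ I))) (z zero) (prodS (z ∘ suc) I))))
          (sym (sumL-* (- z zero) (allSubsets k) _)))))

    signedSum-- : ∀ {k} (g h : Subset k → ℤ) z → signedSum (λ I → g I ℤ.- h I) z ≈ signedSum g z - signedSum h z
    signedSum-- {k} g h z = begin
      signedSum (λ I → g I ℤ.- h I) z
        ≈⟨ sumL-cong (allSubsets k) (λ I → trans (*-congˡ (*-congʳ (trans (ι-+ (g I) (ℤ.- h I)) (+-congˡ (ι-neg (h I))))))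
            (trans (solve 4 (λ s a b p → s :* ((a :- b) :* p) := s :* (a :* p) :+ :- (s :* (b :* p))) refl (ι (neg1pow
                (card I))) (ι (g I)) (ι (h I)) (prodS z I))
              (+-congˡ (-‿cong (sym (*-identityˡ _)))))) ⟩
      sumL (allSubsets k) (λ I → G I + - (1# * H I))
        ≈⟨ sumL-+ (allSubsets k) G _ ⟨
      sumL (allSubsets k) G + sumL (allSubsets k) (λ I → - (1# * H I))
        ≈⟨ +-congˡ (trans (sumL-cong (allSubsets k) (λ I → solve 2 (λ o x → :- (o :* x) := :- o :* x) refl 1# (H I)))
            (sym (sumL-* (- 1#) (allSubsets k) H))) ⟩
      sumL (allSubsets k) G + - 1# * sumL (allSubsets k) H
        ≈⟨ +-congˡ (trans (solve 2 (λ o x → :- o :* x := :- (o :* x)) refl 1# (sumL (allSubsets k) H)) (-‿cong (*-identityˡ _))) ⟩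
      sumL (allSubsets k) G - sumL (allSubsets k) H ∎
      where
      G H : Subset k → Carrier
      G I = ι (neg1pow (card I)) * (ι (g I) * prodS z I)
      H I = ι (neg1pow (card I)) * (ι (h I) * prodS z I)

    -- Splitting off the first index gives Σ₀ - z₀Σ₁. If z₀ is marked as 1, this is a single signed
    -- sum for -Δg, and both D and the number of marks drop by one. If it is not marked, both slices
    -- of g keep the bound D and the number of marks is unchanged. With no index left D is 0, so g
    -- is 0.
    vanishing : ∀ {k} D (g : Subset k → ℤ) z (t : Fin k → Bool) → (∀ s → t s ≡ true → z s ≈ 1#) →
      DegLt D (λ I → S.ι (g I)) → D ≤ sumℕ (λ s → if t s then 1 else 0) → signedSum g z ≈ 0#
    vanishing {zero}  D g z t t⇒1 h D≤ = trans (+-identityʳ _) (trans (*-congˡ (trans (*-congʳ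
       (trans (ι-cong (ι-injective (g []) (h (ℕP.n≤0⇒n≡0 D≤)))) ι-0)) (zeroˡ _))) (zeroʳ _))
    vanishing {suc k} D g z t t⇒1 (h , d) D≤ with t zero in eq
    ... | true = begin
      signedSum g z                            ≈⟨ signedSum-split g z ⟩
      Σ₀ + - z zero * Σ₁                       ≈⟨ +-congˡ (*-congʳ (-‿cong (t⇒1 zero eq))) ⟩
      Σ₀ + - 1# * Σ₁                           ≈⟨ +-congˡ (trans (solve 2 (λ o x → :- o :* x := :- (o :* x)) refl 1# Σ₁)
          (-‿cong (*-identityˡ Σ₁))) ⟩
      Σ₀ - Σ₁                                  ≈⟨ signedSum-- (g ∘ (false ∷_)) (g ∘ (true ∷_)) (z ∘ suc) ⟨
      signedSum (λ I → g (false ∷ I) ℤ.- g (true ∷ I)) (z ∘ suc)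
        ≈⟨ vanishing (D ∸ 1) _ (z ∘ suc) (t ∘ suc) (λ s → t⇒1 (suc s)) (DegLt-cong neg-Δ (DegLt-neg d)) (ℕP.≤-trans
            (ℕP.∸-monoˡ-≤ 1 D≤) ℕP.≤-refl) ⟩
      0# ∎
      where
      Σ₀ = signedSum (g ∘ (false ∷_)) (z ∘ suc)
      Σ₁ = signedSum (g ∘ (true ∷_)) (z ∘ suc)
      DegLt-neg : ∀ {D} {f : Subset k → S.Carrier} → DegLt D f → DegLt D (λ I → S.ι (ℤ.- (+ 1)) S.* f I)
      DegLt-neg {D} h = DegLt-* 1 D (DegLt-const (S.ι (ℤ.- (+ 1)))) h
      neg-Δ : ∀ I → S.ι (ℤ.- (+ 1)) S.* Δ (S.ι ∘ g) I S.≈ S.ι (g (false ∷ I) ℤ.- g (true ∷ I))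
      neg-Δ I = S.trans (S.*-cong (S.trans (S.ι-neg (+ 1)) (S.-‿cong S.ι-1)) (S.refl {Δ (S.ι ∘ g) I}))
        (S.trans (SS.solve 3 (λ o a b → SS.:- o SS.:* (a SS.:- b) SS.:= o SS.:* (b SS.:- a)) S.refl S.1# (S.ι (g
            (true ∷ I))) (S.ι (g (false ∷ I))))
        (S.trans (S.*-identityˡ _) (S.sym (S.trans (S.ι-+ (g (false ∷ I)) (ℤ.- g (true ∷ I))) (S.+-congˡ (S.ι-neg (g
            (true ∷ I))))))))
        where module SS = IntSolver S
    ... | false = begin
      signedSum g z                            ≈⟨ signedSum-split g z ⟩
      Σ₀ + - z zero * Σ₁                       ≈⟨ +-cong Σ₀≈0 (*-congˡ Σ₁≈0) ⟩
      0# + - z zero * 0#                       ≈⟨ trans (+-identityˡ _) (zeroʳ _) ⟩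
      0#                                       ∎
      where
      Σ₀ = signedSum (g ∘ (false ∷_)) (z ∘ suc)
      Σ₁ = signedSum (g ∘ (true ∷_)) (z ∘ suc)
      Σ₀≈0 : Σ₀ ≈ 0#
      Σ₀≈0 = vanishing D _ (z ∘ suc) (t ∘ suc) (λ s → t⇒1 (suc s)) h D≤
      Σ₁≈0 : Σ₁ ≈ 0#
      Σ₁≈0 = vanishing D _ (z ∘ suc) (t ∘ suc) (λ s → t⇒1 (suc s))
        (DegLt-cong (λ I → SS.solve 2 (λ a b → a SS.:+ (b SS.:- a) SS.:= b) S.refl (S.ι (g (false ∷ I))) (S.ι (g
            (true ∷ I)))) (DegLt-+ h (DegLt-mono (ℕP.m∸n≤m D 1) d))) D≤
        where module SS = IntSolver S

-- Binomial coefficients with integer upper argument, modulo p.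

module IntegerBinomials where

  open import Defs using (neg1pow)
  open MöbiusDivisors using (module PrimePower)
  open import Data.Nat using (_!)
  open import Data.Nat.Coprimality using (Coprime; coprime-divisor)
  open import Data.Nat.Primality using (Prime)
  open import Data.Integer using (-[1+_]; _+_; _*_; _-_; -_; ∣_∣)
  open import Data.Integer.Divisibility.Signed using (_∣_; divides; _∣?_; ∣⇒∣ᵤ; ∣ᵤ⇒∣; ∣m∣n⇒∣m-n)
  open import Relation.Binary.PropositionalEquality using (sym; trans; refl)
  open ≡.≡-Reasoning

  -- The row n ↦ C(x, n). The absorption identity determines it, and rows are built by stepping x up
  -- or down from 0 with Pascal's rule; negative x does occur, as the arguments are shifted by -1.
  record Binomials (x : ℤ) : Set where
    field
      C        : ℕ → ℤ
      C-zero   : C 0 ≡ + 1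
      C-absorb : ∀ n → + suc n * C (suc n) ≡ (x - + n) * C n

  binomials-0 : Binomials (+ 0)
  binomials-0 = record
    { C = λ { zero → + 1 ; (suc _) → + 0 } ; C-zero = refl
    ; C-absorb = λ { zero → refl ; (suc n) → trans (ℤP.*-zeroʳ (+ suc (suc n))) (sym (ℤP.*-zeroʳ (+ 0 - + suc n))) } }

  module _ {x : ℤ} (B : Binomials x) where
    open Binomials B

    private
      absorb′ : ∀ n → (+ 1 + + n) * C (suc n) ≡ (x - + n) * C n
      absorb′ = C-absorb

    -- The sum in parentheses is C(x + 1, n + 1), so this is (n + 1)·C(x + 1, n + 1) = (x + 1)·C(x,
    -- n), from which both divisibility results below are read off.
    Pascal-absorb : ∀ n → (+ 1 + + n) * (C n + C (suc n)) ≡ (x + + 1) * C n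
    Pascal-absorb n = begin
      (+ 1 + + n) * (C n + C (suc n))                 ≡⟨ ℤP.*-distribˡ-+ (+ 1 + + n) (C n) (C (suc n)) ⟩
      (+ 1 + + n) * C n + (+ 1 + + n) * C (suc n)     ≡⟨ cong (λ z → (+ 1 + + n) * C n + z) (absorb′ n) ⟩
      (+ 1 + + n) * C n + (x - + n) * C n             ≡⟨ collect (+ n) (C n) x ⟩
      (x + + 1) * C n                                 ∎
      where
      collect : ∀ n c x → (+ 1 + n) * c + (x - n) * c ≡ (x + + 1) * c
      collect = solve-∀

    binomials-up : Binomials (x + + 1)
    binomials-up = record { C = C′ ; C-zero = refl ; C-absorb = absorb }
      where
      C′ : ℕ → ℤ
      C′ zero    = + 1
      C′ (suc n) = C n + C (suc n)
      collect : ∀ n a b x → (+ 1 + (+ 1 + n)) * (a + b) ≡ (+ 1 + n) * a + a + (+ 1 + (+ 1 + n)) * b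
      collect = solve-∀
      absorb : ∀ n → + suc n * C′ (suc n) ≡ (x + + 1 - + n) * C′ n
      absorb zero = trans (Pascal-absorb 0) (trans (cong ((x + + 1) *_) C-zero) (cong (_* + 1) (sym (ℤP.+-identityʳ (x + + 1)))))
      absorb (suc n) = begin
        + suc (suc n) * (C (suc n) + C (suc (suc n)))   ≡⟨ Pascal-absorb (suc n) ⟩
        (x + + 1) * C (suc n)                           ≡⟨ split x (+ n) (C (suc n)) ⟩
        (+ 1 + + n) * C (suc n) + (x - + n) * C (suc n) ≡⟨ cong (_+ (x - + n) * C (suc n)) (absorb′ n) ⟩
        (x - + n) * C n + (x - + n) * C (suc n)         ≡⟨ ℤP.*-distribˡ-+ (x - + n) (C n) (C (suc n)) ⟨
        (x - + n) * (C n + C (suc n))                   ≡⟨ cong (_* (C n + C (suc n))) (shift x (+ n)) ⟩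
        (x + + 1 - (+ 1 + + n)) * (C n + C (suc n))     ∎
        where
        split : ∀ x n c → (x + + 1) * c ≡ (+ 1 + n) * c + (x - n) * c
        split = solve-∀
        shift : ∀ x n → x - n ≡ x + + 1 - (+ 1 + n)
        shift = solve-∀

    binomials-down : Binomials (x - + 1)
    binomials-down = record { C = C′ ; C-zero = refl ; C-absorb = absorb }
      where
      C′ : ℕ → ℤ
      C′ zero    = + 1
      -- Pascal's rule C(x, n + 1) = C(x - 1, n) + C(x - 1, n + 1), solved for its last term.
      C′ (suc n) = C (suc n) - C′ n
      absorb : ∀ n → + suc n * C′ (suc n) ≡ (x - + 1 - + n) * C′ n
      absorb zero = trans (base (C 1)) (trans (cong (_- + 1) (trans (absorb′ 0) (cong ((x - + 0) *_) C-zero))) (end x))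
        where
        base : ∀ c → + 1 * (c - + 1) ≡ (+ 1 + + 0) * c - + 1
        base = solve-∀
        end : ∀ x → (x - + 0) * + 1 - + 1 ≡ (x - + 1 - + 0) * + 1
        end = solve-∀
      absorb (suc n) = begin
        (+ 1 + (+ 1 + + n)) * (C (suc (suc n)) - C′ (suc n))
          ≡⟨ ℤP.*-distribˡ-+ (+ 1 + (+ 1 + + n)) (C (suc (suc n))) (- C′ (suc n)) ⟩
        (+ 1 + (+ 1 + + n)) * C (suc (suc n)) + (+ 1 + (+ 1 + + n)) * - C′ (suc n)
          ≡⟨ cong (_+ (+ 1 + (+ 1 + + n)) * - C′ (suc n)) (absorb′ (suc n)) ⟩
        (x - (+ 1 + + n)) * C (suc n) + (+ 1 + (+ 1 + + n)) * - (C (suc n) - C′ n)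
          ≡⟨ rearrange x (+ n) (C (suc n)) (C′ n) ⟩
        (x - + 1 - (+ 1 + + n)) * (C (suc n) - C′ n) + ((x - + 1 - + n) * C′ n - (+ 1 + + n) * (C (suc n) - C′ n))
          ≡⟨ cong (λ z → (x - + 1 - (+ 1 + + n)) * (C (suc n) - C′ n) + (z - (+ 1 + + n) * (C (suc n) - C′ n))) (absorb n) ⟨
        (x - + 1 - (+ 1 + + n)) * (C (suc n) - C′ n) + ((+ 1 + + n) * (C (suc n) - C′ n) - (+ 1 + + n) * (C (suc n) - C′ n))
          ≡⟨ cancel ((x - + 1 - (+ 1 + + n)) * (C (suc n) - C′ n)) ((+ 1 + + n) * (C (suc n) - C′ n)) ⟩
        (x - + 1 - (+ 1 + + n)) * (C (suc n) - C′ n) ∎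
        where
        rearrange : ∀ x n c d → (x - (+ 1 + n)) * c + (+ 1 + (+ 1 + n)) * - (c - d) ≡
                                (x - + 1 - (+ 1 + n)) * (c - d) + ((x - + 1 - n) * d - (+ 1 + n) * (c - d))
        rearrange = solve-∀
        cancel : ∀ a b → a + (b - b) ≡ a
        cancel = solve-∀

  binomials : ∀ x → Binomials x
  binomials (+ zero)      = binomials-0
  binomials (+ suc n)     = subst Binomials (trans (ℤP.+-comm (+ n) (+ 1)) refl) (binomials-up (binomials (+ n)))
  binomials -[1+ zero ]   = binomials-down binomials-0
  binomials -[1+ suc n ]  = subst Binomials (cong -[1+_] (cong suc (ℕP.+-identityʳ n))) (binomials-down (binomials -[1+ n ]))

  binomial : ℤ → ℕ → ℤ
  binomial x = Binomials.C (binomials x)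

  falling : ℤ → ℕ → ℤ
  falling x zero    = + 1
  falling x (suc n) = falling x n * (x - + n)

  falling≡!*binomial : ∀ x n → falling x n ≡ + (n !) * binomial x n
  falling≡!*binomial x zero    = sym (trans (ℤP.*-identityˡ _) (Binomials.C-zero (binomials x)))
  falling≡!*binomial x (suc n) = begin
    falling x n * (x - + n)                       ≡⟨ cong (_* (x - + n)) (falling≡!*binomial x n) ⟩
    + (n !) * binomial x n * (x - + n)            ≡⟨ trans (ℤP.*-assoc (+ (n !)) _ _) (cong (+ (n !) *_) (ℤP.*-comm
        (binomial x n) _)) ⟩
    + (n !) * ((x - + n) * binomial x n)          ≡⟨ cong (+ (n !) *_) (Binomials.C-absorb (binomials x) n) ⟨
    + (n !) * (+ suc n * binomial x (suc n))      ≡⟨ trans (sym (ℤP.*-assoc (+ (n !)) (+ suc n) _)) (cong (_* binomial x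
        (suc n)) (trans (ℤP.*-comm (+ (n !)) (+ suc n)) (sym (ℤP.pos-* (suc n) (n !))))) ⟩
    + (suc n !) * binomial x (suc n)              ∎

  module PrimePowerBinomial {p : ℕ} (pp : Prime p) {q e : ℕ} (q∣p^e : q ℕD.∣ p ℕ.^ e) where

    private
      euclid : ∀ y z → ¬ + p ∣ z → + q ∣ y * z → + q ∣ y
      euclid y z p∤z d = ∣ᵤ⇒∣ (coprime-divisor cop (subst (q ℕD.∣_) (trans (ℤP.abs-* y z) (ℕP.*-comm ∣ y ∣ ∣ z ∣)) (∣⇒∣ᵤ d)))
        where
        cop : Coprime q ∣ z ∣
        cop (a , b) = PrimePower.coprime-pow p pp e (λ p∣ → p∤z (∣ᵤ⇒∣ p∣)) (b , ℕD.∣-trans a q∣p^e)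

    -- Here n = q - 1 and (x + 1)·C(x, q - 1) = q·C(x + 1, q). If p did not divide C(x, q - 1), that
    -- factor would be prime to q and q would divide x + 1.
    binomial-nondivisor : ∀ x n → q ≡ suc n → ¬ + q ∣ x + + 1 → + p ∣ binomial x n
    binomial-nondivisor x n q≡ q∤ with + p ∣? binomial x n
    ... | yes d = d
    ... | no ¬d = ⊥-elim (q∤ (euclid (x + + 1) (binomial x n) ¬d (divides (C n + C (suc n))
        (trans (sym (Pascal-absorb (binomials x) n)) (trans (ℤP.*-comm (+ suc n) (C n + C (suc n))) (cong (λ k →
            (C n + C (suc n)) * + k) (sym q≡)))))))
      where
      open Binomials (binomials x)

    -- For j + 1 < q, q divides (x + 1)·C(x, j) = (j + 1)·C(x + 1, j + 1) but not j + 1, so p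
    -- divides C(x + 1, j + 1) = C(x, j) + C(x, j + 1): consecutive entries of the row are opposite
    -- modulo p, starting from 1.
    binomial-divisor : ∀ x → + q ∣ x + + 1 → ∀ j → j ℕ.< q → + p ∣ binomial x j - neg1pow j
    binomial-divisor x q∣ zero    j<q = divides (+ 0) (cong (_- + 1) (Binomials.C-zero (binomials x)))
    binomial-divisor x q∣ (suc j) j<q = subst (+ p ∣_) (regroup (C (suc j)) (C j) (neg1pow j))
        (∣m∣n⇒∣m-n p∣sum (binomial-divisor x q∣ j (ℕP.<-trans (ℕP.n<1+n j) j<q)))
      where
      open Binomials (binomials x)
      regroup : ∀ a b s → (b + a) - (b - s) ≡ a - (- s)
      regroup = solve-∀
      p∣sum : + p ∣ C j + C (suc j)
      p∣sum with + p ∣? C j + C (suc j)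
      ... | yes d = d
      ... | no ¬d = ⊥-elim (ℕP.<⇒≱ j<q (ℕD.∣⇒≤ (∣⇒∣ᵤ (euclid (+ suc j) (C j + C (suc j)) ¬d
              (subst (+ q ∣_) (sym (Pascal-absorb (binomials x) j)) (divides-* q∣))))))
        where
        divides-* : ∀ {y} → + q ∣ y → + q ∣ y * C j
        divides-* {y} (divides r e) = divides (r * C j) (trans (cong (_* C j) e) (trans (ℤP.*-assoc r (+ q) (C j))
            (trans (cong (r *_) (ℤP.*-comm (+ q) (C j))) (sym (ℤP.*-assoc r (C j) (+ q))))))

-- Integer powers of ζ and averaging over residues modulo N.

module RootFiltering where

  open ℤAlgebras
  open PolynomialEvaluation
  open GeometricSums
  open RootsOfUnity
  open IntegralElements
  open FiniteDifferences
  import Data.Integer.DivMod as ℤDM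
  open import Data.Integer.Divisibility.Signed using (_∣_; divides; ∣⇒∣ᵤ; ∣ᵤ⇒∣; ∣m∣n⇒∣m+n; ∣m∣n⇒∣m-n)
  open import Data.Vec using ([]; _∷_; lookup)

  module IntegerPowers {N : ℕ} .{{_ : NonZero N}} (R : RootRing N) where
    open RootRing R
    open ℤAlgebra A hiding (zero)
    open IntSolver A
    open Geometric A using (_^_; geo; ^-congʳ; ^-homo-*)
    open Integrality R using (ζ^-period)
    open ListSum A
    open SR setoid

    private
      ζ-≤ : ∀ a b → a ℕ.≤ b → + N ∣ + b ℤ.- + a → ζ ^ a ≈ ζ ^ b
      ζ-≤ a b a≤b d with ∣⇒∣ᵤ (subst (+ N ∣_) (≡.trans (ℤP.m-n≡m⊖n b a) (ℤP.⊖-≥ a≤b)) d)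
      ... | ℕD.divides t eq = trans (sym (ζ^-period t a)) (^-congʳ ζ (≡.trans (cong (a ℕ.+_) (≡.sym eq)) (ℕP.m+[n∸m]≡n a≤b)))

      flip : ∀ a b → b ℤ.- a ≡ + 0 ℤ.- (a ℤ.- b)
      flip = solve-∀

    ∣-flip : ∀ {n} a b → n ∣ a ℤ.- b → n ∣ b ℤ.- a
    ∣-flip {n} a b d = subst (n ∣_) (≡.sym (flip a b)) (∣m∣n⇒∣m-n (divides (+ 0) ≡.refl) d)

    ζ-mod : ∀ a b → + N ∣ + b ℤ.- + a → ζ ^ a ≈ ζ ^ b
    ζ-mod a b d with ℕP.≤-total a b
    ... | inj₁ a≤b = ζ-≤ a b a≤b d
    ... | inj₂ b≤a = sym (ζ-≤ b a b≤a (∣-flip (+ b) (+ a) d))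

    -- Reduces the exponent by the same `resid` as `rootSum`, so that monomials of `rootSum`
    -- evaluate to these powers directly.
    ζℤ : ℤ → Carrier
    ζℤ e = ζ ^ resid e N

    resid-∣ : ∀ e → + N ∣ e ℤ.- + resid e N
    resid-∣ e = go N ≡.refl
      where
      go : ∀ n .{{_ : NonZero n}} → n ≡ N → + n ∣ e ℤ.- + resid e n
      go (suc n) _ = divides (e ℤDM./ℕ suc n) (≡.trans (cong (ℤ._- + resid e (suc n)) (ℤDM.a≡a%ℕn+[a/ℕn]*n e (suc n)))
          (drop (+ (e ℤDM.%ℕ suc n)) (e ℤDM./ℕ suc n ℤ.* + suc n)))
        where
        drop : ∀ a b → (a ℤ.+ b) ℤ.- a ≡ b
        drop = solve-∀

    ζℤ-nat : ∀ e k → + N ∣ e ℤ.- + k → ζℤ e ≈ ζ ^ k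
    ζℤ-nat e k d = ζ-mod (resid e N) k (subst (+ N ∣_) (telescope e (+ k) (+ resid e N)) (∣m∣n⇒∣m-n (resid-∣ e) d))
      where
      telescope : ∀ e k r → (e ℤ.- r) ℤ.- (e ℤ.- k) ≡ k ℤ.- r
      telescope = solve-∀

    ζℤ-+ : ∀ e f → ζℤ (e ℤ.+ f) ≈ ζℤ e * ζℤ f
    ζℤ-+ e f = trans (ζℤ-nat (e ℤ.+ f) (resid e N ℕ.+ resid f N)
        (subst (+ N ∣_) (regroup e f (+ resid e N) (+ resid f N)) (∣m∣n⇒∣m+n (resid-∣ e) (resid-∣ f)))) (^-homo-* ζ
            (resid e N) (resid f N))
      where
      regroup : ∀ e f r s → (e ℤ.- r) ℤ.+ (f ℤ.- s) ≡ (e ℤ.+ f) ℤ.- (r ℤ.+ s)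
      regroup = solve-∀

    ζℤ-∣ : ∀ e → + N ∣ e → ζℤ e ≈ 1#
    ζℤ-∣ e d = ζℤ-nat e 0 (subst (+ N ∣_) (≡.sym (ℤP.+-identityʳ e)) d)

    ζℤ-0 : ζℤ (+ 0) ≈ 1#
    ζℤ-0 = ζℤ-∣ (+ 0) (divides (+ 0) ≡.refl)

    ζℤ-*ℕ : ∀ e k → ζℤ (e ℤ.* + k) ≈ ζℤ e ^ k
    ζℤ-*ℕ e zero    = trans (reflexive (cong ζℤ (ℤP.*-zeroʳ e))) ζℤ-0
    ζℤ-*ℕ e (suc k) = trans (reflexive (cong ζℤ (dist e (+ k)))) (trans (ζℤ-+ e (e ℤ.* + k)) (*-congˡ (ζℤ-*ℕ e k)))
      where
      dist : ∀ e k → e ℤ.* (+ 1 ℤ.+ k) ≡ e ℤ.+ e ℤ.* k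
      dist = solve-∀

    ζℤ-unit : ∀ e → ζℤ e * ζℤ (ℤ.- e) ≈ 1#
    ζℤ-unit e = trans (sym (ζℤ-+ e (ℤ.- e))) (trans (reflexive (cong ζℤ (ℤP.+-inverseʳ e))) ζℤ-0)

    geo-one : ∀ n y → y ≈ 1# → geo n y ≈ ι (+ n)
    geo-one zero    y h = sym ι-0
    geo-one (suc n) y h = sym (trans (ι-+ (+ 1) (+ n)) (+-cong ι-1 (sym (trans (*-cong h (geo-one n y h)) (*-identityˡ _)))))

    geo-∣ : ∀ e → + N ∣ e → geo N (ζℤ e) ≈ ι (+ N)
    geo-∣ e d = geo-one N (ζℤ e) (ζℤ-∣ e d)

    geo-∤ : ∀ e → ¬ + N ∣ e → geo N (ζℤ e) ≈ 0#
    geo-∤ e ∤ = root-sum (resid e N) λ N∣r → ∤ (subst (+ N ∣_) (back e (+ resid e N)) (∣m∣n⇒∣m+n (resid-∣ e) (∣ᵤ⇒∣ N∣r)))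
      where
      back : ∀ e r → (e ℤ.- r) ℤ.+ r ≡ e
      back = solve-∀

    sumL-geo : ∀ n f u y (h : ℕ → Carrier) → (∀ i → h (f i) ≈ u * y ^ i) → sumL (L.applyUpTo f n) h ≈ u * geo n y
    sumL-geo zero    f u y h e = sym (zeroʳ u)
    sumL-geo (suc n) f u y h e = trans (+-cong (e 0) (sumL-geo n (f ∘ suc) (u * y) y h (λ i → trans (e (suc i)) (sym
        (*-assoc u y _)))))
      (solve 4 (λ u o y g → u :* o :+ u :* y :* g := u :* (o :+ y :* g)) refl u 1# y (geo n y))

    weightSum : ∀ {k} → (Fin k → ℤ) → Subset k → ℤ
    weightSum v I = sumℤ (λ s → if lookup I s then v s else + 0)

  module Filter {N : ℕ} .{{_ : NonZero N}} (R : RootRing N) (S : ℤAlgebra)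
    (ι-injective : ∀ z → ℤAlgebra._≈_ S (ℤAlgebra.ι S z) (ℤAlgebra.0# S) → z ≡ + 0) where
    open RootRing R
    open ℤAlgebra A hiding (zero)
    open IntSolver A
    open Geometric A using (_^_; geo; ^-congʳ; ^-homo-*)
    open IntegerPowers R
    open Degree S using (DegLt)
    open Vanishing S A ι-injective
    open ListSum A
    open SR setoid

    prodS-ζℤ : ∀ {k} (v : Fin k → ℤ) I → prodS (ζℤ ∘ v) I ≈ ζℤ (weightSum v I)
    prodS-ζℤ v []          = sym ζℤ-0
    prodS-ζℤ v (false ∷ I) = trans (prodS-ζℤ (v ∘ suc) I) (reflexive (cong ζℤ (≡.sym (ℤP.+-identityˡ (weightSum (v ∘ suc) I)))))
    prodS-ζℤ v (true ∷ I)  = trans (*-congˡ (prodS-ζℤ (v ∘ suc) I)) (sym (ζℤ-+ (v zero) _))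

    weightSum-affine : ∀ {k} (b c : Fin k → ℤ) x I → weightSum (λ s → b s ℤ.- x ℤ.* c s) I ≡ weightSum b I ℤ.- x ℤ.* weightSum c I
    weightSum-affine b c x []          = base x
      where
      base : ∀ x → + 0 ≡ + 0 ℤ.- x ℤ.* + 0
      base = solve-∀
    weightSum-affine b c x (false ∷ I) = ≡.trans (ℤP.+-identityˡ _) (≡.trans (weightSum-affine (b ∘ suc) (c ∘ suc) x I)
      (cong₂ (λ u v → u ℤ.- x ℤ.* v) (≡.sym (ℤP.+-identityˡ (weightSum (b ∘ suc) I))) (≡.sym (ℤP.+-identityˡ (weightSum
          (c ∘ suc) I)))))
    weightSum-affine b c x (true ∷ I)  = ≡.trans (cong (ℤ._+_ (b zero ℤ.- x ℤ.* c zero)) (weightSum-affine (b ∘ suc)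
        (c ∘ suc) x I))
      (regroup (b zero) (c zero) x (weightSum (b ∘ suc) I) (weightSum (c ∘ suc) I))
      where
      regroup : ∀ a c x s t → (a ℤ.- x ℤ.* c) ℤ.+ (s ℤ.- x ℤ.* t) ≡ (a ℤ.+ s) ℤ.- x ℤ.* (c ℤ.+ t)
      regroup = solve-∀

    -- Averaging ζ^(xA)·∏(1 − ζ^(b_s − x c_s)) over x modulo N isolates the subsets with Σ c_s ≡ A (mod N).
    filter-sum : ∀ {k} D (g : Subset k → ℤ) (b c : Fin k → ℤ) (t : ℕ → Fin k → Bool) →
      DegLt D (λ I → ℤAlgebra.ι S (g I)) →
      (∀ x → D ℕ.≤ sumℕ (λ s → if t x s then 1 else 0)) →
      (∀ x s → t x s ≡ true → + N ∣ b s ℤ.- + x ℤ.* c s) →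
      ∀ A₀ (K : Subset k → Bool) → (∀ I → K I ≡ true → + N ∣ A₀ ℤ.- weightSum c I) →
          (∀ I → K I ≡ false → ¬ + N ∣ A₀ ℤ.- weightSum c I) →
      sumL (allSubsets k) (λ I → if K I then ι (neg1pow (card I)) * (ι (g I) * ζℤ (weightSum b I)) else 0#) ≈ 0#
    -- The sum over x gives N times the claim, and multiplication by N is injective in ℤ[ζ].
    filter-sum {k} D g b c t deg cover t⇒ A₀ K K⇒ ¬K⇒ = torsion-free N _ (begin
      ι (+ N) * sumL (allSubsets k) (λ I → if K I then T I else 0#)
        ≈⟨ sumL-* (ι (+ N)) (allSubsets k) _ ⟩
      sumL (allSubsets k) (λ I → ι (+ N) * (if K I then T I else 0#))
        ≈⟨ sumL-cong (allSubsets k) pick ⟩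
      sumL (allSubsets k) (λ I → T I * geo N (ζℤ (A₀ ℤ.- weightSum c I)))
        ≈⟨ sumL-cong (allSubsets k) (λ I → sumL-geo N id (T I) (ζℤ (A₀ ℤ.- weightSum c I)) (λ x → term x I) (term-power I)) ⟨
      sumL (allSubsets k) (λ I → sumL (L.upTo N) (λ x → term x I))
        ≈⟨ sumL-swap (allSubsets k) (L.upTo N) (λ I x → term x I) ⟩
      sumL (L.upTo N) (λ x → sumL (allSubsets k) (term x))
        ≈⟨ sumL-zero (L.upTo N) each ⟩
      0# ∎)
      where
      T : Subset k → Carrier
      T I = ι (neg1pow (card I)) * (ι (g I) * ζℤ (weightSum b I))
      v : ℕ → Fin k → ℤ
      v x s = b s ℤ.- + x ℤ.* c s
      term : ℕ → Subset k → Carrier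
      term x I = ζℤ (A₀ ℤ.* + x) * (ι (neg1pow (card I)) * (ι (g I) * prodS (ζℤ ∘ v x) I))
      each : ∀ x → sumL (allSubsets k) (term x) ≈ 0#
      each x = trans (sym (sumL-* (ζℤ (A₀ ℤ.* + x)) (allSubsets k) _)) (trans (*-congˡ
        (vanishing D g (ζℤ ∘ v x) (t x) (λ s ts → ζℤ-∣ (v x s) (t⇒ x s ts)) deg (cover x))) (zeroʳ _))
      term-power : ∀ I x → term x I ≈ T I * ζℤ (A₀ ℤ.- weightSum c I) ^ x
      term-power I x = begin
        ζℤ (A₀ ℤ.* + x) * (s * (γ * prodS (ζℤ ∘ v x) I))
          ≈⟨ *-congˡ (*-congˡ (*-congˡ (trans (prodS-ζℤ (v x) I) (trans (reflexive (cong ζℤ (weightSum-affine b c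
              (+ x) I))) (ζℤ-+ (weightSum b I) _))))) ⟩
        ζℤ (A₀ ℤ.* + x) * (s * (γ * (ζℤ (weightSum b I) * ζℤ (ℤ.- (+ x ℤ.* weightSum c I)))))
          ≈⟨ solve 5 (λ a s g b w → a :* (s :* (g :* (b :* w))) := s :* (g :* b) :* (a :* w)) refl (ζℤ (A₀ ℤ.* + x)) s γ
              (ζℤ (weightSum b I)) (ζℤ (ℤ.- (+ x ℤ.* weightSum c I))) ⟩
        T I * (ζℤ (A₀ ℤ.* + x) * ζℤ (ℤ.- (+ x ℤ.* weightSum c I)))
          ≈⟨ *-congˡ (trans (sym (ζℤ-+ (A₀ ℤ.* + x) _)) (trans (reflexive (cong ζℤ (regroup A₀ (+ x) (weightSum c I))))
              (ζℤ-*ℕ (A₀ ℤ.- weightSum c I) x))) ⟩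
        T I * ζℤ (A₀ ℤ.- weightSum c I) ^ x ∎
        where
        s = ι (neg1pow (card I))
        γ = ι (g I)
        regroup : ∀ a x w → a ℤ.* x ℤ.+ ℤ.- (x ℤ.* w) ≡ (a ℤ.- w) ℤ.* x
        regroup = solve-∀
      pick : ∀ I → ι (+ N) * (if K I then T I else 0#) ≈ T I * geo N (ζℤ (A₀ ℤ.- weightSum c I))
      pick I with K I in eq
      ... | true  = trans (*-comm (ι (+ N)) (T I)) (*-congˡ (sym (geo-∣ _ (K⇒ I eq))))
      ... | false = trans (zeroʳ _) (sym (trans (*-congˡ (geo-∤ _ (¬K⇒ I eq))) (zeroʳ (T I))))

-- Rational polynomials on subsets; congruences for products.

module SubsetPolynomials where

  open ℤAlgebras
  open RationalAlgebra
  open FiniteDifferences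
  open IntegerBinomials
  open import Data.Nat using (_≤_; _!)
  open import Data.Integer.Divisibility.Signed using (_∣_; divides; ∣⇒∣ᵤ; ∣ᵤ⇒∣)
  open import Data.Rational as ℚ using (ℚ; ↥_; ↧ₙ_; 0ℚ; 1ℚ)
  open import Data.Rational.Literals using (fromℤ)
  import Data.Rational.Properties as ℚP
  open import Data.Vec using ([]; _∷_; lookup)
  open import Data.List.Membership.Propositional using (_∈_)
  open import Data.List.Membership.Propositional.Properties using (∈-map⁺; ∈-++⁺ˡ; ∈-++⁺ʳ)
  open import Data.List.Relation.Unary.Any using (here; there)
  open import Data.List.Relation.Unary.All using ([]; _∷_)
  open import Relation.Nullary.Decidable using (dec-true)
  open import Relation.Binary.PropositionalEquality using (refl; sym; trans)

  open IntSolver ratAlg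
  open Degree ratAlg

  prodℤ : ∀ {k} → (Fin k → ℤ) → ℤ
  prodℤ {zero}  f = + 1
  prodℤ {suc k} f = f zero ℤ.* prodℤ (f ∘ suc)

  -- The vanishing lemma takes integer-valued functions, whereas P and the falling factorials may be
  -- fractional on the subsets that the average removes. There are finitely many subsets, so one
  -- denominator serves them all.
  clear-denominators : ∀ {k} (f : Subset k → ℚ) → ∃ λ D → NonZero D × ∃ λ (g : Subset k → ℤ) → ∀ I → fromℤ (g I) ≡ fromℤ
      (+ D) ℚ.* f I
  clear-denominators {zero} f = ↧ₙ (f []) , _ , (λ _ → ↥ (f [])) , λ { [] → sym (↧*q≡↥ (f [])) }
  clear-denominators {suc k} f with clear-denominators (f ∘ (false ∷_)) | clear-denominators (f ∘ (true ∷_))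
  ... | D , D≢0 , g , eq | D′ , D′≢0 , g′ , eq′ = D ℕ.* D′ , ℕP.m*n≢0 D D′ {{D≢0}} {{D′≢0}} , G , proof
    where
    G : Subset (suc k) → ℤ
    G (false ∷ I) = + D′ ℤ.* g I
    G (true ∷ I)  = + D ℤ.* g′ I
    D*D′ : fromℤ (+ (D ℕ.* D′)) ≡ fromℤ (+ D) ℚ.* fromℤ (+ D′)
    D*D′ = trans (cong fromℤ (ℤP.pos-* D D′)) (fromℤ-* (+ D) (+ D′))
    proof : ∀ I → fromℤ (G I) ≡ fromℤ (+ (D ℕ.* D′)) ℚ.* f I
    proof (false ∷ I) = trans (fromℤ-* (+ D′) (g I)) (trans (cong (fromℤ (+ D′) ℚ.*_) (eq I))
      (trans (solve 3 (λ d d′ x → d′ :* (d :* x) := d :* d′ :* x) refl (fromℤ (+ D)) (fromℤ (+ D′)) (f (false ∷ I)))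
          (cong (ℚ._* f (false ∷ I)) (sym D*D′))))
    proof (true ∷ I)  = trans (fromℤ-* (+ D) (g′ I)) (trans (cong (fromℤ (+ D) ℚ.*_) (eq′ I))
      (trans (sym (ℚP.*-assoc (fromℤ (+ D)) (fromℤ (+ D′)) (f (true ∷ I)))) (cong (ℚ._* f (true ∷ I)) (sym D*D′))))

  linear : ∀ {k} → (Fin k → ℚ) → Subset k → ℚ
  linear v I = sumℚ (λ s → if lookup I s then v s else 0ℚ)

  DegLt-linear : ∀ {k} (v : Fin k → ℚ) → DegLt 2 (linear v)
  DegLt-linear {zero}  v ()
  DegLt-linear {suc k} v = DegLt-cong {k} (λ I → sym (ℚP.+-identityˡ (linear (v ∘ suc) I))) (DegLt-linear (v ∘ suc)) ,
    DegLt-cong {k} (λ I → solve 3 (λ v z x → v := (v :+ x) :- (con (+ 0) :+ x)) refl (v zero) 0ℚ (linear (v ∘ suc) I))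
        (DegLt-const {k} (v zero))

  fromℤ-linear : ∀ {k} (v : Fin k → ℤ) (I : Subset k) → linear (fromℤ ∘ v) I ≡ fromℤ (sumℤ
      (λ s → if lookup I s then v s else + 0))
  fromℤ-linear v []          = refl
  fromℤ-linear v (false ∷ I) = trans (cong (0ℚ ℚ.+_) (fromℤ-linear (v ∘ suc) I)) (sym (fromℤ-+ (+ 0) (sumℤ
      (λ s → if lookup I s then v (suc s) else + 0))))
  fromℤ-linear v (true ∷ I)  = trans (cong (fromℤ (v zero) ℚ.+_) (fromℤ-linear (v ∘ suc) I)) (sym (fromℤ-+ (v zero)
      (sumℤ (λ s → if lookup I s then v (suc s) else + 0))))

  DegLt-affine : ∀ {k} {f : Subset k → ℚ} β → DegLt 2 f → DegLt 2 (λ I → f I ℚ.- β)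
  DegLt-affine {k} β h = DegLt-+ h (DegLt-mono {k} (ℕ.s≤s ℕ.z≤n) (DegLt-const {k} (ℚ.- β)))

  bit : ∀ {k} → Subset k → Fin k → ℚ
  bit I s = if lookup I s then 1ℚ else 0ℚ

  DegLt-bit : ∀ {k} (s : Fin k) → DegLt 2 (λ I → bit I s)
  DegLt-bit {suc k} zero    = DegLt-mono {k} (ℕ.s≤s ℕ.z≤n) (DegLt-const {k} 0ℚ) , DegLt-const {k} (1ℚ ℚ.- 0ℚ)
  DegLt-bit {suc k} (suc s) = DegLt-bit s , DegLt-≈0 (λ I → ℚP.+-inverseʳ (bit I s))

  DegLt-pow : ∀ {k} {f : Subset k → ℚ} → DegLt 2 f → ∀ e → DegLt (suc e) (λ I → powℚ (f I) e)
  DegLt-pow {k} h zero    = DegLt-const {k} 1ℚ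
  DegLt-pow {k} h (suc e) = DegLe-* 1 e h (DegLt-pow h e)

  DegLt-prodℚ : ∀ {k r} (f : Fin r → Subset k → ℚ) (D : Fin r → ℕ) → (∀ i → DegLt (suc (D i)) (f i)) → DegLt (suc
      (sumℕ D)) (λ I → prodℚ (λ i → f i I))
  DegLt-prodℚ {k} {zero}  f D h = DegLt-const {k} 1ℚ
  DegLt-prodℚ {k} {suc r} f D h = DegLe-* (D zero) (sumℕ (D ∘ suc)) (h zero) (DegLt-prodℚ (f ∘ suc) (D ∘ suc) (h ∘ suc))

  DegLt-evalSub : ∀ {k d} (P : Poly k) → DegLe d P → DegLt (suc d) (evalSub P)
  DegLt-evalSub {k} []            []        = DegLt-zero {k}
  DegLt-evalSub {k} ((c , e) ∷ P) (h ∷ hs) = DegLt-+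
    (DegLe-* 0 _ (DegLt-const {k} c) (DegLt-mono (ℕ.s≤s h) (DegLt-prodℚ (λ s I → powℚ (bit I s) (e s)) e
        (λ s → DegLt-pow (DegLt-bit s) (e s)))))
    (DegLt-evalSub P hs)

  fallingℚ : ℚ → ℕ → ℚ
  fallingℚ x zero    = 1ℚ
  fallingℚ x (suc n) = fallingℚ x n ℚ.* (x ℚ.- fromℤ (+ n))

  fallingℚ-fromℤ : ∀ z n → fallingℚ (fromℤ z) n ≡ fromℤ (falling z n)
  fallingℚ-fromℤ z zero    = refl
  fallingℚ-fromℤ z (suc n) = trans (cong₂ ℚ._*_ (fallingℚ-fromℤ z n) (sym (fromℤ-sub z (+ n)))) (sym (fromℤ-*
      (falling z n) (z ℤ.- + n)))

  fallingℚ≡!*binomial : ∀ z n → fallingℚ (fromℤ z) n ≡ fromℤ (+ (n !) ℤ.* binomial z n)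
  fallingℚ≡!*binomial z n = trans (fallingℚ-fromℤ z n) (cong fromℤ (falling≡!*binomial z n))

  DegLt-falling : ∀ {k} {f : Subset k → ℚ} → DegLt 2 f → ∀ n → DegLt (suc n) (λ I → fallingℚ (f I) n)
  DegLt-falling {k} h zero    = DegLt-const {k} 1ℚ
  DegLt-falling {k} {f} h (suc n) = subst (λ m → DegLt (suc m) (λ I → fallingℚ (f I) (suc n))) (ℕP.+-comm n 1)
    (DegLe-* n 1 (DegLt-falling h n) (DegLt-affine (fromℤ (+ n)) h))

  prodShift : List ℕ → ℚ → ℚ
  prodShift []       x = 1ℚ
  prodShift (ρ ∷ ρs) x = (x ℚ.- fromℤ (+ ρ)) ℚ.* prodShift ρs x

  prodShiftℤ : List ℕ → ℤ → ℤ
  prodShiftℤ []       x = + 1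
  prodShiftℤ (ρ ∷ ρs) x = (x ℤ.- + ρ) ℤ.* prodShiftℤ ρs x

  prodShift-fromℤ : ∀ ρs z → prodShift ρs (fromℤ z) ≡ fromℤ (prodShiftℤ ρs z)
  prodShift-fromℤ []       z = refl
  prodShift-fromℤ (ρ ∷ ρs) z = trans (cong₂ ℚ._*_ (sym (fromℤ-sub z (+ ρ))) (prodShift-fromℤ ρs z)) (sym (fromℤ-* (z ℤ.- + ρ) _))

  DegLt-prodShift : ∀ {k d} {f : Subset k → ℚ} → 1 ≤ d → DegLt (suc d) f → ∀ ρs → DegLt (suc (d ℕ.* L.length ρs))
      (λ I → prodShift ρs (f I))
  DegLt-prodShift {k} {d} 1≤d h [] = DegLt-mono {k} (ℕ.s≤s ℕ.z≤n) (DegLt-const {k} 1ℚ)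
  DegLt-prodShift {k} {d} {f} 1≤d h (ρ ∷ ρs) = subst (λ m → DegLt (suc m) (λ I → prodShift (ρ ∷ ρs) (f I))) (sym
      (ℕP.*-suc d (L.length ρs)))
    (DegLe-* d (d ℕ.* L.length ρs) (DegLt-+ h (DegLt-mono {k} (ℕ.s≤s ℕ.z≤n) (DegLt-const {k} (ℚ.- fromℤ (+ ρ)))))
        (DegLt-prodShift 1≤d h ρs))

  dvdB⇒∣ : ∀ n z → dvdB n z ≡ true → + n ∣ z
  dvdB⇒∣ n z h with n ℕD.∣? ℤ.∣ z ∣
  ... | yes d = ∣ᵤ⇒∣ d
  dvdB⇒∣ n z () | no _

  ¬dvdB⇒∤ : ∀ n z → dvdB n z ≡ false → ¬ + n ∣ z
  ¬dvdB⇒∤ n z h with n ℕD.∣? ℤ.∣ z ∣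
  ... | no ∤ = λ d → ∤ (∣⇒∣ᵤ d)
  ¬dvdB⇒∤ n z () | yes _

  ∣⇒dvdB : ∀ n z → + n ∣ z → dvdB n z ≡ true
  ∣⇒dvdB n z d = dec-true (n ℕD.∣? ℤ.∣ z ∣) (∣⇒∣ᵤ d)

  allB-true : ∀ {r} (f : Fin r → Bool) → allB f ≡ true → ∀ i → f i ≡ true
  allB-true f h zero with f zero
  ... | true = refl
  allB-true f h (suc i) with f zero
  ... | true = allB-true (f ∘ suc) h i

  allB-false : ∀ {r} (f : Fin r → Bool) → allB f ≡ false → ∃ λ i → f i ≡ false
  allB-false {suc r} f h with f zero in eq
  ... | false = zero , eq
  ... | true with allB-false (f ∘ suc) h
  ... | i , fi = suc i , fi

  ∧-true : ∀ a b → a ∧ b ≡ true → a ≡ true × b ≡ true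
  ∧-true true true _ = refl , refl

  ∈-allSubsets : ∀ {k} (I : Subset k) → I ∈ allSubsets k
  ∈-allSubsets []          = here refl
  ∈-allSubsets (false ∷ I) = ∈-++⁺ˡ (∈-map⁺ (false ∷_) (∈-allSubsets I))
  ∈-allSubsets (true ∷ I)  = ∈-++⁺ʳ (L.map (false ∷_) (allSubsets _)) (∈-map⁺ (true ∷_) (∈-allSubsets I))

  module Congruence (n : ℤ) where

    *-cong-mod : ∀ a b c d → n ∣ a ℤ.- b → n ∣ c ℤ.- d → n ∣ a ℤ.* c ℤ.- b ℤ.* d
    *-cong-mod a b c d (divides q e) (divides r f) = divides (q ℤ.* c ℤ.+ b ℤ.* r)
      (trans (split a b c d) (trans (cong₂ (λ x y → x ℤ.* c ℤ.+ b ℤ.* y) e f) (collect q r n b c)))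
      where
      split : ∀ a b c d → a ℤ.* c ℤ.- b ℤ.* d ≡ (a ℤ.- b) ℤ.* c ℤ.+ b ℤ.* (c ℤ.- d)
      split = solve-∀
      collect : ∀ q r n b c → q ℤ.* n ℤ.* c ℤ.+ b ℤ.* (r ℤ.* n) ≡ (q ℤ.* c ℤ.+ b ℤ.* r) ℤ.* n
      collect = solve-∀

    ∣-*ˡ : ∀ {a} b → n ∣ a → n ∣ a ℤ.* b
    ∣-*ˡ {a} b (divides q e) = divides (q ℤ.* b) (trans (cong (ℤ._* b) e) (swp q n b))
      where
      swp : ∀ q n b → q ℤ.* n ℤ.* b ≡ q ℤ.* b ℤ.* n
      swp = solve-∀

    ∣-*ʳ : ∀ a {b} → n ∣ b → n ∣ a ℤ.* b
    ∣-*ʳ a {b} d = subst (n ∣_) (ℤP.*-comm b a) (∣-*ˡ a d)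

    refl-mod : ∀ a → n ∣ a ℤ.- a
    refl-mod a = divides (+ 0) (ℤP.+-inverseʳ a)

    prodℤ-cong-mod : ∀ {r} (f g : Fin r → ℤ) → (∀ i → n ∣ f i ℤ.- g i) → n ∣ prodℤ f ℤ.- prodℤ g
    prodℤ-cong-mod {zero}  f g h = refl-mod (+ 1)
    prodℤ-cong-mod {suc r} f g h = *-cong-mod (f zero) (g zero) (prodℤ (f ∘ suc)) (prodℤ (g ∘ suc)) (h zero)
        (prodℤ-cong-mod (f ∘ suc) (g ∘ suc) (h ∘ suc))

    ∣-prodℤ : ∀ {r} (f : Fin r → ℤ) i → n ∣ f i → n ∣ prodℤ f
    ∣-prodℤ f zero    d = ∣-*ˡ (prodℤ (f ∘ suc)) d
    ∣-prodℤ f (suc i) d = ∣-*ʳ (f zero) (∣-prodℤ (f ∘ suc) i d)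

    prodShiftℤ-cong-mod : ∀ ρs x y → n ∣ x ℤ.- y → n ∣ prodShiftℤ ρs x ℤ.- prodShiftℤ ρs y
    prodShiftℤ-cong-mod []       x y h = refl-mod (+ 1)
    prodShiftℤ-cong-mod (ρ ∷ ρs) x y h = *-cong-mod (x ℤ.- + ρ) (y ℤ.- + ρ) (prodShiftℤ ρs x) (prodShiftℤ ρs y) (subst
        (n ∣_) (cancel x y (+ ρ)) h) (prodShiftℤ-cong-mod ρs x y h)
      where
      cancel : ∀ x y r → x ℤ.- y ≡ (x ℤ.- r) ℤ.- (y ℤ.- r)
      cancel = solve-∀

    ∣-prodShiftℤ : ∀ {ρ} ρs x → ρ ∈ ρs → n ∣ x ℤ.- + ρ → n ∣ prodShiftℤ ρs x
    ∣-prodShiftℤ (_ ∷ ρs) x (here refl) d = ∣-*ˡ (prodShiftℤ ρs x) d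
    ∣-prodShiftℤ (σ ∷ ρs) x (there m)   d = ∣-*ʳ (x ℤ.- + σ) (∣-prodShiftℤ ρs x m d)

  prodℚ-scaled : ∀ {r} (f : Fin r → ℚ) (a b : Fin r → ℤ) → (∀ i → f i ≡ fromℤ (a i ℤ.* b i)) → prodℚ f ≡ fromℤ
      (prodℤ a ℤ.* prodℤ b)
  prodℚ-scaled {zero}  f a b h = refl
  prodℚ-scaled {suc r} f a b h = trans (cong₂ ℚ._*_ (h zero) (prodℚ-scaled (f ∘ suc) (a ∘ suc) (b ∘ suc) (h ∘ suc)))
    (trans (sym (fromℤ-* (a zero ℤ.* b zero) (prodℤ (a ∘ suc) ℤ.* prodℤ (b ∘ suc)))) (cong fromℤ (regroup (a zero)
        (b zero) (prodℤ (a ∘ suc)) (prodℤ (b ∘ suc)))))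
    where
    regroup : ∀ a b c d → a ℤ.* b ℤ.* (c ℤ.* d) ≡ a ℤ.* c ℤ.* (b ℤ.* d)
    regroup = solve-∀

-- The signed sum over the subsets in ℐ with p dividing P(I).

module ZeroSums where

  open ℤAlgebras
  open PolynomialEvaluation using (module Evaluation)
  open GeometricSums using (module Geometric; prime∤⇒coprime)
  open MöbiusDivisors using (∈-range⁺; ∈-range⁻; divℕ-cofactor)
  open RootsOfUnity
  open IntegralElements
  open RationalAlgebra
  open FiniteDifferences
  open IntegerBinomials
  open RootFiltering
  open SubsetPolynomials
  open import Data.Nat using (_∸_; _≤_; _<_; _!)
  open import Data.Nat.Coprimality using (coprime-Bézout)
  open import Data.Nat.GCD using (module Bézout)
  open import Data.Nat.Primality using (Prime; prime⇒nonTrivial; prime⇒nonZero; euclidsLemma)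
  import Data.Integer.DivMod as ℤDM
  open import Data.Integer.Divisibility.Signed using (_∣_; divides; ∣⇒∣ᵤ; ∣ᵤ⇒∣)
  open import Data.Rational as ℚ using (ℚ; ↥_; 0ℚ; 1ℚ)
  open import Data.Rational.Literals using (fromℤ)
  import Data.Rational.Properties as ℚP
  import Data.Fin.Properties as FinP
  open import Data.Bool.Properties using (T-≡)
  import Data.Bool.ListAction as BLA
  open import Data.Vec using (Vec; []; _∷_; lookup)
  open import Data.List using (length)
  open import Data.List.Membership.Propositional using (_∈_)
  open import Data.List.Membership.Propositional.Properties using (∈-filter⁺; ∈-filter⁻)
  open import Data.List.Relation.Unary.Any using (here; there)
  open import Data.List.Relation.Unary.All as All using (All; []; _∷_)
  open import Function.Bundles using (Equivalence)
  open import Relation.Nullary.Decidable using (T?)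

  fromℤ-injective-0 : ∀ z → fromℤ z ≡ 0ℚ → z ≡ + 0
  fromℤ-injective-0 z e = fromℤ-injective e

  prodℕ-divides : ∀ {r} (f : Fin r → ℕ) i → f i ℕD.∣ prodℕ f
  prodℕ-divides f zero    = ℕD.m∣m*n _
  prodℕ-divides f (suc i) = ℕD.∣-trans (prodℕ-divides (f ∘ suc) i) (ℕD.n∣m*n (f zero))

  prodℕ≢0 : ∀ {r} (f : Fin r → ℕ) → (∀ i → NonZero (f i)) → NonZero (prodℕ f)
  prodℕ≢0 {zero}  f h = _
  prodℕ≢0 {suc r} f h = ℕP.m*n≢0 (f zero) _ {{h zero}} {{prodℕ≢0 (f ∘ suc) (h ∘ suc)}}

  any-true : ∀ {B : Set} (f : B → Bool) {x} xs → x ∈ xs → f x ≡ true → BLA.any f xs ≡ true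
  any-true f (x ∷ xs) (here ≡.refl) h rewrite h = ≡.refl
  any-true f (y ∷ xs) (there m)     h with f y
  ... | true  = ≡.refl
  ... | false = any-true f xs m h

  prodℤ-pos : ∀ {r} (f : Fin r → ℕ) → prodℤ (λ i → + f i) ≡ + prodℕ f
  prodℤ-pos {zero}  f = ≡.refl
  prodℤ-pos {suc r} f = ≡.trans (cong (ℤ._*_ (+ f zero)) (prodℤ-pos (f ∘ suc))) (≡.sym (ℤP.pos-* (f zero) (prodℕ (f ∘ suc))))

  bezout : ∀ {p} → Prime p → ∀ u → ¬ + p ∣ u → ∃ λ v → ∃ λ w → v ℤ.* u ℤ.+ w ℤ.* + p ≡ + 1
  bezout {p} pp u p∤u with coprime-Bézout (prime∤⇒coprime pp (λ d → p∤u (∣ᵤ⇒∣ d)))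
  ... | b with |u|≡ u
    where
    |u|≡ : ∀ u → ∃ λ σ → σ ℤ.* u ≡ + ℤ.∣ u ∣
    |u|≡ (+ n)      = + 1 , ℤP.*-identityˡ (+ n)
    |u|≡ ℤ.-[1+ n ] = ℤ.- (+ 1) , ℤP.-1*i≡-i ℤ.-[1+ n ]
  bezout {p} pp u p∤u | Bézout.+- x y eq | σ , σu = ℤ.- (+ y) ℤ.* σ , + x ,
    ≡.trans (cong₂ ℤ._+_ (≡.trans (ℤP.*-assoc (ℤ.- (+ y)) σ u) (cong (ℤ._*_ (ℤ.- (+ y))) σu))
                         (≡.trans (≡.sym (ℤP.pos-* x p)) (cong +_ (≡.sym eq))))
      (≡.trans (cong (λ z → ℤ.- (+ y) ℤ.* + ℤ.∣ u ∣ ℤ.+ (+ 1 ℤ.+ z)) (ℤP.pos-* y ℤ.∣ u ∣)) (cancel (+ y) (+ ℤ.∣ u ∣)))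
    where
    cancel : ∀ y u → ℤ.- y ℤ.* u ℤ.+ (+ 1 ℤ.+ y ℤ.* u) ≡ + 1
    cancel = solve-∀
  bezout {p} pp u p∤u | Bézout.-+ x y eq | σ , σu = + y ℤ.* σ , ℤ.- (+ x) ,
    ≡.trans (cong (ℤ._+ ℤ.- (+ x) ℤ.* + p) (≡.trans (ℤP.*-assoc (+ y) σ u) (≡.trans (cong (ℤ._*_ (+ y)) σu) (≡.trans
        (≡.sym (ℤP.pos-* y ℤ.∣ u ∣)) (cong +_ (≡.sym eq))))))
      (≡.trans (cong (λ z → + 1 ℤ.+ z ℤ.+ ℤ.- (+ x) ℤ.* + p) (ℤP.pos-* x p)) (cancel (+ x) (+ p)))
    where
    cancel : ∀ x p → + 1 ℤ.+ x ℤ.* p ℤ.+ ℤ.- x ℤ.* p ≡ + 1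
    cancel = solve-∀

  module SignedTerms (A : ℤAlgebra) where
    open ℤAlgebra A hiding (zero)
    open IntSolver A
    open SR setoid

    -- The idle term `ι u * 0#` gives this the same shape as `congruent`, so that the two cases can
    -- be added up over all subsets.
    multiple : ∀ s f u p z → p ∣ f → ∃ λ Q → ι s * (ι f * z) ≈ ι u * 0# + ι p * Q
    multiple s f u p z (divides q eq) = ι s * (ι q * z) , (begin
      ι s * (ι f * z)                       ≈⟨ *-congˡ (*-congʳ (trans (ι-cong eq) (ι-* q p))) ⟩
      ι s * (ι q * ι p * z)                 ≈⟨ solve 4 (λ s q p z → s :* (q :* p :* z) := p :* (s :* (q :* z))) refl
          (ι s) (ι q) (ι p) z ⟩
      ι p * (ι s * (ι q * z))               ≈⟨ trans (+-congʳ (zeroʳ (ι u))) (+-identityˡ _) ⟨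
      ι u * 0# + ι p * (ι s * (ι q * z))    ∎)

    congruent : ∀ s f u p z → p ∣ f ℤ.- u → ∃ λ Q → ι s * (ι f * z) ≈ ι u * (ι s * z) + ι p * Q
    congruent s f u p z (divides q eq) = ι s * (ι q * z) , (begin
      ι s * (ι f * z)                       ≈⟨ *-congˡ (*-congʳ (trans (ι-cong (≡.trans (split f u) (cong
          (ℤ._+_ u) eq))) (trans (ι-+ u (q ℤ.* p)) (+-congˡ (ι-* q p))))) ⟩
      ι s * ((ι u + ι q * ι p) * z)         ≈⟨ solve 5 (λ s u q p z → s :* ((u :+ q :* p) :* z) := u :* (s :* z) :+ p :*
          (s :* (q :* z))) refl (ι s) (ι u) (ι q) (ι p) z ⟩
      ι u * (ι s * z) + ι p * (ι s * (ι q * z)) ∎)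
      where
      split : ∀ f u → f ≡ u ℤ.+ (f ℤ.- u)
      split = solve-∀

    scaled : ∀ c s f g z → g ≡ c ℤ.* f → ι c * (ι s * (ι f * z)) ≈ ι s * (ι g * z)
    scaled c s f g z eq = begin
      ι c * (ι s * (ι f * z))   ≈⟨ solve 4 (λ c s f z → c :* (s :* (f :* z)) := s :* (c :* f :* z)) refl (ι c) (ι s) (ι f) z ⟩
      ι s * (ι c * ι f * z)     ≈⟨ *-congˡ (*-congʳ (trans (sym (ι-* c f)) (ι-cong (≡.sym eq)))) ⟩
      ι s * (ι g * z)           ∎

  module Main (p : ℕ) (pp : Prime p) {r : ℕ} (dG : Fin r → ℕ) (dG>1 : ∀ i → 1 < dG i) (e : ℕ) (|G| : prodℕ dG ≡ p ℕ.^ e)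
    (h Δ : ℕ) {k : ℕ} (a : Fin k → ℤ) (n : Fin k → ℕ) (nz : ∀ s → NonZero (n s))
    (cover : IsCover (dstar dG ℕ.+ p ℕ.^ h ℕ.+ Δ) a n)
    (m : Fin k → ℤ) (c : Grp r) (cs : Fin k → Grp r) (α : ℚ)
    (d : ℕ) (1≤d : 1 ≤ d) (P : Poly k) (degP : DegLe d P)
    (intP : ∀ (I : Subset k) → IsInt (ratSum m n nz I ℚ.- α) → IsInt (evalSub P I))
    (R : RootRing (prodℕ n)) where

    ℐ : Subset k → Bool
    ℐ = inℐB p h dG c cs m n nz α

    member : Subset k → Bool
    member I = ℐ I ∧ inMultB p (evalSub P I)

    N : ℕ
    N = prodℕ n

    instance
      N≢0 : NonZero N
      N≢0 = prodℕ≢0 n nz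
      p≢0 : NonZero p
      p≢0 = prime⇒nonZero pp

    p^h-1 : ℕ
    p^h-1 = p ℕ.^ h ∸ 1

    p^h≢0 : NonZero (p ℕ.^ h)
    p^h≢0 = ℕP.m^n≢0 p h

    open RootRing R
    open ℤAlgebra A hiding (zero)
    open IntSolver A
    open Geometric A using (_^_; ^-congˡ; ^-congʳ; ^-distrib-*; ^-homo-*)
    open IntegerPowers R
    open Integrality R using (integral)
    open ListSum A
    open SignedTerms A
    open Degree ratAlg using (DegLt; DegLt-*; DegLt-const; DegLt-cong; DegLe-*)
    open Congruence (+ p)

    cofactor : Fin k → ℕ
    cofactor s = divℕ N (n s)

    cofactor-* : ∀ s → N ≡ cofactor s ℕ.* n s
    cofactor-* s with prodℕ-divides n s
    ... | ℕD.divides q eq = ≡.trans eq (cong (ℕ._* n s) (≡.sym (≡.trans (cong (λ M → divℕ M (n s)) eq) (divℕ-cofactor q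
        (n s) (nz s)))))

    t : Subset k → ℚ
    t I = ratSum m n nz I ℚ.- α

    -- The class that the average singles out. It contains every subset of ℐ, and on it both t and P
    -- take integer values.
    K : Subset k → Bool
    K I = isIntB (t I)

    mN : Fin k → ℤ
    mN s = m s ℤ.* + cofactor s

    N*ratSum : ∀ I → fromℤ (+ N) ℚ.* ratSum m n nz I ≡ fromℤ (weightSum mN I)
    N*ratSum I = ≡.trans (scale (λ s → ℚ._/_ (m s) (n s) {{nz s}}) (fromℤ ∘ mN) term I) (fromℤ-linear mN I)
      where
      scale : ∀ {k} (u v : Fin k → ℚ) → (∀ s → fromℤ (+ N) ℚ.* u s ≡ v s) → ∀ I → fromℤ (+ N) ℚ.* linear u I ≡ linear v I
      scale u v h []          = ℚP.*-zeroʳ (fromℤ (+ N))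
      scale u v h (false ∷ I) = ≡.trans (ℚP.*-distribˡ-+ (fromℤ (+ N)) 0ℚ (linear (u ∘ suc) I)) (cong₂ ℚ._+_ (ℚP.*-zeroʳ
          (fromℤ (+ N))) (scale (u ∘ suc) (v ∘ suc) (h ∘ suc) I))
      scale u v h (true ∷ I)  = ≡.trans (ℚP.*-distribˡ-+ (fromℤ (+ N)) (u zero) (linear (u ∘ suc) I)) (cong₂ ℚ._+_
          (h zero) (scale (u ∘ suc) (v ∘ suc) (h ∘ suc) I))
      term : ∀ s → fromℤ (+ N) ℚ.* ℚ._/_ (m s) (n s) {{nz s}} ≡ fromℤ (mN s)
      term s = ≡.trans (cong (ℚ._* x) (≡.trans (cong fromℤ (≡.trans (cong +_ (cofactor-* s)) (ℤP.pos-* (cofactor s)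
          (n s)))) (fromℤ-* (+ cofactor s) (+ n s))))
        (≡.trans (ℚP.*-assoc (fromℤ (+ cofactor s)) (fromℤ (+ n s)) x) (≡.trans (cong (fromℤ (+ cofactor s) ℚ.*_) (/-*
            (m s) (n s) {{nz s}}))
          (≡.trans (≡.sym (fromℤ-* (+ cofactor s) (m s))) (cong fromℤ (ℤP.*-comm (+ cofactor s) (m s))))))
        where x = ℚ._/_ (m s) (n s) {{nz s}}

    -- A numerator is defined for every subset; it equals the rational number itself only on `K`,
    -- where alone it is used as such.
    T′ : Subset k → ℤ
    T′ I = ↥ (t I)

    Pz : Subset k → ℤ
    Pz I = ↥ (evalSub P I)

    t≡ : ∀ I → K I ≡ true → t I ≡ fromℤ (T′ I)
    t≡ I = isInt⇒fromℤ (t I)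

    P≡ : ∀ I → K I ≡ true → evalSub P I ≡ fromℤ (Pz I)
    P≡ I KI = isInt⇒fromℤ (evalSub P I) (intP I KI)

    private
      module ℚS = IntSolver ratAlg

    difference : ∀ I J → fromℤ (+ N) ℚ.* (t I ℚ.- t J) ≡ fromℤ (weightSum mN I ℤ.- weightSum mN J)
    difference I J = ≡.trans (ℚS.solve 4 (λ n x y α → n ℚS.:* ((x ℚS.:- α) ℚS.:-
        (y ℚS.:- α)) ℚS.:= n ℚS.:* x ℚS.:- n ℚS.:* y) ≡.refl (fromℤ (+ N)) (ratSum m n nz I) (ratSum m n nz J) α)
      (≡.trans (cong₂ ℚ._-_ (N*ratSum I) (N*ratSum J)) (≡.sym (fromℤ-sub (weightSum mN I) (weightSum mN J))))

    -- The shift in the average must be an integer, and Nα need not be one. Once a subset of `K` is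
    -- known, its weight Σ m_s·N/n_s takes the place of Nα: this lemma and the next say that `K` is
    -- the class of that weight modulo N.
    K⇒∣ : ∀ I J → K I ≡ true → K J ≡ true → + N ∣ weightSum mN I ℤ.- weightSum mN J
    K⇒∣ I J KI KJ = divides (T′ I ℤ.- T′ J) (fromℤ-injective (≡.trans (≡.sym (difference I J)) (≡.trans (cong (fromℤ (+ N) ℚ.*_)
      (≡.trans (cong₂ ℚ._-_ (t≡ I KI) (t≡ J KJ)) (≡.sym (fromℤ-sub (T′ I) (T′ J)))))
      (≡.trans (≡.sym (fromℤ-* (+ N) (T′ I ℤ.- T′ J))) (cong fromℤ (ℤP.*-comm (+ N) (T′ I ℤ.- T′ J)))))))

    ∣⇒K : ∀ I J → K I ≡ true → + N ∣ weightSum mN I ℤ.- weightSum mN J → K J ≡ true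
    ∣⇒K I J KI (divides q eq) = fromℤ⇒isInt {t J} {T′ I ℤ.- q} (≡.trans (ℚS.solve 2 (λ x y → y ℚS.:= x ℚS.:-
        (x ℚS.:- y)) ≡.refl (t I) (t J))
      (≡.trans (cong₂ ℚ._-_ (t≡ I KI) t-t) (≡.sym (fromℤ-sub (T′ I) q))))
      where
      t-t : t I ℚ.- t J ≡ fromℤ q
      t-t = fromℤ-cancelˡ N (t I ℚ.- t J) (fromℤ q) (≡.trans (difference I J) (≡.trans (cong fromℤ (≡.trans eq
          (ℤP.*-comm q (+ N)))) (fromℤ-* (+ N) q)))

    -- The test function F and its values modulo p.

    attained : ℕ → Bool
    attained ρ = BLA.any (λ I → ℐ I ∧ inMultB p (evalSub P I ℚ.- (ℚ._/_ (+ ρ) 1))) (allSubsets k)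

    ρs : List ℕ
    ρs = filterᵇ attained (L.drop 1 (L.upTo p))

    y : Fin r → Subset k → ℤ
    y i I = sumG cs I i ℤ.- c i ℤ.- + 1

    -- Falling factorials instead of binomials: F̃ = fac · F, and the factor fac is cancelled at the end
    -- because ℤ[ζ] is torsion-free.
    F̃ : Subset k → ℚ
    F̃ I = prodℚ (λ i → fallingℚ (fromℤ (y i I)) (dG i ∸ 1)) ℚ.* fallingℚ (t I ℚ.- 1ℚ) p^h-1 ℚ.* prodShift ρs (evalSub P I)

    coordinates : Subset k → ℤ
    coordinates I = prodℤ (λ i → binomial (y i I) (dG i ∸ 1))

    fraction : Subset k → ℤ
    fraction I = binomial (T′ I ℤ.- + 1) p^h-1

    F : Subset k → ℤ
    F I = coordinates I ℤ.* fraction I ℤ.* prodShiftℤ ρs (Pz I)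

    fac : ℕ
    fac = prodℕ (λ i → (dG i ∸ 1) !) ℕ.* (p^h-1 !)

    deg-F̃ : DegLt (suc (dstar dG ℕ.+ p^h-1 ℕ.+ d ℕ.* length ρs)) F̃
    deg-F̃ = DegLe-* (dstar dG ℕ.+ p^h-1) (d ℕ.* length ρs)
      (DegLe-* (dstar dG) p^h-1
        (DegLt-prodℚ (λ i I → fallingℚ (fromℤ (y i I)) (dG i ∸ 1)) (λ i → dG i ∸ 1) (λ i → DegLt-falling (deg-y i) (dG i ∸ 1)))
        (DegLt-falling (DegLt-affine 1ℚ (DegLt-affine α (DegLt-linear (λ s → ℚ._/_ (m s) (n s) {{nz s}})))) p^h-1))
      (DegLt-prodShift 1≤d (DegLt-evalSub P degP) ρs)
      where
      deg-y : ∀ i → DegLt 2 (λ I → fromℤ (y i I))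
      deg-y i = DegLt-cong {k} (λ I → ≡.sym (≡.trans (fromℤ-sub (sumG cs I i ℤ.- c i) (+ 1)) (cong (ℚ._- 1ℚ)
          (≡.trans (fromℤ-sub (sumG cs I i) (c i)) (cong (ℚ._- fromℤ (c i)) (≡.sym (fromℤ-linear (λ s → cs s i) I)))))))
        (DegLt-affine 1ℚ (DegLt-affine (fromℤ (c i)) (DegLt-linear (λ s → fromℤ (cs s i)))))

    F̃≡fac*F : ∀ I → K I ≡ true → F̃ I ≡ fromℤ (+ fac ℤ.* F I)
    F̃≡fac*F I KI = ≡.trans (cong₂ ℚ._*_ (cong₂ ℚ._*_
        (prodℚ-scaled _ (λ i → + ((dG i ∸ 1) !)) (λ i → binomial (y i I) (dG i ∸ 1)) (λ i → fallingℚ≡!*binomial (y i I)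
            (dG i ∸ 1)))
        (≡.trans (cong (λ x → fallingℚ x p^h-1) t-1) (fallingℚ≡!*binomial (T′ I ℤ.- + 1) p^h-1)))
        (≡.trans (cong (prodShift ρs) (P≡ I KI)) (prodShift-fromℤ ρs (Pz I))))
      (≡.trans (≡.sym (≡.trans (fromℤ-* (f₁ ℤ.* B₁ ℤ.* (f₂ ℤ.* B₂)) B₃) (cong (ℚ._* fromℤ B₃) (fromℤ-* (f₁ ℤ.* B₁) (f₂ ℤ.* B₂)))))
        (cong fromℤ (≡.trans (regroup f₁ B₁ f₂ B₂ B₃) (cong (ℤ._* F I) fac≡))))
      where
      f₁ = prodℤ (λ i → + ((dG i ∸ 1) !))
      f₂ = + (p^h-1 !)
      B₁ = coordinates I
      B₂ = fraction I
      B₃ = prodShiftℤ ρs (Pz I)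
      t-1 : t I ℚ.- 1ℚ ≡ fromℤ (T′ I ℤ.- + 1)
      t-1 = ≡.trans (cong (ℚ._- 1ℚ) (t≡ I KI)) (≡.sym (fromℤ-+ (T′ I) (ℤ.- (+ 1))))
      regroup : ∀ a b c d e → a ℤ.* b ℤ.* (c ℤ.* d) ℤ.* e ≡ a ℤ.* c ℤ.* (b ℤ.* d ℤ.* e)
      regroup = solve-∀
      fac≡ : f₁ ℤ.* f₂ ≡ + fac
      fac≡ = ≡.trans (cong (ℤ._* f₂) (prodℤ-pos (λ i → (dG i ∸ 1) !))) (≡.sym (ℤP.pos-* (prodℕ (λ i → (dG i ∸ 1) !)) (p^h-1 !)))

    u : ℤ
    u = prodℤ (λ i → neg1pow (dG i ∸ 1)) ℤ.* neg1pow p^h-1 ℤ.* prodShiftℤ ρs (+ 0)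

    dG∣p^e : ∀ i → dG i ℕD.∣ p ℕ.^ e
    dG∣p^e i = subst (dG i ℕD.∣_) |G| (prodℕ-divides dG i)

    private
      module BG i = PrimePowerBinomial pp {dG i} {e} (dG∣p^e i)
      module Bh = PrimePowerBinomial pp {p ℕ.^ h} {h} ℕD.∣-refl

      plus-minus : ∀ x → x ℤ.- + 1 ℤ.+ + 1 ≡ x
      plus-minus = solve-∀

      pred-pos : ∀ n → 0 < n → n ≡ suc (n ∸ 1)
      pred-pos (suc n) _ = ≡.refl

      dG>0 : ∀ i → 0 < dG i
      dG>0 i = ℕP.<-trans (ℕ.s≤s ℕ.z≤n) (dG>1 i)

      p^h>0 : 0 < p ℕ.^ h
      p^h>0 = ℕ.>-nonZero⁻¹ (p ℕ.^ h) {{p^h≢0}}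

      pred< : ∀ n → 0 < n → n ∸ 1 < n
      pred< n 0<n = subst (n ∸ 1 <_) (≡.sym (pred-pos n 0<n)) (ℕP.n<1+n (n ∸ 1))

      y+1 : ∀ i I → y i I ℤ.+ + 1 ≡ sumG cs I i ℤ.- c i
      y+1 i I = plus-minus (sumG cs I i ℤ.- c i)

    member⇒ : ∀ I → member I ≡ true → eqGB dG (sumG cs I) c ≡ true × K I ≡ true × dvdB (p ℕ.^ h) (T′ I) ≡ true × dvdB p
        (Pz I) ≡ true
    member⇒ I h₀ with ∧-true (ℐ I) (inMultB p (evalSub P I)) h₀
    ... | inI , inP with ∧-true (eqGB dG (sumG cs I) c) (inMultB (p ℕ.^ h) (t I)) inI
    ... | inG , inα = inG , proj₁ (∧-true (K I) _ inα) , proj₂ (∧-true (K I) _ inα) , proj₂ (∧-true (isIntB (evalSub P I)) _ inP)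

    member⇒F≡u : ∀ I → member I ≡ true → + p ∣ F I ℤ.- u
    member⇒F≡u I h₀ = *-cong-mod (coordinates I ℤ.* fraction I) (prodℤ (λ i → neg1pow (dG i ∸ 1)) ℤ.* neg1pow p^h-1)
        (prodShiftℤ ρs (Pz I)) (prodShiftℤ ρs (+ 0))
      (*-cong-mod (coordinates I) (prodℤ (λ i → neg1pow (dG i ∸ 1))) (fraction I) (neg1pow p^h-1)
        (prodℤ-cong-mod _ _ (λ i → BG.binomial-divisor i (y i I) (subst (+ dG i ∣_) (≡.sym (y+1 i I)) (dvdB⇒∣ (dG i) _
            (allB-true _ inG i))) (dG i ∸ 1) (pred< (dG i) (dG>0 i))))
        (Bh.binomial-divisor (T′ I ℤ.- + 1) (subst (+ (p ℕ.^ h) ∣_) (≡.sym (plus-minus (T′ I))) (dvdB⇒∣ (p ℕ.^ h)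
            (T′ I) inα)) p^h-1 (pred< (p ℕ.^ h) p^h>0)))
      (prodShiftℤ-cong-mod ρs (Pz I) (+ 0) (subst (+ p ∣_) (≡.sym (ℤP.+-identityʳ (Pz I))) (dvdB⇒∣ p (Pz I) inP)))
      where
      inG = proj₁ (member⇒ I h₀)
      inα = proj₁ (proj₂ (proj₂ (member⇒ I h₀)))
      inP = proj₂ (proj₂ (proj₂ (member⇒ I h₀)))

    -- Each way of missing the membership conditions inside `K` has its own factor of F divisible by
    -- p: a coordinate of G, the condition modulo p^h, or a shift P(I) - ρ.
    ¬member⇒p∣F : ∀ I → K I ≡ true → member I ≡ false → + p ∣ F I
    ¬member⇒p∣F I KI h₀ with eqGB dG (sumG cs I) c in eqG
    ... | false = ∣-*ˡ (prodShiftℤ ρs (Pz I)) (∣-*ˡ (fraction I) (∣-prodℤ (λ i → binomial (y i I) (dG i ∸ 1)) i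
          (BG.binomial-nondivisor i (y i I) (dG i ∸ 1) (pred-pos (dG i) (dG>0 i)) (subst (λ z → ¬ + dG i ∣ z) (≡.sym
              (y+1 i I)) (¬dvdB⇒∤ (dG i) _ (proj₂ failing))))))
      where
      failing = allB-false _ eqG
      i = proj₁ failing
    ... | true with dvdB (p ℕ.^ h) (T′ I) in eqT
    ... | false = ∣-*ˡ (prodShiftℤ ρs (Pz I)) (∣-*ʳ (coordinates I)
          (Bh.binomial-nondivisor (T′ I ℤ.- + 1) p^h-1 (pred-pos (p ℕ.^ h) p^h>0)
            (subst (λ z → ¬ + (p ℕ.^ h) ∣ z) (≡.sym (plus-minus (T′ I))) (¬dvdB⇒∤ (p ℕ.^ h) (T′ I) eqT))))
    -- Now I lies in ℐ, so p does not divide P(I). The residue of P(I) is therefore nonzero and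
    -- attained on ℐ, and the product over `ρs` has a factor that it kills.
    ... | true = ∣-*ʳ (coordinates I ℤ.* fraction I) (∣-prodShiftℤ ρs (Pz I) ρ∈ρs p∣P-ρ)
      where
      intPI : isIntB (evalSub P I) ≡ true
      intPI = intP I KI
      p∤P : ¬ + p ∣ Pz I
      p∤P p∣P = true≢false (≡.trans (≡.sym (≡.cong₂ _∧_ (≡.cong₂ _∧_ KI ≡.refl) (≡.cong₂ _∧_ intPI (∣⇒dvdB p (Pz I) p∣P)))) h₀)
        where
        true≢false : true ≡ false → _
        true≢false ()
      ρ = Pz I ℤDM.%ℕ p
      p∣P-ρ : + p ∣ Pz I ℤ.- + ρ
      p∣P-ρ = divides (Pz I ℤDM./ℕ p) (≡.trans (cong (ℤ._- + ρ) (ℤDM.a≡a%ℕn+[a/ℕn]*n (Pz I) p)) (drop (+ ρ)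
          (Pz I ℤDM./ℕ p ℤ.* + p)))
        where
        drop : ∀ a b → a ℤ.+ b ℤ.- a ≡ b
        drop = solve-∀
      ρ>0 : 0 < ρ
      ρ>0 = ℕP.n≢0⇒n>0 λ ρ≡0 → p∤P (subst (+ p ∣_) (≡.trans (cong (λ r → Pz I ℤ.- + r) ρ≡0) (ℤP.+-identityʳ (Pz I))) p∣P-ρ)
      ρ∈ρs : ρ ∈ ρs
      ρ∈ρs = ∈-filter⁺ (λ ρ → T? (attained ρ)) (∈-range⁺ ρ>0 (ℤDM.n%ℕd<d (Pz I) p))
        (Equivalence.from T-≡ (any-true _ (allSubsets k) (∈-allSubsets I) (cong₂ _∧_ (cong₂ _∧_ eqG (cong₂ _∧_ KI eqT))
            (≡.trans (cong (inMultB p) P-ρ≡) (∣⇒dvdB p (Pz I ℤ.- + ρ) p∣P-ρ)))))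
        where
        P-ρ≡ : evalSub P I ℚ.- (ℚ._/_ (+ ρ) 1) ≡ fromℤ (Pz I ℤ.- + ρ)
        P-ρ≡ = ≡.trans (cong₂ ℚ._-_ (P≡ I KI) (/1≡fromℤ (+ ρ))) (≡.sym (fromℤ-sub (Pz I) (+ ρ)))

    -- Up to sign, u is the product of the ρ in `ρs`, all strictly between 0 and p.
    p∤u : ¬ + p ∣ u
    p∤u = ∤-* _ (prodShiftℤ ρs (+ 0)) (∤-* _ (neg1pow p^h-1) (prod-∤ (λ i → dG i ∸ 1)) (sign-∤ p^h-1))
      (shift-∤ ρs (All.tabulate (λ m → ∈-range⁻ {p} (proj₁ (∈-filter⁻ (λ ρ → T? (attained ρ)) m)))))
      where
      ∤-* : ∀ a b → ¬ + p ∣ a → ¬ + p ∣ b → ¬ + p ∣ a ℤ.* b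
      ∤-* a b p∤a p∤b d with euclidsLemma ℤ.∣ a ∣ ℤ.∣ b ∣ pp (subst (p ℕD.∣_) (ℤP.abs-* a b) (∣⇒∣ᵤ d))
      ... | inj₁ p∣a = p∤a (∣ᵤ⇒∣ p∣a)
      ... | inj₂ p∣b = p∤b (∣ᵤ⇒∣ p∣b)
      p∤1ℤ : ¬ + p ∣ + 1
      p∤1ℤ d = ℕ.nonTrivial⇒≢1 {{prime⇒nonTrivial pp}} (ℕD.∣1⇒≡1 (∣⇒∣ᵤ d))
      sign-∤ : ∀ j → ¬ + p ∣ neg1pow j
      sign-∤ zero    = p∤1ℤ
      sign-∤ (suc j) d = sign-∤ j (∣ᵤ⇒∣ (subst (p ℕD.∣_) (ℤP.∣-i∣≡∣i∣ (neg1pow j)) (∣⇒∣ᵤ d)))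
      prod-∤ : ∀ {r} (f : Fin r → ℕ) → ¬ + p ∣ prodℤ (λ i → neg1pow (f i))
      prod-∤ {zero}  f = p∤1ℤ
      prod-∤ {suc r} f = ∤-* (neg1pow (f zero)) _ (sign-∤ (f zero)) (prod-∤ (f ∘ suc))
      shift-∤ : ∀ σs → All (λ ρ → 0 < ρ × ρ < p) σs → ¬ + p ∣ prodShiftℤ σs (+ 0)
      shift-∤ []       []                    = p∤1ℤ
      shift-∤ (ρ ∷ σs) ((0<ρ , ρ<p) ∷ h) = ∤-* (+ 0 ℤ.- + ρ) _ (λ d → ℕP.<⇒≱ ρ<p (ℕD.∣⇒≤ {{ℕ.>-nonZero 0<ρ}}
          (subst (p ℕD.∣_) (≡.trans (cong ℤ.∣_∣ (ℤP.+-identityˡ (ℤ.- (+ ρ)))) (ℤP.∣-i∣≡∣i∣ (+ ρ))) (∣⇒∣ᵤ d)))) (shift-∤ σs h)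

    -- A member attains the residue 0, the one residue that `ρs` leaves out.
    residueCount≡ : ∀ I → member I ≡ true → residueCount p ℐ P ≡ suc (length ρs)
    residueCount≡ I h₀ = go p p>0
      where
      p>0 : 0 < p
      p>0 = ℕ.>-nonZero⁻¹ p
      P-0 : evalSub P I ℚ.- (ℚ._/_ (+ 0) 1) ≡ evalSub P I
      P-0 = ≡.trans (cong (evalSub P I ℚ.+_) (cong ℚ.-_ (/1≡fromℤ (+ 0)))) (ℚP.+-identityʳ (evalSub P I))
      attained-0 : attained 0 ≡ true
      attained-0 = any-true _ (allSubsets k) (∈-allSubsets I) (≡.trans (cong (λ x → ℐ I ∧ inMultB p x) P-0) h₀)
      go : ∀ q → 0 < q → length (filterᵇ attained (L.upTo q)) ≡ suc (length (filterᵇ attained (L.drop 1 (L.upTo q))))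
      go (suc q) _ with attained 0 | attained-0
      ... | true | _ = ≡.refl

    -- Passage to ℤ[ζ] and divisibility by p.

    b : Fin k → ℤ
    b s = a s ℤ.* m s ℤ.* + cofactor s

    term : Subset k → Carrier
    term I = ι (neg1pow (card I)) * ζℤ (weightSum b I)

    ev = Evaluation.ev A ζ

    ev-rootSum : ∀ Is → ev (rootSum a m n Is) ≈ sumL Is term
    ev-rootSum []       = refl
    ev-rootSum (I ∷ Is) = trans (Evaluation.ev-add A ζ (monoP (neg1pow (card I)) (resid (expo a m n I) N)) (rootSum a m n Is))
      (+-cong (Evaluation.ev-mono A ζ (neg1pow (card I)) (resid (expo a m n I) N)) (ev-rootSum Is))

    weighted : (Subset k → ℤ) → Subset k → Carrier
    weighted g I = ι (neg1pow (card I)) * (ι (g I) * ζℤ (weightSum b I))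

    Ksum : (Subset k → ℤ) → Carrier
    Ksum g = sumL (allSubsets k) (λ I → if K I then weighted g I else 0#)

    -- The `suc` of the strict degree bound is absorbed by p^h - 1, which is the degree of the
    -- binomial in the fractional sum.
    degree-bound : d ℕ.* length ρs ≤ Δ → suc (dstar dG ℕ.+ p^h-1 ℕ.+ d ℕ.* length ρs) ≤ dstar dG ℕ.+ p ℕ.^ h ℕ.+ Δ
    degree-bound len = subst (_≤ dstar dG ℕ.+ p ℕ.^ h ℕ.+ Δ) (≡.trans (cong (λ q → dstar dG ℕ.+ q ℕ.+ d ℕ.* length ρs)
        (pred-pos (p ℕ.^ h) p^h>0))
        (cong (ℕ._+ d ℕ.* length ρs) (ℕP.+-suc (dstar dG) p^h-1)))
      (ℕP.+-monoʳ-≤ (dstar dG ℕ.+ p ℕ.^ h) len)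

    covered : ∀ x s → dvdB (n s) (+ x ℤ.- a s) ≡ true → + N ∣ b s ℤ.- + x ℤ.* mN s
    covered x s ts with dvdB⇒∣ (n s) (+ x ℤ.- a s) ts
    ... | divides q eq = divides (ℤ.- (q ℤ.* m s)) (≡.trans (factor (a s) (m s) (+ cofactor s) (+ x))
          (≡.trans (cong (λ z → ℤ.- z ℤ.* (m s ℤ.* + cofactor s)) eq) (≡.trans (regroup q (+ n s) (m s) (+ cofactor s))
            (cong (ℤ._*_ (ℤ.- (q ℤ.* m s))) (≡.sym (≡.trans (cong +_ (cofactor-* s)) (ℤP.pos-* (cofactor s) (n s))))))))
      where
      factor : ∀ a m c x → a ℤ.* m ℤ.* c ℤ.- x ℤ.* (m ℤ.* c) ≡ ℤ.- (x ℤ.- a) ℤ.* (m ℤ.* c)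
      factor = solve-∀
      regroup : ∀ q n m c → ℤ.- (q ℤ.* n) ℤ.* (m ℤ.* c) ≡ ℤ.- (q ℤ.* m) ℤ.* (c ℤ.* n)
      regroup = solve-∀

    Ksum-F̃ : ∀ I₀ → K I₀ ≡ true → d ℕ.* length ρs ≤ Δ → ∀ D (g : Subset k → ℤ) → (∀ I → fromℤ (g I) ≡ fromℤ
        (+ D) ℚ.* F̃ I) → Ksum g ≈ 0#
    Ksum-F̃ I₀ KI₀ len D g eq = Filter.filter-sum R ratAlg fromℤ-injective-0 B g b mN (λ x s → dvdB (n s) (+ x ℤ.- a s))
      (DegLt-cong {k} (λ I → ≡.sym (eq I)) (DegLt-* {k} 1 B (DegLt-const {k} (fromℤ (+ D))) deg-F̃))
      (λ x → ℕP.≤-trans (degree-bound len) (cover (+ x)))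
      covered (weightSum mN I₀) K (λ I KI → K⇒∣ I₀ I KI₀ KI) λ I ¬KI d → false≢true (≡.trans (≡.sym ¬KI) (∣⇒K I₀ I KI₀ d))
      where
      B = suc (dstar dG ℕ.+ p^h-1 ℕ.+ d ℕ.* length ρs)
      false≢true : ¬ false ≡ true
      false≢true ()

    -- A multiple D·F̃ is integral on all subsets, so the filter applies to it; on `K` it equals
    -- D·fac·F. Hence D·fac annihilates the sum of F, and ℤ[ζ] is torsion-free. The subset `I₀`
    -- fixes the class modulo N.
    Ksum-F : ∀ I₀ → K I₀ ≡ true → d ℕ.* length ρs ≤ Δ → Ksum F ≈ 0#
    Ksum-F I₀ KI₀ len = clear (clear-denominators F̃)
      where
      clear : (∃ λ D → NonZero D × ∃ λ (g : Subset k → ℤ) → ∀ I → fromℤ (g I) ≡ fromℤ (+ D) ℚ.* F̃ I) → Ksum F ≈ 0#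
      clear (D , D≢0 , g , eq) = torsion-free (D ℕ.* fac) {{ℕP.m*n≢0 D fac {{D≢0}} {{fac≢0}}}} (Ksum F)
        (trans (sumL-* (ι (+ (D ℕ.* fac))) (allSubsets k) _) (trans (sumL-cong (allSubsets k) pointwise)
            (Ksum-F̃ I₀ KI₀ len D g eq)))
        where
        fac≢0 : NonZero fac
        fac≢0 = ℕP.m*n≢0 _ _ {{prodℕ≢0 (λ i → (dG i ∸ 1) !) (λ i → (dG i ∸ 1) ℕP.!≢0)}} {{p^h-1 ℕP.!≢0}}
        g≡ : ∀ I → K I ≡ true → g I ≡ + (D ℕ.* fac) ℤ.* F I
        g≡ I KI = fromℤ-injective (≡.trans (eq I) (≡.trans (cong (fromℤ (+ D) ℚ.*_) (F̃≡fac*F I KI)) (≡.trans (≡.sym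
            (fromℤ-* (+ D) (+ fac ℤ.* F I)))
          (cong fromℤ (≡.trans (≡.sym (ℤP.*-assoc (+ D) (+ fac) (F I))) (cong (ℤ._* F I) (≡.sym (ℤP.pos-* D fac))))))))
        pointwise : ∀ I → ι (+ (D ℕ.* fac)) * (if K I then weighted F I else 0#) ≈ (if K I then weighted g I else 0#)
        pointwise I with K I in KI
        ... | false = zeroʳ _
        ... | true = scaled (+ (D ℕ.* fac)) (neg1pow (card I)) (F I) (g I) (ζℤ (weightSum b I)) (g≡ I KI)

    F-mod-p : ∀ I → ∃ λ Q → (if K I then weighted F I else 0#) ≈ ι u * (if member I then term I else 0#) + ι (+ p) * Q
    F-mod-p I = go (K I) (member I) ≡.refl ≡.refl
     where
     go : ∀ κ μ → K I ≡ κ → member I ≡ μ → ∃ λ Q → (if κ then weighted F I else 0#) ≈ ι u *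
         (if μ then term I else 0#) + ι (+ p) * Q
     go false false KI MI = 0# , sym (trans (+-cong (zeroʳ _) (zeroʳ _)) (+-identityˡ 0#))
     go false true  KI MI with ≡.trans (≡.sym KI) (proj₁ (proj₂ (member⇒ I MI)))
     ... | ()
     go true  false KI MI = multiple (neg1pow (card I)) (F I) u (+ p) (ζℤ (weightSum b I)) (¬member⇒p∣F I KI MI)
     go true  true  KI MI = congruent (neg1pow (card I)) (F I) u (+ p) (ζℤ (weightSum b I)) (member⇒F≡u I MI)

    -- Modulo p, F is u on members and 0 on the rest of `K`, so uS + p·ΣQ = 0. With vu + ωp = 1,
    -- multiplying by v gives S = p(ωS - v·ΣQ).
    core : ∀ I₀ → member I₀ ≡ true → d ℕ.* length ρs ≤ Δ → ∃ λ Q → sumL (ℐp p ℐ P) term ≈ ι (+ p) * Q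
    core I₀ MI₀ len = ι ω * S + - (ι v * ΣQ) , trans (sumL-filter member (allSubsets k) term) (begin
      S                                            ≈⟨ *-identityˡ S ⟨
      1# * S                                       ≈⟨ *-congʳ (trans (sym ι-1) (trans (ι-cong (≡.sym vw)) (trans (ι-+
          (v ℤ.* u) (ω ℤ.* + p)) (+-cong (ι-* v u) (ι-* ω (+ p)))))) ⟩
      (ι v * ι u + ι ω * ι (+ p)) * S              ≈⟨ solve 6 (λ v u ω p s q → (v :* u :+ ω :* p) :* s := v :*
          (u :* s :+ p :* q) :+ p :* (ω :* s :+ :- (v :* q))) refl (ι v) (ι u) (ι ω) (ι (+ p)) S ΣQ ⟩
      ι v * (ι u * S + ι (+ p) * ΣQ) + ι (+ p) * (ι ω * S + - (ι v * ΣQ))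
                                                   ≈⟨ +-congʳ (trans (*-congˡ uS+pQ≈0) (zeroʳ (ι v))) ⟩
      0# + ι (+ p) * (ι ω * S + - (ι v * ΣQ))      ≈⟨ +-identityˡ _ ⟩
      ι (+ p) * (ι ω * S + - (ι v * ΣQ))           ∎)
      where
      open SR setoid
      S ΣQ : Carrier
      S = sumL (allSubsets k) (λ I → if member I then term I else 0#)
      ΣQ = sumL (allSubsets k) (λ I → proj₁ (F-mod-p I))
      v = proj₁ (bezout pp u p∤u)
      ω = proj₁ (proj₂ (bezout pp u p∤u))
      vw = proj₂ (proj₂ (bezout pp u p∤u))
      uS+pQ≈0 : ι u * S + ι (+ p) * ΣQ ≈ 0#
      uS+pQ≈0 = begin
        ι u * S + ι (+ p) * ΣQ   ≈⟨ +-cong (sumL-* (ι u) (allSubsets k) _) (sumL-* (ι (+ p)) (allSubsets k) _) ⟩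
        sumL (allSubsets k) (λ I → ι u * (if member I then term I else 0#)) + sumL (allSubsets k) (λ I → ι (+ p) * proj₁
            (F-mod-p I))
                                 ≈⟨ sumL-+ (allSubsets k) _ _ ⟩
        sumL (allSubsets k) (λ I → ι u * (if member I then term I else 0#) + ι (+ p) * proj₁ (F-mod-p I))
                                 ≈⟨ sumL-cong (allSubsets k) (λ I → sym (proj₂ (F-mod-p I))) ⟩
        Ksum F                   ≈⟨ Ksum-F I₀ (proj₁ (proj₂ (member⇒ I₀ MI₀))) len ⟩
        0#                       ∎

    -- A single term is ±ζ^E, a unit; a multiple of p among the units would make p itself a unit of
    -- ℤ[ζ].
    length≢1 : ∀ Is → (∃ λ Q → sumL Is term ≈ ι (+ p) * Q) → length Is ≢ 1
    length≢1 (I ∷ []) (Q , h₀) _ = p∤1 p pp (Q * (σ * ζℤ (ℤ.- E))) (begin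
      1#                                  ≈⟨ trans (*-congˡ (ζℤ-unit E)) (trans (*-identityʳ _) (trans (sym (ι-* s s))
          (trans (ι-cong (sign² (card I))) ι-1))) ⟨
      (σ * σ) * (ζℤ E * ζℤ (ℤ.- E))       ≈⟨ solve 4 (λ s z y o → s :* s :* (z :* y) := (s :* z) :* (s :* y)) refl σ
          (ζℤ E) (ζℤ (ℤ.- E)) 0# ⟩
      (σ * ζℤ E) * (σ * ζℤ (ℤ.- E))       ≈⟨ *-congʳ (trans (sym (+-identityʳ _)) h₀) ⟩
      ι (+ p) * Q * (σ * ζℤ (ℤ.- E))      ≈⟨ *-assoc (ι (+ p)) Q _ ⟩
      ι (+ p) * (Q * (σ * ζℤ (ℤ.- E)))    ∎)
      where
      open SR setoid
      E = weightSum b I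
      s = neg1pow (card I)
      σ = ι s
      neg-neg : ∀ x → ℤ.- x ℤ.* ℤ.- x ≡ x ℤ.* x
      neg-neg = solve-∀
      sign² : ∀ j → neg1pow j ℤ.* neg1pow j ≡ + 1
      sign² zero    = ≡.refl
      sign² (suc j) = ≡.trans (neg-neg (neg1pow j)) (sign² j)

    -- The quotient Q of the sum by p satisfies a monic relation of degree τ. Multiplied by p^τ,
    -- with p^τ = p^(τ-i)·p^i in the i-th term, it becomes the relation for pQ that `InPΩ` asks for.
    inPΩ : ∀ Is → (∃ λ Q → sumL Is term ≈ ι (+ p) * Q) → InPΩ N p (rootSum a m n Is)
    inPΩ Is (Q , h₀) = conclude (integral Q)
      where
      open SR setoid
      y₀ : ZPoly
      y₀ = rootSum a m n Is
      y≈pQ : ev y₀ ≈ ι (+ p) * Q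
      y≈pQ = trans (ev-rootSum Is) h₀
      ι-pow : ∀ j → ι (+ (p ℕ.^ j)) ≈ ι (+ p) ^ j
      ι-pow zero    = ι-1
      ι-pow (suc j) = trans (ι-cong (ℤP.pos-* p (p ℕ.^ j))) (trans (ι-* (+ p) (+ (p ℕ.^ j))) (*-congˡ (ι-pow j)))
      ev-pow : ∀ j → ev (powP y₀ j) ≈ ι (+ p) ^ j * Q ^ j
      ev-pow j = trans (Evaluation.ev-pow A ζ y₀ j) (trans (^-congˡ j y≈pQ) (^-distrib-* (ι (+ p)) Q j))
      conclude : (∃ λ t → ∃ λ (c : Vec ℤ t) → Q ^ t + sumL (L.allFin t) (λ i → ι (lookup c i) * Q ^ toℕ i) ≈ 0#) → InPΩ N p y₀
      conclude (τ , cf , rel) = τ , cf , vanishes (addP (powP y₀ τ) (L.foldr addP [] (L.map summand (L.allFin τ)))) (begin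
        ev (addP (powP y₀ τ) (L.foldr addP [] (L.map summand (L.allFin τ))))
          ≈⟨ Evaluation.ev-add A ζ (powP y₀ τ) _ ⟩
        ev (powP y₀ τ) + ev (L.foldr addP [] (L.map summand (L.allFin τ)))
          ≈⟨ +-cong (ev-pow τ) (ev-sum (L.allFin τ)) ⟩
        ι (+ p) ^ τ * Q ^ τ + ι (+ p) ^ τ * sumL (L.allFin τ) (λ i → ι (lookup cf i) * Q ^ toℕ i)
          ≈⟨ distribˡ (ι (+ p) ^ τ) (Q ^ τ) _ ⟨
        ι (+ p) ^ τ * (Q ^ τ + sumL (L.allFin τ) (λ i → ι (lookup cf i) * Q ^ toℕ i))
          ≈⟨ trans (*-congˡ rel) (zeroʳ _) ⟩
        0# ∎)
        where
        summand : Fin τ → ZPoly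
        summand i = scaleP (lookup cf i ℤ.* (+ (p ℕ.^ (τ ∸ toℕ i)))) (powP y₀ (toℕ i))
        ev-summand : ∀ i → ev (summand i) ≈ ι (+ p) ^ τ * (ι (lookup cf i) * Q ^ toℕ i)
        ev-summand i = begin
          ev (summand i)
            ≈⟨ trans (Evaluation.ev-scale A ζ (lookup cf i ℤ.* (+ (p ℕ.^ (τ ∸ toℕ i)))) (powP y₀ (toℕ i))) (*-cong
                (trans (ι-* (lookup cf i) (+ (p ℕ.^ (τ ∸ toℕ i)))) (*-congˡ (ι-pow (τ ∸ toℕ i)))) (ev-pow (toℕ i))) ⟩
          (ι (lookup cf i) * ι (+ p) ^ (τ ∸ toℕ i)) * (ι (+ p) ^ toℕ i * Q ^ toℕ i)
            ≈⟨ solve 4 (λ c x y q → c :* x :* (y :* q) := x :* y :* (c :* q)) refl (ι (lookup cf i)) (ι (+ p) ^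
                (τ ∸ toℕ i)) (ι (+ p) ^ toℕ i) (Q ^ toℕ i) ⟩
          ι (+ p) ^ (τ ∸ toℕ i) * ι (+ p) ^ toℕ i * (ι (lookup cf i) * Q ^ toℕ i)
            ≈⟨ *-congʳ (trans (sym (^-homo-* (ι (+ p)) (τ ∸ toℕ i) (toℕ i))) (^-congʳ (ι (+ p)) (ℕP.m∸n+n≡m (ℕP.<⇒≤
                (FinP.toℕ<n i))))) ⟩
          ι (+ p) ^ τ * (ι (lookup cf i) * Q ^ toℕ i) ∎
        ev-sum : ∀ is → ev (L.foldr addP [] (L.map summand is)) ≈ ι (+ p) ^ τ * sumL is (λ i → ι (lookup cf i) * Q ^ toℕ i)
        ev-sum []       = sym (zeroʳ _)
        ev-sum (i ∷ is) = trans (Evaluation.ev-add A ζ (summand i) _) (trans (+-cong (ev-summand i) (ev-sum is)) (sym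
            (distribˡ (ι (+ p) ^ τ) _ _)))

    Conclusion : List (Subset k) → Set
    Conclusion Is = (d ℕ.* residueCount p ℐ P ℕ.> d ℕ.+ Δ) ⊎ ((length Is ≢ 1) × InPΩ N p (rootSum a m n Is))

    result : Conclusion (ℐp p ℐ P)
    result = go (ℐp p ℐ P) ≡.refl
      where
      go : ∀ Is → ℐp p ℐ P ≡ Is → Conclusion Is
      -- Without members the count is 0 and the sum is empty, so the second alternative holds
      -- outright; beyond this point a member is available.
      go []        eq = inj₂ ((λ ()) , inPΩ [] (0# , sym (zeroʳ _)))
      go (I₀ ∷ Is) eq with d ℕ.+ Δ ℕP.<? d ℕ.* residueCount p ℐ P
      ... | yes big = inj₁ big
      ... | no ¬big = inj₂ (length≢1 (I₀ ∷ Is) divisible , inPΩ (I₀ ∷ Is) divisible)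
        where
        MI₀ : member I₀ ≡ true
        MI₀ = Equivalence.to T-≡ (proj₂ (∈-filter⁻ (λ I → T? (member I)) {xs = allSubsets k} (subst (I₀ ∈_) (≡.sym eq)
            (here ≡.refl))))
        len : d ℕ.* length ρs ≤ Δ
        -- With 1 + |`ρs`| residues, failure of the first alternative reads d + d·|`ρs`| ≤ d + Δ.
        len = ℕP.+-cancelˡ-≤ d _ _ (subst (_≤ d ℕ.+ Δ) (≡.trans (cong (d ℕ.*_) (residueCount≡ I₀ MI₀)) (ℕP.*-suc d
            (length ρs))) (ℕP.≮⇒≥ ¬big))
        divisible : ∃ λ Q → sumL (I₀ ∷ Is) term ≈ ι (+ p) * Q
        divisible = subst (λ Js → ∃ λ Q → sumL Js term ≈ ι (+ p) * Q) eq (core I₀ MI₀ len)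

open import Data.Nat using (ℕ; NonZero; _+_; _*_; _^_; _≤_; _<_; _>_)
open import Data.Nat.Divisibility using (_∣_)
open import Data.Nat.Primality using (Prime)
open import Data.Integer using (ℤ)
open import Data.Rational as ℚ using (ℚ)
open import Data.Fin using (Fin; toℕ)
open import Data.List using (length)
open import Data.Product using (∃; _×_; _,_)
open import Data.Sum using (_⊎_)
open import Relation.Binary.PropositionalEquality using (_≡_; _≢_)
open CyclotomicPolynomials using (cyclotomic)
open RootsOfUnity using (RootRing; rootRing)
open ZeroSums

theorem3p1 : (p : ℕ) → Prime p →
    (r : ℕ) (dG : Fin r → ℕ) → (∀ i → 1 < dG i) → (∀ i j → toℕ i ≤ toℕ j → dG i ∣ dG j) →
    (∃ λ e → prodℕ dG ≡ p ^ e) →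
    (h Δ : ℕ) →
    (k : ℕ) (a : Fin k → ℤ) (n : Fin k → ℕ) (nz : ∀ s → NonZero (n s)) →
    IsCover (dstar dG + p ^ h + Δ) a n →
    (m : Fin k → ℤ) (c : Grp r) (cs : Fin k → Grp r) (α : ℚ) →
    (d : ℕ) → 1 ≤ d → (P : Poly k) → DegLe d P →
    (∀ (I : Subset k) → IsInt (ratSum m n nz I ℚ.- α) → IsInt (evalSub P I)) →
    (d * residueCount p (inℐB p h dG c cs m n nz α) P > d + Δ)
    ⊎ ((length (ℐp p (inℐB p h dG c cs m n nz α) P) ≢ 1)
    × InPΩ (prodℕ n) p (rootSum a m n (ℐp p (inℐB p h dG c cs m n nz α) P)))
theorem3p1 p pp r dG dG>1 dG∣ (e , |G|) h Δ k a n nz cover m c cs α d 1≤d P degP intP =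
  Main.result p pp dG dG>1 e |G| h Δ a n nz cover m c cs α d 1≤d P degP intP root
  where
  root : RootRing (prodℕ n)
  root = rootRing (prodℕ n) {{prodℕ≢0 n nz}} (cyclotomic (prodℕ n) {{prodℕ≢0 n nz}})
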